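{- Let $M_G$ be a mixed graph with vertex set $V$ and edge set $E$, and let $V_1\subseteq V$ be nonempty. Then \[\det(Q[V_1])=\sum_{M_R}3^{\tau_1}4^{\tau_2},\] where the sum runs over all substructures $M_R$ with vertex set $V_1$ (i.e. over all edge subsets $E_1\subseteq E$ with $|E_1|=|V_1|$) that are substructures of type II, and $\tau_1$, $\tau_2$ are the numbers of components of $M_R$ that are unicyclic graphs belonging to $\Psi_2$ and to $\Psi_3$, respectively. Here $Q[V_1]$ is the principal submatrix of $Q(M_G)$ with rows and columns indexed by $V_1$.
   Context: All graphs are simple, finite and connected. A mixed graph $M_G$ is obtained from a graph $G$ (its underlying graph) by giving directions to some edges. Let $\omega=\frac{1+\sqrt{3}\mathbf{i}}{2}$. $N(M_G)=(n_{ij})$ has $n_{ij}=1$ if $v_i,v_j$ are joined by an undirected edge, $n_{ij}=\omega$ if there is an edge directed $v_i\to v_j$, $n_{ij}=\overline{\omega}$ if directed $v_j\to v_i$, and $0$ otherwise; $Q(M_G)=D(M_G)+N(M_G)$ where $D(M_G)$ is the degree diagonal matrix of $G$. A substructure $M_R$ with vertex subset $V_1\subseteq V$ and edge subset $E_1\subseteq E$ consists of these vertices and edges (an edge of $E_1$ may have one or no endpoint in $V_1$); it is square if $|V_1|=|E_1|$. Its components are the connected pieces of the structure with vertices $V_1$ and edges $E_1$, where each edge of $E_1$ joins those of its endpoints lying in $V_1$ (an edge with no endpoint in $V_1$ is a component on its own). A component is a rootless tree if it is obtained from a tree by deleting one vertex (the root) while keeping the incident edge as an edge with only one endpoint; equivalently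 its edges with both endpoints in $V_1$ form a tree on its vertices and it contains exactly one edge of $E_1$ with exactly one endpoint in $V_1$. A component is a unicyclic graph if all its edges have both endpoints in $V_1$ and it is a connected graph with exactly one cycle. For a mixed cycle, fix a cyclic traversal direction; let $a$ (resp. $b$) be the number of directed edges oriented along (resp. against) the traversal, and $c$ the number of undirected edges. The cycle belongs to $\Psi_1$ if $a-b\equiv 1,2,4$ or $5\pmod 6$ and $c$ is odd; to $\Psi_2$ if $a-b\equiv 1,2,4$ or $5\pmod 6$ and $c$ is even; to $\Psi_3$ if $a-b\equiv 0$ or $3\pmod 6$ and $c$ is odd; to $\Psi_4$ if $a-b\equiv 0$ or $3\pmod 6$ and $c$ is even. A unicyclic mixed graph belongs to the class of its cycle. A square substructure is of type II if each of its components is either a rootless tree or a unicyclic graph not belonging to $\Psi_4$. -}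

module Defs where

open import Data.Nat as ℕ using (ℕ; zero; suc; _^_; _≟_)
open import Data.Integer as ℤ using (ℤ; +_; _%ℕ_)
open import Data.Fin using (Fin; zero; suc)
import Data.Fin as F
open import Data.Fin.Subset using (Subset; _∈_; ∣_∣)
open import Data.Bool using (Bool; true; false; if_then_else_; _∧_; _∨_)
open import Data.Vec using (Vec; []; _∷_)
open import Data.List using (List; []; _∷_; map; length; filter; _++_; lookup)
open import Data.Nat.ListAction using (sum)
open import Data.Product using (Σ; ∃; _×_; _,_; proj₁)
open import Data.Sum using (_⊎_)
open import Relation.Nullary using (¬_; does)
open import Relation.Binary.PropositionalEquality using (_≡_; _≢_)
open import Relation.Binary.Construct.Closure.ReflexiveTransitive using (Star)
open import Relation.Binary.Construct.Closure.Symmetric using (SymClosure)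
open import Function using (_∘_)

-- Eisenstein integers ℤ[ω], ω = (1 + √3 i)/2.  The element  re + im·ω.
-- ω² = ω − 1  and  ω̄ = 1 − ω.  Every entry of Q(M_G) lies in ℤ[ω], and
-- this representation is faithful (1, ω is a ℤ-basis), so ≡ is equality
-- of complex numbers.

record ℤω : Set where
  constructor _+_ω
  field
    re : ℤ
    im : ℤ
open ℤω public

infixl 6 _⊕_
infixl 7 _⊗_

_⊕_ : ℤω → ℤω → ℤω
(a + b ω) ⊕ (c + d ω) = (a ℤ.+ c) + (b ℤ.+ d) ω

_⊗_ : ℤω → ℤω → ℤω
(a + b ω) ⊗ (c + d ω) = (a ℤ.* c ℤ.- b ℤ.* d) + (a ℤ.* d ℤ.+ b ℤ.* c ℤ.+ b ℤ.* d) ω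

⊖_ : ℤω → ℤω
⊖ (a + b ω) = (ℤ.- a) + (ℤ.- b) ω

𝟘 𝟙 ω ω̄ : ℤω
𝟘 = (+ 0) + (+ 0) ω
𝟙 = (+ 1) + (+ 0) ω
ω = (+ 0) + (+ 1) ω
ω̄ = (+ 1) + (ℤ.- (+ 1)) ω

fromℕ : ℕ → ℤω
fromℕ k = (+ k) + (+ 0) ω

sumFin : ∀ {k} → (Fin k → ℤω) → ℤω
sumFin {zero}  f = 𝟘
sumFin {suc k} f = f zero ⊕ sumFin (f ∘ suc)

sumFinℕ : ∀ {k} → (Fin k → ℕ) → ℕ
sumFinℕ {zero}  f = 0
sumFinℕ {suc k} f = f zero ℕ.+ sumFinℕ (f ∘ suc)

countFin : ∀ {k} → (Fin k → Bool) → ℕ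
countFin p = sumFinℕ (λ i → if p i then 1 else 0)

Matrix : ℕ → Set
Matrix k = Fin k → Fin k → ℤω

signω : ℕ → ℤω
signω zero          = 𝟙
signω (suc zero)    = ⊖ 𝟙
signω (suc (suc j)) = signω j

det : ∀ {k} → Matrix k → ℤω
det {zero}  M = 𝟙
det {suc k} M =
  sumFin (λ j → signω (F.toℕ j) ⊗ M zero j ⊗ det (λ r c → M (suc r) (F.punchIn j c)))

-- Mixed graphs.  Vertices Fin n, edges Fin m.  An edge has two endpoints
-- src, tgt; if 'directed' is true it is oriented src → tgt, otherwise it
-- is undirected.

record MEdge (n : ℕ) : Set where
  field
    src      : Fin n
    tgt      : Fin n
    directed : Bool
open MEdge public

MixedGraph : ℕ → ℕ → Set
MixedGraph n m = Fin m → MEdge n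

module _ {n m : ℕ} (G : MixedGraph n m) where

  Joins : Fin m → Fin n → Fin n → Set
  Joins e u v = (src (G e) ≡ u × tgt (G e) ≡ v) ⊎ (src (G e) ≡ v × tgt (G e) ≡ u)

  EndPt : Fin n → Fin m → Set
  EndPt v e = (v ≡ src (G e)) ⊎ (v ≡ tgt (G e))

  Adjacent : Fin n → Fin n → Set
  Adjacent u v = ∃ λ e → Joins e u v

  IsSimple : Set
  IsSimple = (∀ e → src (G e) ≢ tgt (G e))
           × (∀ e e' → Joins e' (src (G e)) (tgt (G e)) → e ≡ e')

  IsConnected : Set
  IsConnected = ∀ u v → Star Adjacent u v

  eqb : Fin n → Fin n → Bool
  eqb i j = does (i F.≟ j)

  nEntry : Fin m → Fin n → Fin n → ℤω
  nEntry e i j =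
    if eqb (src (G e)) i ∧ eqb (tgt (G e)) j
      then (if directed (G e) then ω else 𝟙)
      else (if eqb (src (G e)) j ∧ eqb (tgt (G e)) i
              then (if directed (G e) then ω̄ else 𝟙)
              else 𝟘)

  NMat : Fin n → Fin n → ℤω
  NMat i j = sumFin (λ e → nEntry e i j)

  degree : Fin n → ℕ
  degree i = countFin (λ e → eqb (src (G e)) i ∨ eqb (tgt (G e)) i)

  QMat : Fin n → Fin n → ℤω
  QMat i j = (if eqb i j then fromℕ (degree i) else 𝟘) ⊕ NMat i j

elems : ∀ {n} → Subset n → List (Fin n)
elems []            = []
elems (true  ∷ p)   = zero ∷ map suc (elems p)
elems (false ∷ p)   = map suc (elems p)

principal : ∀ {n} → (Fin n → Fin n → ℤω) → (V₁ : Subset n) → Matrix (length (elems V₁))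
principal A V₁ i j = A (lookup (elems V₁) i) (lookup (elems V₁) j)

allSubsets : (m : ℕ) → List (Subset m)
allSubsets zero    = [] ∷ []
allSubsets (suc m) = map (true ∷_) (allSubsets m) ++ map (false ∷_) (allSubsets m)

sumSubsetsOfSize : ∀ {m} → ℕ → (Subset m → ℕ) → ℕ
sumSubsetsOfSize {m} k w = sum (map w (filter (λ E₁ → ∣ E₁ ∣ ≟ k) (allSubsets m)))

next : ∀ {k} → Fin (suc k) → Fin (suc k)
next {zero}  zero    = zero
next {suc k} zero    = suc zero
next {suc k} (suc i) with next {k} i
... | zero  = zero
... | suc j = suc (suc j)

data Psi : Set where
  ψ₁ ψ₂ ψ₃ ψ₄ : Psi

-- r = (a − b) mod 6,  c = number of undirected edges
psiOf : ℕ → ℕ → Psi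
psiOf r c =
  if does (r ≟ 0) ∨ does (r ≟ 3)
    then (if does (c ℕ.% 2 ≟ 1) then ψ₃ else ψ₄)
    else (if does (c ℕ.% 2 ≟ 1) then ψ₁ else ψ₂)

module Substructure {n m : ℕ} (G : MixedGraph n m) (V₁ : Subset n) (E₁ : Subset m) where

  open import Data.Sum using (inj₁; inj₂)

  Elem : Set
  Elem = Fin n ⊎ Fin m

  Member : Elem → Set
  Member (inj₁ v) = v ∈ V₁
  Member (inj₂ e) = e ∈ E₁

  Inc : Elem → Elem → Set
  Inc (inj₁ v) (inj₂ e) = v ∈ V₁ × e ∈ E₁ × EndPt G v e
  Inc _        _        = Data.Empty.⊥
    where import Data.Empty

  Linked : Elem → Elem → Set
  Linked = Star (SymClosure Inc)

  OneEndIn : Fin m → Set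
  OneEndIn e = (src (G e) ∈ V₁ × ¬ (tgt (G e) ∈ V₁)) ⊎ (¬ (src (G e) ∈ V₁) × tgt (G e) ∈ V₁)

  BothEndsIn : Fin m → Set
  BothEndsIn e = src (G e) ∈ V₁ × tgt (G e) ∈ V₁

  -- A decomposition of M_R into its components: labels Fin t, every
  -- label used, incident elements share a label, equally labelled
  -- elements are linked.  Hence label classes = components.
  record Components : Set where
    field
      t       : ℕ
      lab     : Elem → Fin t
      onto    : ∀ l → ∃ λ x → Member x × lab x ≡ l
      respect : ∀ x y → Inc x y → lab x ≡ lab y
      linked  : ∀ x y → Member x → Member y → lab x ≡ lab y → Linked x y

  module InComponents (C : Components) where
    open Components C

    VIn : Fin t → Fin n → Set
    VIn l v = v ∈ V₁ × lab (inj₁ v) ≡ l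

    EIn : Fin t → Fin m → Set
    EIn l e = e ∈ E₁ × lab (inj₂ e) ≡ l

    InnerAdj : Fin t → Fin n → Fin n → Set
    InnerAdj l u v = ∃ λ e → EIn l e × BothEndsIn e × Joins G e u v

    InnerConnected : Fin t → Set
    InnerConnected l = ∀ u v → VIn l u → VIn l v → Star (InnerAdj l) u v

    record Cycle (l : Fin t) : Set where
      field
        len   : ℕ
        vs    : Fin (3 ℕ.+ len) → Fin n
        es    : Fin (3 ℕ.+ len) → Fin m
        vsInj : ∀ i j → vs i ≡ vs j → i ≡ j
        vsIn  : ∀ i → VIn l (vs i)
        esIn  : ∀ i → es i ∈ E₁
        esJ   : ∀ i → Joins G (es i) (vs i) (vs (next i))

      along : Fin (3 ℕ.+ len) → Bool
      along i = directed (G (es i)) ∧ does (src (G (es i)) F.≟ vs i)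

      against : Fin (3 ℕ.+ len) → Bool
      against i = directed (G (es i)) ∧ does (tgt (G (es i)) F.≟ vs i)

      undirected : Fin (3 ℕ.+ len) → Bool
      undirected i = if directed (G (es i)) then false else true

      a b c : ℕ
      a = countFin along
      b = countFin against
      c = countFin undirected

      psi : Psi
      psi = psiOf (((+ a) ℤ.- (+ b)) %ℕ 6) c

    OnCycle : ∀ {l} → Cycle l → Fin m → Set
    OnCycle C e = ∃ λ i → Cycle.es C i ≡ e

    RootlessTree : Fin t → Set
    RootlessTree l =
        InnerConnected l
      × ¬ Cycle l
      × (∃ λ e → (EIn l e × OneEndIn e) × (∀ e' → EIn l e' → OneEndIn e' → e' ≡ e))

    -- unicyclic graph: all edges have both endpoints in V₁, connected,
    -- exactly one cycle (cycles identified by their edge sets)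
    Unicyclic : Fin t → Set
    Unicyclic l =
        (∀ e → EIn l e → BothEndsIn e)
      × InnerConnected l
      × Cycle l
      × (∀ (C₁ C₂ : Cycle l) e → (OnCycle C₁ e → OnCycle C₂ e) × (OnCycle C₂ e → OnCycle C₁ e))

  data Kind : Set where
    tree : Kind
    uni  : Psi → Kind

  record TypeII : Set where
    field
      comps : Components
    open Components comps public
    open InComponents comps public
    field
      kind   : Fin t → Kind
      kindOK : ∀ l → (kind l ≡ tree → RootlessTree l)
                   × (∀ p → kind l ≡ uni p → Unicyclic l × Σ (Cycle l) (λ C → Cycle.psi C ≡ p))
      notΨ₄  : ∀ l → kind l ≢ uni ψ₄

    isUni : Psi → Kind → Bool
    isUni ψ₁ (uni ψ₁) = true
    isUni ψ₂ (uni ψ₂) = true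
    isUni ψ₃ (uni ψ₃) = true
    isUni ψ₄ (uni ψ₄) = true
    isUni _  _        = false

    τ₁ τ₂ : ℕ
    τ₁ = countFin (λ l → isUni ψ₂ (kind l))
    τ₂ = countFin (λ l → isUni ψ₃ (kind l))

  WeightOf : ℕ → Set
  WeightOf x = (Σ TypeII λ T → x ≡ 3 ^ TypeII.τ₁ T ℕ.* 4 ^ TypeII.τ₂ T)
             ⊎ (¬ TypeII × x ≡ 0)

{-# OPTIONS --safe #-}
module Submission where

-- Let S be the edge–vertex incidence matrix with entry 1 at the source of an edge and
-- ω̄ (or 1, if the edge is undirected) at its target.  Then Q is the Gram matrix of the
-- columns of S, so by Cauchy–Binet det Q[V₁] is the sum over E₁ of the norm of
-- det S[E₁,V₁].  Suppose every component of (V₁,E₁) contains an edge with one end in V₁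
-- or a cycle, and fix one.  Sending a vertex to the first edge of a shortest path towards
-- it (and a cycle vertex to the next cycle edge) is an injection V₁ → E₁, hence a
-- bijection since |V₁| = |E₁|.  Row operations along each cycle then reduce S[E₁,V₁] to
-- a matrix whose only nonzero expansion term is this bijection, so the norm is a product
-- of one factor per component: 1 for a tree and |1 − ∏ q|² for a cycle, where q is −ω̄,
-- −ω or −1 for an edge along, against or without direction.  The bijection also shows
-- that the components are rootless trees and unicyclic graphs.  Conversely, a nonzero
-- determinant has a nonzero expansion term, i.e. a matching of V₁ with E₁, and following
-- it inside a component ends in an edge with one end in V₁ or in a cycle.

open import Defs
open import Algebra.Bundles using (CommutativeRing)
import Algebra.Properties.CommutativeSemigroup
import Algebra.Properties.Ring
open import Algebra.Structures using (IsCommutativeRing)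
open import Data.Bool using (Bool; true; false; if_then_else_; _∨_)
open import Data.Empty using (⊥; ⊥-elim)
open import Data.Fin using (Fin; zero; suc; toℕ; inject₁; fromℕ<; punchIn; punchOut; cast)
import Data.Fin as F
open import Data.Fin.Induction using (<-weakInduction; >-weakInduction; <-weakInduction-startingFrom)
open import Data.Fin.Properties using (any?; cast-is-id; injective⇒≤; pigeonhole; punchIn-injective; punchIn-punchOut;
  punchInᵢ≢i; punchOut-cong; punchOut-injective; punchOut-punchIn; suc-injective; toℕ-fromℕ; toℕ-fromℕ<;
  toℕ-inject₁; toℕ-injective; toℕ<n; toℕ≤pred[n])
open import Data.Fin.Relation.Unary.Top using (view; ‵fromℕ; ‵inject₁)
open import Data.Fin.Subset using (Subset; Nonempty; _∈_; _∉_; ∣_∣)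
open import Data.Fin.Subset.Properties using (_∈?_)
open import Data.List using (List; []; _∷_; _++_; allFin; filter; length; lookup; map)
import Data.List.Membership.Propositional as List
import Data.List.Membership.Propositional.Properties as List
open import Data.List.Properties using (filter-++; filter-none; filter-≐; length-map; map-++)
import Data.List.Relation.Unary.All as All
import Data.List.Relation.Unary.All.Properties as All
import Data.List.Relation.Unary.AllPairs as AllPairs
import Data.List.Relation.Unary.Any as Any
open import Data.List.Relation.Unary.Any.Properties using (lookup-index)
open import Data.List.Relation.Unary.Unique.Propositional using (Unique)
import Data.List.Relation.Unary.Unique.Propositional.Properties as Unique
open import Data.Nat as ℕ using (ℕ; zero; suc; s≤s; z≤n; _^_)
import Data.Nat.DivMod as ℕ
open import Data.Nat.Induction using (<-rec; <-wellFounded)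
open import Data.Nat.ListAction using (sum)
open import Data.Nat.ListAction.Properties using (sum-++)
import Data.Nat.Properties as ℕ
open import Data.Nat.Solver using (module +-*-Solver)
open import Data.Product using (Σ; ∃; ∃₂; _×_; _,_; proj₁; proj₂)
open import Data.Sum using (_⊎_; inj₁; inj₂)
open import Data.Sum.Properties using (inj₁-injective; inj₂-injective)
open import Data.Vec using ([]; _∷_; here; there)
open import Function using (_∘_; case_of_)
open import Induction.WellFounded using (Acc; acc)
open import Level using (0ℓ)
open import Relation.Binary using (DecidableEquality; Rel; tri<; tri≈; tri>)
open import Relation.Binary.Construct.Closure.ReflexiveTransitive using (Star; ε; _◅_; _◅◅_)
import Relation.Binary.Construct.Closure.ReflexiveTransitive as Star
open import Relation.Binary.Construct.Closure.Symmetric using (SymClosure; fwd; bwd)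
import Relation.Binary.Construct.Closure.Symmetric as Sym
open import Relation.Binary.PropositionalEquality
open import Relation.Nullary using (¬_; Dec; yes; no; does; contradiction; ¬?; _×-dec_; _⊎-dec_)
open import Relation.Unary using (Decidable)

-- Determinants and the Cauchy–Binet formula over a commutative ring

-- A cycle can be matched with its edges in two directions, so it contributes two terms to the
-- expansion of the determinant. The row operations merge the two into a single entry, 1 - ∏ q up to
-- a unit, and this makes the surviving term unique. The product ∏ q is a sixth root of unity, and
-- |1 - ∏ q|² is 0, 4, 3 or 1 according as ∏ q is 1, -1, a primitive cube root or a primitive sixth
-- root of unity. These four cases are Ψ₄, Ψ₃, Ψ₂ and Ψ₁, whence the bases 3 and 4. The two
-- alternatives of `WeightOf` shape the rest. A substructure of type II comes with a decomposition
-- and with a root edge or a cycle in each component, which is all that the norm formula asks for.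
-- In the other alternative only a negation is given, so a structure of type II is constructed from
-- a nonzero norm, its components being read off a matching, and decidable equality in ℤ[ω]
-- concludes that the norm is 0.

enum : ∀ {m} (p : Subset m) → Fin ∣ p ∣ → Fin m
enum (true  ∷ p) zero    = zero
enum (true  ∷ p) (suc i) = suc (enum p i)
enum (false ∷ p) i       = suc (enum p i)

-- The cardinality proof is irrelevant and `cast` computes on constructors, so row by row the
-- enumeration of `true ∷ p` is definitionally `zero` followed by the shifted enumeration of `p`.
-- The induction in `cauchy-binet` relies on this.
enumAs : ∀ {m k} (p : Subset m) → .(∣ p ∣ ≡ k) → Fin k → Fin m
enumAs p eq i = enum p (cast (sym eq) i)

-- Decidable equality is what extracts a nonzero summand from a nonzero sum, and hence a matching
-- from a nonzero determinant, constructively.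
record DiscreteRing : Set₁ where
  infixl 6 _+_
  infixl 7 _*_
  infix  8 -_
  field
    Carrier           : Set
    _+_ _*_           : Carrier → Carrier → Carrier
    -_                : Carrier → Carrier
    0# 1#             : Carrier
    isCommutativeRing : IsCommutativeRing _≡_ _+_ _*_ -_ 0# 1#
    _≟_               : DecidableEquality Carrier

module Determinants (𝓡 : DiscreteRing) where

  open DiscreteRing 𝓡 renaming (Carrier to R)
  infix  4 _≋_

  commutativeRing : CommutativeRing 0ℓ 0ℓ
  commutativeRing = record { isCommutativeRing = isCommutativeRing }

  open IsCommutativeRing isCommutativeRing
    using (+-assoc; +-comm; +-identityˡ; +-identityʳ; -‿inverseˡ; -‿inverseʳ;
           *-assoc; *-comm; *-identityˡ; *-identityʳ; distribˡ; distribʳ; zeroˡ; zeroʳ)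
  open Algebra.Properties.Ring (CommutativeRing.ring commutativeRing)
    using (-‿distribˡ-*; -‿distribʳ-*; -‿involutive; x+x≈x⇒x≈0; +-inverseʳ-unique)
  module +-Props = Algebra.Properties.CommutativeSemigroup (CommutativeRing.+-commutativeSemigroup commutativeRing)
  module *-Props = Algebra.Properties.CommutativeSemigroup (CommutativeRing.*-commutativeSemigroup commutativeRing)
  open ≡-Reasoning

  ∑ : ∀ {k} → (Fin k → R) → R
  ∑ {zero}  f = 0#
  ∑ {suc k} f = f zero + ∑ (f ∘ suc)

  ∏ : ∀ {k} → (Fin k → R) → R
  ∏ {zero}  f = 1#
  ∏ {suc k} f = f zero * ∏ (f ∘ suc)

  ∑-cong : ∀ {k} {f g : Fin k → R} → (∀ i → f i ≡ g i) → ∑ f ≡ ∑ g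
  ∑-cong {zero}  eq = refl
  ∑-cong {suc k} eq = cong₂ _+_ (eq zero) (∑-cong (eq ∘ suc))

  ∑-zero : ∀ {k} {f : Fin k → R} → (∀ i → f i ≡ 0#) → ∑ f ≡ 0#
  ∑-zero {zero}  eq = refl
  ∑-zero {suc k} eq = trans (cong₂ _+_ (eq zero) (∑-zero (eq ∘ suc))) (+-identityˡ 0#)

  ∑-+ : ∀ {k} (f g : Fin k → R) → ∑ (λ i → f i + g i) ≡ ∑ f + ∑ g
  ∑-+ {zero}  f g = sym (+-identityˡ 0#)
  ∑-+ {suc k} f g = trans (cong (f zero + g zero +_) (∑-+ (f ∘ suc) (g ∘ suc))) (+-Props.interchange _ _ _ _)

  *-∑ : ∀ {k} c (f : Fin k → R) → c * ∑ f ≡ ∑ (λ i → c * f i)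
  *-∑ {zero}  c f = zeroʳ c
  *-∑ {suc k} c f = trans (distribˡ c _ _) (cong (c * f zero +_) (*-∑ c (f ∘ suc)))

  ∑-* : ∀ {k} (f : Fin k → R) c → ∑ f * c ≡ ∑ (λ i → f i * c)
  ∑-* f c = trans (*-comm _ c) (trans (*-∑ c f) (∑-cong (λ i → *-comm c (f i))))

  ∑-single : ∀ {k} (f : Fin k → R) i → (∀ j → j ≢ i → f j ≡ 0#) → ∑ f ≡ f i
  ∑-single f zero    z = trans (cong (f zero +_) (∑-zero (λ i → z (suc i) (λ ())))) (+-identityʳ _)
  ∑-single f (suc i) z = trans (cong₂ _+_ (z zero (λ ())) (∑-single (f ∘ suc) i (λ j j≢i → z (suc j) (j≢i ∘ suc-injective)))) (+-identityˡ _)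

  ∏-cong : ∀ {k} {f g : Fin k → R} → (∀ i → f i ≡ g i) → ∏ f ≡ ∏ g
  ∏-cong {zero}  eq = refl
  ∏-cong {suc k} eq = cong₂ _*_ (eq zero) (∏-cong (eq ∘ suc))

  ∏-one : ∀ {k} {f : Fin k → R} → (∀ i → f i ≡ 1#) → ∏ f ≡ 1#
  ∏-one {zero}  eq = refl
  ∏-one {suc k} eq = trans (cong₂ _*_ (eq zero) (∏-one (eq ∘ suc))) (*-identityˡ 1#)

  ∏-* : ∀ {k} (f g : Fin k → R) → ∏ (λ i → f i * g i) ≡ ∏ f * ∏ g
  ∏-* {zero}  f g = sym (*-identityˡ 1#)
  ∏-* {suc k} f g = trans (cong (f zero * g zero *_) (∏-* (f ∘ suc) (g ∘ suc))) (*-Props.interchange _ _ _ _)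

  ∏-swap : ∀ {k l} (f : Fin k → Fin l → R) → ∏ (λ i → ∏ (f i)) ≡ ∏ (λ j → ∏ (λ i → f i j))
  ∏-swap {zero} {l} f = sym (∏-one {l} {λ _ → 1#} (λ _ → refl))
  ∏-swap {suc k} f = trans (cong (∏ (f zero) *_) (∏-swap (f ∘ suc))) (sym (∏-* (f zero) (λ j → ∏ (λ i → f (suc i) j))))

  ∏-single : ∀ {k} (f : Fin k → R) i → (∀ j → j ≢ i → f j ≡ 1#) → ∏ f ≡ f i
  ∏-single f zero    z = trans (cong (f zero *_) (∏-one (λ i → z (suc i) (λ ())))) (*-identityʳ _)
  ∏-single f (suc i) z = trans (cong₂ _*_ (z zero (λ ())) (∏-single (f ∘ suc) i (λ j j≢i → z (suc j) (j≢i ∘ suc-injective)))) (*-identityˡ _)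

  ∏-zero : ∀ {k} (f : Fin k → R) i → f i ≡ 0# → ∏ f ≡ 0#
  ∏-zero f zero    eq = trans (cong (_* ∏ (f ∘ suc)) eq) (zeroˡ _)
  ∏-zero f (suc i) eq = trans (cong (f zero *_) (∏-zero (f ∘ suc) i eq)) (zeroʳ _)

  -- Alternating forms in the rows of a matrix

  Mat : ℕ → ℕ → Set
  Mat k K = Fin k → Fin K → R

  _≋_ : ∀ {k K} → Mat k K → Mat k K → Set
  M ≋ M' = ∀ i j → M i j ≡ M' i j

  infixr 5 _◂_
  _◂_ : ∀ {k K} → (Fin K → R) → Mat k K → Mat (suc k) K
  (v ◂ M) zero    = v
  (v ◂ M) (suc i) = M i

  ◂-cong : ∀ {k K} {v : Fin K → R} {M M' : Mat k K} → M ≋ M' → v ◂ M ≋ v ◂ M'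
  ◂-cong eq zero    j = refl
  ◂-cong eq (suc i) j = eq i j

  -- Row p takes precedence when p ≡ q.
  set₂ : ∀ {k K} → Fin k → Fin k → (Fin K → R) → (Fin K → R) → Mat k K → Mat k K
  set₂ p q u v M i with i F.≟ p
  ... | yes _ = u
  ... | no _ with i F.≟ q
  ...   | yes _ = v
  ...   | no _  = M i

  set₂-p : ∀ {k K} (p q : Fin k) {u v : Fin K → R} {M : Mat k K} → set₂ p q u v M p ≡ u
  set₂-p p q with p F.≟ p
  ... | yes _  = refl
  ... | no p≢p = contradiction refl p≢p

  set₂-q : ∀ {k K} (p q : Fin k) {u v : Fin K → R} {M : Mat k K} → p ≢ q → set₂ p q u v M q ≡ v
  set₂-q p q p≢q with q F.≟ p
  ... | yes q≡p = contradiction (sym q≡p) p≢q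
  ... | no _ with q F.≟ q
  ...   | yes _  = refl
  ...   | no q≢q = contradiction refl q≢q

  set₂-other : ∀ {k K} (p q : Fin k) {u v : Fin K → R} {M : Mat k K} {i} → i ≢ p → i ≢ q → set₂ p q u v M i ≡ M i
  set₂-other p q {i = i} i≢p i≢q with i F.≟ p
  ... | yes i≡p = contradiction i≡p i≢p
  ... | no _ with i F.≟ q
  ...   | yes i≡q = contradiction i≡q i≢q
  ...   | no _    = refl

  set₂-indep : ∀ {k K} (p q : Fin k) {u u' v : Fin K → R} {M : Mat k K} {i} → i ≢ p → set₂ p q u v M i ≡ set₂ p q u' v M i
  set₂-indep p q {i = i} i≢p with i F.≟ p
  ... | yes i≡p = contradiction i≡p i≢p
  ... | no _ with i F.≟ q
  ...   | yes i≡q = refl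
  ...   | no _    = refl

  set₂-indep' : ∀ {k K} (p q : Fin k) {u v v' : Fin K → R} {M : Mat k K} {i} → i ≢ q → set₂ p q u v M i ≡ set₂ p q u v' M i
  set₂-indep' p q {i = i} i≢q with i F.≟ p
  ... | yes i≡p = refl
  ... | no _ with i F.≟ q
  ...   | yes i≡q = contradiction i≡q i≢q
  ...   | no _    = refl

  -- The row length `K` is independent of `k` because `fix-row` leaves a form on fewer rows of the
  -- same length. The fields compare whole matrices pointwise, which avoids function extensionality;
  -- `linear` combines additivity and homogeneity.
  record Alternating {k K} (Φ : Mat k K → R) : Set where
    field
      respects   : ∀ {M M'} → M ≋ M' → Φ M ≡ Φ M'
      linear : ∀ i c {P M N} → (∀ j → P i j ≡ c * M i j + N i j)
             → (∀ r → r ≢ i → ∀ j → P r j ≡ M r j) → (∀ r → r ≢ i → ∀ j → P r j ≡ N r j)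
             → Φ P ≡ c * Φ M + Φ N
      alt    : ∀ p q {M} → p ≢ q → (∀ j → M p j ≡ M q j) → Φ M ≡ 0#

    additive : ∀ i {P M N} → (∀ j → P i j ≡ M i j + N i j)
             → (∀ r → r ≢ i → ∀ j → P r j ≡ M r j) → (∀ r → r ≢ i → ∀ j → P r j ≡ N r j)
             → Φ P ≡ Φ M + Φ N
    additive i {P} {M} {N} eq o₁ o₂ =
      trans (linear i 1# (λ j → trans (eq j) (cong (_+ N i j) (sym (*-identityˡ _)))) o₁ o₂)
            (cong (_+ Φ N) (*-identityˡ _))

    zero-row : ∀ i {M} → (∀ j → M i j ≡ 0#) → Φ M ≡ 0#
    zero-row i {M} z = x+x≈x⇒x≈0 _ (sym (additive i {M} {M} {M}
      (λ j → trans (z j) (sym (trans (cong₂ _+_ (z j) (z j)) (+-identityˡ 0#)))) (λ _ _ _ → refl) (λ _ _ _ → refl)))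

    -- Polarisation: with `s` the sum of the two rows, `β s s` vanishes and expands into four terms,
    -- of which the two diagonal ones vanish as well.
    swap : ∀ p q {M M'} → p ≢ q → (∀ j → M' p j ≡ M q j) → (∀ j → M' q j ≡ M p j)
         → (∀ r → r ≢ p → r ≢ q → ∀ j → M' r j ≡ M r j) → Φ M + Φ M' ≡ 0#
    swap p q {M} {M'} p≢q ep eq eo = begin
      Φ M + Φ M'
        ≡⟨ cong₂ _+_ (respects (λ i j → M≋ i j)) (respects (λ i j → M'≋ i j)) ⟩
      β u v + β v u
        ≡⟨ cong₂ _+_ (+-identityˡ _) (+-identityʳ _) ⟨
      (0# + β u v) + (β v u + 0#)
        ≡⟨ cong₂ _+_ (cong (_+ β u v) (β-diag u)) (cong (β v u +_) (β-diag v)) ⟨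
      (β u u + β u v) + (β v u + β v v)
        ≡⟨ cong₂ _+_ (β-addʳ u) (β-addʳ v) ⟨
      β u s + β v s
        ≡⟨ β-addˡ ⟨
      β s s
        ≡⟨ β-diag s ⟩
      0# ∎
      where
      u v s : Fin _ → R
      u = M p
      v = M q
      s j = u j + v j

      β : (Fin _ → R) → (Fin _ → R) → R
      β x y = Φ (set₂ p q x y M)

      β-diag : ∀ x → β x x ≡ 0#
      β-diag x = alt p q p≢q (λ j → cong (λ f → f j) (trans (set₂-p p q) (sym (set₂-q p q p≢q))))

      β-addʳ : ∀ x → β x s ≡ β x u + β x v
      β-addʳ x = additive q
        (λ j → trans (cong (λ f → f j) (set₂-q p q p≢q)) (sym (cong₂ (λ f g → f j + g j) (set₂-q p q p≢q) (set₂-q p q p≢q))))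
        (λ r r≢q j → cong (λ f → f j) (set₂-indep' p q r≢q))
        (λ r r≢q j → cong (λ f → f j) (set₂-indep' p q r≢q))

      β-addˡ : β s s ≡ β u s + β v s
      β-addˡ = additive p
        (λ j → trans (cong (λ f → f j) (set₂-p p q)) (sym (cong₂ (λ f g → f j + g j) (set₂-p p q) (set₂-p p q))))
        (λ r r≢p j → cong (λ f → f j) (set₂-indep p q r≢p))
        (λ r r≢p j → cong (λ f → f j) (set₂-indep p q r≢p))

      M≋ : M ≋ set₂ p q u v M
      M≋ i j with i F.≟ p
      ... | yes refl = refl
      ... | no _ with i F.≟ q
      ...   | yes refl = refl
      ...   | no _     = refl

      M'≋ : M' ≋ set₂ p q v u M
      M'≋ i j with i F.≟ p
      ... | yes refl = ep j
      ... | no i≢p with i F.≟ q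
      ...   | yes refl = eq j
      ...   | no i≢q   = eo i i≢p i≢q j

    add-row : ∀ p q c {M M'} → p ≢ q → (∀ j → M' p j ≡ c * M q j + M p j)
            → (∀ r → r ≢ p → ∀ j → M' r j ≡ M r j) → Φ M' ≡ Φ M
    add-row p q c {M} {M'} p≢q ep eo = begin
      Φ M'                                ≡⟨ linear p c
          (λ j → trans (ep j) (cong (λ f → c * f j + M p j) (sym (set₂-p p p {M = M}))))
          (λ r r≢p j → trans (eo r r≢p j) (cong (λ f → f j) (sym (set₂-other p p {M = M} r≢p r≢p)))) eo ⟩
      -- With both indices equal, `set₂` replaces a single row; here row `p` becomes a copy of row
      -- `q`, so the form vanishes.
      c * Φ (set₂ p p (M q) (M q) M) + Φ M
        ≡⟨ cong (λ x → c * x + Φ M) (alt p q p≢q (λ j → cong (λ f → f j)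
             (trans (set₂-p p p) (sym (set₂-other p p (p≢q ∘ sym) (p≢q ∘ sym)))))) ⟩
      c * 0# + Φ M                        ≡⟨ cong (_+ Φ M) (zeroʳ c) ⟩
      0# + Φ M                            ≡⟨ +-identityˡ _ ⟩
      Φ M                                 ∎

  fix-row : ∀ {k K} {Φ : Mat (suc k) K → R} → Alternating Φ → ∀ v → Alternating (λ M → Φ (v ◂ M))
  fix-row {Φ = Φ} A v = record
    { respects   = λ eq → respects (◂-cong eq)
    ; linear = λ i c eq o₁ o₂ → linear (suc i) c eq (ext o₁) (ext o₂)
    ; alt    = λ p q p≢q eq → alt (suc p) (suc q) (p≢q ∘ suc-injective) eq
    }
    where
    open Alternating A
    ext : ∀ {i} {M N : Mat _ _} → (∀ r → r ≢ i → ∀ j → M r j ≡ N r j)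
        → ∀ r → r ≢ suc i → ∀ j → (v ◂ M) r j ≡ (v ◂ N) r j
    ext o zero    _   j = refl
    ext o (suc r) r≢i j = o r (r≢i ∘ cong suc) j

  -- The Laplace expansion is an alternating form

  sgn : ℕ → R
  sgn zero          = 1#
  sgn (suc zero)    = - 1#
  sgn (suc (suc j)) = sgn j

  sgn-suc : ∀ j → sgn (suc j) ≡ - sgn j
  sgn-suc zero          = refl
  sgn-suc (suc zero)    = sym (-‿involutive 1#)
  sgn-suc (suc (suc j)) = sgn-suc j

  minor : ∀ {k} → Mat (suc k) (suc k) → Fin (suc k) → Mat k k
  minor M j r c = M (suc r) (punchIn j c)

  determinant : ∀ {k} → Mat k k → R
  determinant {zero}  M = 1#
  determinant {suc k} M = ∑ (λ j → sgn (toℕ j) * M zero j * determinant (minor M j))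

  det-cong : ∀ {k} {M M' : Mat k k} → M ≋ M' → determinant M ≡ determinant M'
  det-cong {zero}  eq = refl
  det-cong {suc k} eq = ∑-cong (λ j →
    cong₂ (λ x y → sgn (toℕ j) * x * y) (eq zero j) (det-cong (λ r c → eq (suc r) (punchIn j c))))

  det-linear : ∀ {k} i c {P M N : Mat k k} → (∀ j → P i j ≡ c * M i j + N i j)
    → (∀ r → r ≢ i → ∀ j → P r j ≡ M r j) → (∀ r → r ≢ i → ∀ j → P r j ≡ N r j)
    → determinant P ≡ c * determinant M + determinant N
  det-linear {suc k} i c {P} {M} {N} eq o₁ o₂ = begin
    ∑ (term P)                                ≡⟨ ∑-cong (step i eq o₁ o₂) ⟩
    ∑ (λ j → c * term M j + term N j)         ≡⟨ ∑-+ (λ j → c * term M j) (term N) ⟩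
    ∑ (λ j → c * term M j) + ∑ (term N)       ≡⟨ cong (_+ ∑ (term N)) (*-∑ c (term M)) ⟨
    c * ∑ (term M) + ∑ (term N)               ∎
    where
    term : Mat (suc k) (suc k) → Fin (suc k) → R
    term X j = sgn (toℕ j) * X zero j * determinant (minor X j)

    step : ∀ i → (∀ j → P i j ≡ c * M i j + N i j) → (∀ r → r ≢ i → ∀ j → P r j ≡ M r j)
         → (∀ r → r ≢ i → ∀ j → P r j ≡ N r j) → ∀ j → term P j ≡ c * term M j + term N j
    step zero eq o₁ o₂ j = begin
      s * P zero j * determinant (minor P j)            ≡⟨ cong (λ x → s * x * determinant (minor P j)) (eq j) ⟩
      s * (c * x + y) * d                       ≡⟨ cong (_* d) (distribˡ s _ _) ⟩
      (s * (c * x) + s * y) * d                 ≡⟨ distribʳ d _ _ ⟩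
      s * (c * x) * d + s * y * d               ≡⟨ cong (λ z → z * d + s * y * d) (*-Props.x∙yz≈y∙xz s c x) ⟩
      c * (s * x) * d + s * y * d               ≡⟨ cong (_+ s * y * d) (*-assoc c _ _) ⟩
      c * (s * x * d) + s * y * d               ≡⟨ cong₂ (λ z w → c * (s * x * z) + s * y * w)
                                                     (det-cong (λ r q → o₁ (suc r) (λ ()) _))
                                                     (det-cong (λ r q → o₂ (suc r) (λ ()) _)) ⟩
      c * term M j + term N j                   ∎
      where
      s d x y : R
      s = sgn (toℕ j)
      d = determinant (minor P j)
      x = M zero j
      y = N zero j
    step (suc i) eq o₁ o₂ j = begin
      s * P zero j * determinant (minor P j)
        ≡⟨ cong (s * P zero j *_) (det-linear i c (λ q → eq (punchIn j q))
             (λ r r≢i q → o₁ (suc r) (r≢i ∘ suc-injective) _) (λ r r≢i q → o₂ (suc r) (r≢i ∘ suc-injective) _)) ⟩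
      s * P zero j * (c * dM + dN)
        ≡⟨ distribˡ (s * P zero j) _ _ ⟩
      s * P zero j * (c * dM) + s * P zero j * dN
        ≡⟨ cong (_+ s * P zero j * dN) (*-Props.x∙yz≈y∙xz (s * P zero j) c dM) ⟩
      c * (s * P zero j * dM) + s * P zero j * dN
        ≡⟨ cong₂ (λ x y → c * (s * x * dM) + s * y * dN) (o₁ zero (λ ()) j) (o₂ zero (λ ()) j) ⟩
      c * term M j + term N j ∎
      where
      s dM dN : R
      s = sgn (toℕ j)
      dM = determinant (minor M j)
      dN = determinant (minor N j)

  -- The terms for the column pairs (j, punchIn j i) and (punchIn j i, j) of a
  -- two-row Laplace expansion cancel; H depends only on the complementary columns.
  two-row-cancel : ∀ {k} (v : Fin (suc (suc k)) → R) (H : (Fin k → Fin (suc (suc k))) → R)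
    → (∀ {f g} → (∀ c → f c ≡ g c) → H f ≡ H g)
    → ∑ (λ j → ∑ (λ i → sgn (toℕ j) * v j * (sgn (toℕ i) * v (punchIn j i) * H (punchIn j ∘ punchIn i)))) ≡ 0#
  two-row-cancel {k} v H H-cong = begin
    ∑ (t zero) + ∑ (λ j → t (suc j) zero + ∑ (λ i → t' j i))
      ≡⟨ cong (∑ (t zero) +_) (∑-+ (λ j → t (suc j) zero) (λ j → ∑ (λ i → t' j i))) ⟩
    ∑ (t zero) + (∑ (λ j → t (suc j) zero) + ∑ (λ j → ∑ (t' j)))
      ≡⟨ +-assoc _ _ _ ⟨
    ∑ (t zero) + ∑ (λ j → t (suc j) zero) + ∑ (λ j → ∑ (t' j))
      ≡⟨ cong₂ _+_ (trans (sym (∑-+ (t zero) (λ j → t (suc j) zero))) (∑-zero cancel)) (rest k v H H-cong) ⟩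
    0# + 0#
      ≡⟨ +-identityˡ 0# ⟩
    0# ∎
    where
    t : Fin (suc (suc k)) → Fin (suc k) → R
    t j i = sgn (toℕ j) * v j * (sgn (toℕ i) * v (punchIn j i) * H (punchIn j ∘ punchIn i))

    t' : Fin (suc k) → Fin k → R
    t' j i = t (suc j) (suc i)

    cancel : ∀ j → t zero j + t (suc j) zero ≡ 0#
    cancel j = begin
      1# * v zero * (sgn (toℕ j) * v (suc j) * h) + sgn (suc (toℕ j)) * v (suc j) * (1# * v zero * h)
        ≡⟨ cong₂ (λ x y → x * (sgn (toℕ j) * v (suc j) * h) + y * v (suc j) * (x * h)) (*-identityˡ (v zero)) (sgn-suc (toℕ j)) ⟩
      v zero * (s * w * h) + - s * w * (v zero * h)
        ≡⟨ cong₂ _+_ (*-Props.x∙yz≈y∙xz (v zero) (s * w) h) (cong (_* (v zero * h)) (sym (-‿distribˡ-* s w))) ⟩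
      s * w * (v zero * h) + - (s * w) * (v zero * h)
        ≡⟨ distribʳ (v zero * h) _ _ ⟨
      (s * w + - (s * w)) * (v zero * h)
        ≡⟨ cong (_* (v zero * h)) (-‿inverseʳ _) ⟩
      0# * (v zero * h)
        ≡⟨ zeroˡ _ ⟩
      0# ∎
      where
      s w h : R
      s = sgn (toℕ j)
      w = v (suc j)
      h = H (suc ∘ punchIn j)

    -- Here neither column is `zero`. Deleting that column changes both signs, which leaves the
    -- product as it was, and `lift` puts the column back among the complementary ones, so the claim
    -- for one column fewer applies.
    rest : ∀ k (v : Fin (suc (suc k)) → R) (H : (Fin k → Fin (suc (suc k))) → R)
      → (∀ {f g} → (∀ c → f c ≡ g c) → H f ≡ H g)
      → ∑ (λ (j : Fin (suc k)) → ∑ (λ (i : Fin k) → sgn (suc (toℕ j)) * v (suc j)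
          * (sgn (suc (toℕ i)) * v (suc (punchIn j i)) * H (punchIn (suc j) ∘ punchIn (suc i))))) ≡ 0#
    rest zero    v H H-cong = ∑-zero {1} (λ _ → refl)
    rest (suc k) v H H-cong = trans
      (∑-cong (λ j → ∑-cong (λ i → trans (signs j i)
        (cong (λ z → sgn (toℕ j) * v (suc j) * (sgn (toℕ i) * v (suc (punchIn j i)) * z)) (H-cong (lifts j i))))))
      (two-row-cancel (v ∘ suc) (λ f → H (lift f)) (λ eq → H-cong (lift-cong eq)))
      where
      lift : (Fin k → Fin (suc (suc k))) → Fin (suc k) → Fin (suc (suc (suc k)))
      lift f zero    = zero
      lift f (suc c) = suc (f c)

      lift-cong : ∀ {f g} → (∀ c → f c ≡ g c) → ∀ c → lift f c ≡ lift g c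
      lift-cong eq zero    = refl
      lift-cong eq (suc c) = cong suc (eq c)

      lifts : ∀ j i c → punchIn (suc j) (punchIn (suc i) c) ≡ lift (punchIn j ∘ punchIn i) c
      lifts j i zero    = refl
      lifts j i (suc c) = refl

      signs : ∀ (j : Fin (suc (suc k))) (i : Fin (suc k)) {x y z} →
        sgn (suc (toℕ j)) * x * (sgn (suc (toℕ i)) * y * z) ≡ sgn (toℕ j) * x * (sgn (toℕ i) * y * z)
      signs j i {x} {y} {z} = begin
        sgn (suc (toℕ j)) * x * (sgn (suc (toℕ i)) * y * z)
          ≡⟨ cong₂ (λ a b → a * x * (b * y * z)) (sgn-suc (toℕ j)) (sgn-suc (toℕ i)) ⟩
        - s * x * (- u * y * z)
          ≡⟨ cong₂ _*_ (sym (-‿distribˡ-* s x)) (trans (cong (_* z) (sym (-‿distribˡ-* u y))) (sym (-‿distribˡ-* (u * y) z))) ⟩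
        - (s * x) * - (u * y * z)
          ≡⟨ -‿distribˡ-* _ _ ⟨
        - (s * x * - (u * y * z))
          ≡⟨ cong -_ (-‿distribʳ-* _ _) ⟨
        - - (s * x * (u * y * z))
          ≡⟨ -‿involutive _ ⟩
        s * x * (u * y * z) ∎
        where
        s u : R
        s = sgn (toℕ j)
        u = sgn (toℕ i)

  det-alt₀₁ : ∀ {k} {M : Mat (suc (suc k)) (suc (suc k))} → (∀ j → M zero j ≡ M (suc zero) j) → determinant M ≡ 0#
  det-alt₀₁ {k} {M} eq = trans
    (∑-cong (λ j → trans (*-∑ (sgn (toℕ j) * M zero j) (λ i → sgn (toℕ i) * M (suc zero) (punchIn j i) * determinant (minor (minor M j) i)))
      (∑-cong (λ i → cong (λ x → sgn (toℕ j) * M zero j * (sgn (toℕ i) * x * determinant (minor (minor M j) i))) (sym (eq (punchIn j i)))))))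
    (two-row-cancel (M zero) (λ f → determinant (λ r c → M (suc (suc r)) (f c))) (λ e → det-cong (λ r c → cong (M (suc (suc r))) (e c))))

  -- Equal rows below the first make every minor vanish, and equal first two rows are settled by
  -- `det-alt₀₁`. If the first row equals one further down, exchanging the latter with the second
  -- row negates every minor, which reduces the claim to equal first two rows.
  det-alternating-suc : ∀ {k} → Alternating (determinant {k}) → Alternating (determinant {suc k})
  det-alternating-suc {k} IH = record { respects = det-cong ; linear = λ i c {P} {M} {N} → det-linear i c {P} {M} {N} ; alt = alternate }
    where
    minors-zero : ∀ {M : Mat (suc k) (suc k)} → (∀ j → determinant (minor M j) ≡ 0#) → determinant M ≡ 0#
    minors-zero {M} z = ∑-zero (λ j → trans (cong (sgn (toℕ j) * M zero j *_) (z j)) (zeroʳ _))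

    first-row : ∀ q {M : Mat (suc k) (suc k)} → (∀ j → M zero j ≡ M (suc q) j) → determinant M ≡ 0#
    first-row zero {M} eq = det-alt₀₁ {M = M} eq
    first-row (suc q) {M} eq = begin
      determinant M             ≡⟨ +-identityʳ _ ⟨
      determinant M + 0#        ≡⟨ cong (determinant M +_) (sym (det-alt₀₁ {M = M'} (λ j → trans (eq j) (sym (M'-p j))))) ⟩
      determinant M + determinant M'
        ≡⟨ ∑-+ (λ j → sgn (toℕ j) * M zero j * determinant (minor M j))
               (λ j → sgn (toℕ j) * M zero j * determinant (minor M' j)) ⟨
      ∑ (λ j → sgn (toℕ j) * M zero j * determinant (minor M j) + sgn (toℕ j) * M zero j * determinant (minor M' j))
        ≡⟨ ∑-zero (λ j → trans (sym (distribˡ _ _ _)) (trans (cong (sgn (toℕ j) * M zero j *_) (swapped j)) (zeroʳ _))) ⟩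
      0#                ∎
      where
      N : Mat k (suc k)
      N r = M (suc r)
      p₀ q₀ : Fin k
      p₀ = zero
      q₀ = suc q
      M' : Mat (suc k) (suc k)
      M' = M zero ◂ set₂ p₀ q₀ (N q₀) (N p₀) N
      M'-p : ∀ j → M' (suc zero) j ≡ M (suc (suc q)) j
      M'-p j = cong (λ f → f j) (set₂-p p₀ q₀ {N q₀} {N p₀} {N})
      swapped : ∀ j → determinant (minor M j) + determinant (minor M' j) ≡ 0#
      swapped j = Alternating.swap IH p₀ q₀ (λ ())
        (λ c → cong (λ f → f (punchIn j c)) (set₂-p p₀ q₀ {N q₀} {N p₀} {N}))
        (λ c → cong (λ f → f (punchIn j c)) (set₂-q p₀ q₀ {N q₀} {N p₀} {N} (λ ())))
        (λ r r≢p r≢q c → cong (λ f → f (punchIn j c)) (set₂-other p₀ q₀ {N q₀} {N p₀} {N} r≢p r≢q))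

    alternate : ∀ p q {M : Mat (suc k) (suc k)} → p ≢ q → (∀ j → M p j ≡ M q j) → determinant M ≡ 0#
    alternate zero    zero    p≢q eq = contradiction refl p≢q
    alternate zero    (suc q) {M} p≢q eq = first-row q {M} eq
    alternate (suc p) zero    {M} p≢q eq = first-row p {M} (λ j → sym (eq j))
    alternate (suc p) (suc q) {M} p≢q eq = minors-zero {M} (λ j →
      Alternating.alt IH p q (p≢q ∘ cong suc) (λ c → eq (punchIn j c)))

  det-alternating : ∀ {k} → Alternating (determinant {k})
  det-alternating {zero}  = record { respects = det-cong ; linear = λ () ; alt = λ () }
  det-alternating {suc k} = det-alternating-suc det-alternating

  -- In the multilinear expansion a term that takes `b` in two rows vanishes, so at most one row
  -- comes from the rank-one part. Moving that row to the top costs the sign `sgn (toℕ i)`.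
  rank-one-update : ∀ {k K} {Φ : Mat (suc k) K → R} → Alternating Φ → ∀ (c : Fin (suc k) → R) (b : Fin K → R) (N : Mat (suc k) K)
    → Φ (λ i j → c i * b j + N i j) ≡ Φ N + ∑ (λ i → sgn (toℕ i) * c i * Φ (b ◂ (N ∘ punchIn i)))
  rank-one-update {zero} {K} {Φ} A c b N = begin
    Φ (λ i j → c i * b j + N i j)
      ≡⟨ linear zero (c zero) (λ _ → refl) (λ { zero z≢z → contradiction refl z≢z }) (λ { zero z≢z → contradiction refl z≢z }) ⟩
    c zero * Φ (b ◂ (N ∘ punchIn zero)) + Φ N
      ≡⟨ +-comm _ _ ⟩
    Φ N + c zero * Φ (b ◂ (N ∘ punchIn zero))
      ≡⟨ cong (Φ N +_) (trans (+-identityʳ _) (cong (_* Φ (b ◂ (N ∘ punchIn zero))) (*-identityˡ _))) ⟨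
    Φ N + (1# * c zero * Φ (b ◂ (N ∘ punchIn zero)) + 0#) ∎
    where open Alternating A
  rank-one-update {suc k} {K} {Φ} A c b N = begin
    Φ (λ i j → c i * b j + N i j)
      ≡⟨ linear zero (c zero) {M = b ◂ P'} {N = N zero ◂ P'} (λ _ → refl)
           (λ { zero z≢z → contradiction refl z≢z ; (suc r) _ j → refl })
           (λ { zero z≢z → contradiction refl z≢z ; (suc r) _ j → refl }) ⟩
    c zero * Φ (b ◂ P') + Φ (N zero ◂ P')
      ≡⟨ cong₂ (λ x y → c zero * x + y) (rank-one-update (fix-row A b) (c ∘ suc) b N') (rank-one-update (fix-row A (N zero)) (c ∘ suc) b N') ⟩
    c zero * (Φ (b ◂ N') + ∑ (λ i → sgn (toℕ i) * c (suc i) * Φ (b ◂ b ◂ (N' ∘ punchIn i))))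
      + (Φ (N zero ◂ N') + ∑ (λ i → sgn (toℕ i) * c (suc i) * Φ (N zero ◂ b ◂ (N' ∘ punchIn i))))
      ≡⟨ cong₂ (λ x y → c zero * (Φ (b ◂ N') + x) + y)
           (∑-zero (λ i → trans (cong (sgn (toℕ i) * c (suc i) *_) (alt zero (suc zero) {b ◂ b ◂ (N' ∘ punchIn i)} (λ ()) (λ _ → refl))) (zeroʳ _)))
           (cong₂ _+_ (respects (λ { zero j → refl ; (suc i) j → refl })) (∑-cong term)) ⟩
    c zero * (Φ (b ◂ N') + 0#) + (Φ N + S)
      ≡⟨ cong (_+ (Φ N + S)) (trans (cong (c zero *_) (+-identityʳ _)) (cong (_* Φ (b ◂ N')) (sym (*-identityˡ _)))) ⟩
    1# * c zero * Φ (b ◂ N') + (Φ N + S)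
      ≡⟨ +-Props.x∙yz≈y∙xz _ _ _ ⟩
    Φ N + (1# * c zero * Φ (b ◂ N') + S) ∎
    where
    open Alternating A
    P' N' : Mat (suc k) K
    P' i j = c (suc i) * b j + N (suc i) j
    N' = N ∘ suc
    S : R
    S = ∑ (λ i → sgn (toℕ (suc i)) * c (suc i) * Φ (b ◂ (N ∘ punchIn (suc i))))

    flip : ∀ i → Φ (b ◂ (N ∘ punchIn (suc i))) ≡ - Φ (N zero ◂ b ◂ (N' ∘ punchIn i))
    flip i = +-inverseʳ-unique _ _ (swap zero (suc zero) (λ ()) (λ _ → refl) (λ _ → refl)
      (λ { zero r≢p _ → contradiction refl r≢p ; (suc zero) _ r≢q → contradiction refl r≢q ; (suc (suc r)) _ _ j → refl }))

    term : ∀ i → sgn (toℕ i) * c (suc i) * Φ (N zero ◂ b ◂ (N' ∘ punchIn i))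
               ≡ sgn (toℕ (suc i)) * c (suc i) * Φ (b ◂ (N ∘ punchIn (suc i)))
    term i = sym (begin
      sgn (suc (toℕ i)) * c (suc i) * Φ (b ◂ (N ∘ punchIn (suc i)))
        ≡⟨ cong₂ (λ x y → x * c (suc i) * y) (sgn-suc (toℕ i)) (flip i) ⟩
      - s * c (suc i) * - y
        ≡⟨ cong (_* - y) (sym (-‿distribˡ-* s (c (suc i)))) ⟩
      - (s * c (suc i)) * - y
        ≡⟨ -‿distribˡ-* _ _ ⟨
      - (s * c (suc i) * - y)
        ≡⟨ cong -_ (-‿distribʳ-* _ _) ⟨
      - - (s * c (suc i) * y)
        ≡⟨ -‿involutive _ ⟩
      s * c (suc i) * y ∎)
      where
      s y : R
      s = sgn (toℕ i)
      y = Φ (N zero ◂ b ◂ (N' ∘ punchIn i))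

  -- Sums over subsets of fixed size and the Cauchy-Binet formula

  ∑⊆ : ∀ m k → ((p : Subset m) → .(∣ p ∣ ≡ k) → R) → R
  ∑⊆ zero    zero    w = w [] refl
  ∑⊆ zero    (suc k) w = 0#
  ∑⊆ (suc m) zero    w = ∑⊆ m zero (λ p eq → w (false ∷ p) eq)
  ∑⊆ (suc m) (suc k) w = ∑⊆ m k (λ p eq → w (true ∷ p) (cong suc eq)) + ∑⊆ m (suc k) (λ p eq → w (false ∷ p) eq)

  ∑⊆-cong : ∀ m k {w w' : (p : Subset m) → .(∣ p ∣ ≡ k) → R} → (∀ p (eq : ∣ p ∣ ≡ k) → w p eq ≡ w' p eq) → ∑⊆ m k w ≡ ∑⊆ m k w'
  ∑⊆-cong zero    zero    eq = eq [] refl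
  ∑⊆-cong zero    (suc k) eq = refl
  ∑⊆-cong (suc m) zero    eq = ∑⊆-cong m zero (λ p e → eq (false ∷ p) e)
  ∑⊆-cong (suc m) (suc k) eq = cong₂ _+_ (∑⊆-cong m k (λ p e → eq (true ∷ p) (cong suc e))) (∑⊆-cong m (suc k) (λ p e → eq (false ∷ p) e))

  ∑⊆-0 : ∀ m k → ∑⊆ m k (λ _ _ → 0#) ≡ 0#
  ∑⊆-0 zero    zero    = refl
  ∑⊆-0 zero    (suc k) = refl
  ∑⊆-0 (suc m) zero    = ∑⊆-0 m zero
  ∑⊆-0 (suc m) (suc k) = trans (cong₂ _+_ (∑⊆-0 m k) (∑⊆-0 m (suc k))) (+-identityˡ 0#)

  ∑⊆-+ : ∀ m k (w w' : (p : Subset m) → .(∣ p ∣ ≡ k) → R) → ∑⊆ m k (λ p eq → w p eq + w' p eq) ≡ ∑⊆ m k w + ∑⊆ m k w'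
  ∑⊆-+ zero    zero    w w' = refl
  ∑⊆-+ zero    (suc k) w w' = sym (+-identityˡ 0#)
  ∑⊆-+ (suc m) zero    w w' = ∑⊆-+ m zero (λ p eq → w (false ∷ p) eq) (λ p eq → w' (false ∷ p) eq)
  ∑⊆-+ (suc m) (suc k) w w' = trans
    (cong₂ _+_ (∑⊆-+ m k (λ p eq → w (true ∷ p) (cong suc eq)) (λ p eq → w' (true ∷ p) (cong suc eq)))
               (∑⊆-+ m (suc k) (λ p eq → w (false ∷ p) eq) (λ p eq → w' (false ∷ p) eq)))
    (+-Props.interchange _ _ _ _)

  *-∑⊆ : ∀ m k c (w : (p : Subset m) → .(∣ p ∣ ≡ k) → R) → c * ∑⊆ m k w ≡ ∑⊆ m k (λ p eq → c * w p eq)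
  *-∑⊆ zero    zero    c w = refl
  *-∑⊆ zero    (suc k) c w = zeroʳ c
  *-∑⊆ (suc m) zero    c w = *-∑⊆ m zero c (λ p eq → w (false ∷ p) eq)
  *-∑⊆ (suc m) (suc k) c w = trans (distribˡ c _ _)
    (cong₂ _+_ (*-∑⊆ m k c (λ p eq → w (true ∷ p) (cong suc eq))) (*-∑⊆ m (suc k) c (λ p eq → w (false ∷ p) eq)))

  ∑-∑⊆ : ∀ {l} m k (w : Fin l → (p : Subset m) → .(∣ p ∣ ≡ k) → R)
    → ∑ (λ i → ∑⊆ m k (w i)) ≡ ∑⊆ m k (λ p eq → ∑ (λ i → w i p eq))
  ∑-∑⊆ {zero}  m k w = sym (∑⊆-0 m k)
  ∑-∑⊆ {suc l} m k w = trans (cong (∑⊆ m k (w zero) +_) (∑-∑⊆ m k (w ∘ suc)))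
    (sym (∑⊆-+ m k (w zero) (λ p eq → ∑ (λ i → w (suc i) p eq))))

  -- One determinant is generalised to an alternating form so that a row of `B` can be fixed during
  -- the induction on `m`. Splitting off the first summand exhibits the product as a rank-one update
  -- of `N`: the term `Φ N` yields the subsets without `zero`, and the remaining sum yields those
  -- with `zero`, as Laplace expansions along the first row of the minors of `A`.
  cauchy-binet : ∀ {k K} m {Φ : Mat k K → R} → Alternating Φ → (A : Mat m k) (B : Mat m K)
    → Φ (λ i j → ∑ (λ e → A e i * B e j))
      ≡ ∑⊆ m k (λ p eq → determinant (A ∘ enumAs p eq) * Φ (B ∘ enumAs p eq))
  cauchy-binet {zero}  zero    {Φ} alt A B = trans (Alternating.respects alt (λ ())) (sym (*-identityˡ _))
  cauchy-binet {suc k} zero    {Φ} alt A B = Alternating.zero-row alt zero (λ _ → refl)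
  cauchy-binet {zero}  (suc m) {Φ} alt A B = trans (trans (Alternating.respects alt (λ ())) (cauchy-binet m alt (A ∘ suc) (B ∘ suc)))
    (∑⊆-cong m zero (λ p eq → cong (1# *_) (Alternating.respects alt (λ ()))))
  cauchy-binet {suc k} {K} (suc m) {Φ} alt A B = begin
    Φ (λ i j → A zero i * B zero j + N i j)
      ≡⟨ rank-one-update alt (A zero) (B zero) N ⟩
    Φ N + ∑ (λ i → sgn (toℕ i) * A zero i * Φ (B zero ◂ (N ∘ punchIn i)))
      ≡⟨ +-comm _ _ ⟩
    ∑ (λ i → sgn (toℕ i) * A zero i * Φ (B zero ◂ (N ∘ punchIn i))) + Φ N
      ≡⟨ cong₂ _+_
           (trans (∑-cong expand) (∑-∑⊆ m k (λ i p eq → sgn (toℕ i) * A zero i * (D p eq i * Φ (B zero ◂ (B ∘ suc ∘ enumAs p eq))))))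
           (cauchy-binet m alt (A ∘ suc) (B ∘ suc)) ⟩
    ∑⊆ m k (λ p eq → ∑ (λ i → sgn (toℕ i) * A zero i * (D p eq i * Φ (B zero ◂ (B ∘ suc ∘ enumAs p eq)))))
      + ∑⊆ m (suc k) (λ p eq → determinant (A ∘ suc ∘ enumAs p eq) * Φ (B ∘ suc ∘ enumAs p eq))
      ≡⟨ cong (_+ _) (∑⊆-cong m k collect) ⟩
    ∑⊆ m k (λ p eq → determinant (A ∘ enumAs (true ∷ p) (cong suc eq)) * Φ (B ∘ enumAs (true ∷ p) (cong suc eq)))
      + ∑⊆ m (suc k) (λ p eq → determinant (A ∘ suc ∘ enumAs p eq) * Φ (B ∘ suc ∘ enumAs p eq)) ∎
    where
    N : Mat (suc k) K
    N i j = ∑ (λ e → A (suc e) i * B (suc e) j)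

    D : (p : Subset m) → .(∣ p ∣ ≡ k) → Fin (suc k) → R
    D p eq i = determinant (λ r c → A (suc (enumAs p eq r)) (punchIn i c))

    expand : ∀ i → sgn (toℕ i) * A zero i * Φ (B zero ◂ (N ∘ punchIn i))
      ≡ ∑⊆ m k (λ p eq → sgn (toℕ i) * A zero i * (D p eq i * Φ (B zero ◂ (B ∘ suc ∘ enumAs p eq))))
    expand i = trans
      (cong (sgn (toℕ i) * A zero i *_) (cauchy-binet m (fix-row alt (B zero)) (λ e c → A (suc e) (punchIn i c)) (B ∘ suc)))
      (*-∑⊆ m k (sgn (toℕ i) * A zero i) (λ p eq → D p eq i * Φ (B zero ◂ (B ∘ suc ∘ enumAs p eq))))

    collect : ∀ p (eq : ∣ p ∣ ≡ k)
      → ∑ (λ i → sgn (toℕ i) * A zero i * (D p eq i * Φ (B zero ◂ (B ∘ suc ∘ enumAs p eq))))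
      ≡ determinant (A ∘ enumAs (true ∷ p) (cong suc eq)) * Φ (B ∘ enumAs (true ∷ p) (cong suc eq))
    collect p eq = trans (∑-cong (λ i → sym (*-assoc (sgn (toℕ i) * A zero i) (D p eq i) Ψ)))
      (trans (sym (∑-* (λ i → sgn (toℕ i) * A zero i * D p eq i) Ψ))
        (cong (∑ (λ i → sgn (toℕ i) * A zero i * D p eq i) *_)
          (Alternating.respects alt {B zero ◂ (B ∘ suc ∘ enumAs p eq)} (λ { zero j → refl ; (suc i) j → refl }))))
      where
      Ψ : R
      Ψ = Φ (B zero ◂ (B ∘ suc ∘ enumAs p eq))

  -- Nonzero terms of the determinant expansion

  record Transversal {k} (M : Mat k k) : Set where
    field
      col     : Fin k → Fin k
      col-inj : ∀ i j → col i ≡ col j → i ≡ j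
      nonzero : ∀ i → M i (col i) ≢ 0#

  extend : ∀ {k} {M : Mat (suc k) (suc k)} j → M zero j ≢ 0# → Transversal (minor M j) → Transversal M
  extend {k} {M} j nz T = record { col = col' ; col-inj = inj ; nonzero = λ { zero → nz ; (suc i) → nonzero i } }
    where
    open Transversal T
    col' : Fin (suc k) → Fin (suc k)
    col' zero    = j
    col' (suc i) = punchIn j (col i)
    inj : ∀ a b → col' a ≡ col' b → a ≡ b
    inj zero    zero    eq = refl
    inj zero    (suc b) eq = contradiction (sym eq) (punchInᵢ≢i j (col b))
    inj (suc a) zero    eq = contradiction eq (punchInᵢ≢i j (col a))
    inj (suc a) (suc b) eq = cong suc (col-inj a b (punchIn-injective j _ _ eq))

  ∑≢0 : ∀ {k} (f : Fin k → R) → ∑ f ≢ 0# → ∃ λ i → f i ≢ 0#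
  ∑≢0 {zero}  f nz = contradiction refl nz
  ∑≢0 {suc k} f nz with f zero ≟ 0#
  ... | no f₀≢0 = zero , f₀≢0
  ... | yes f₀≡0 with ∑≢0 (f ∘ suc) (λ z → nz (trans (cong₂ _+_ f₀≡0 z) (+-identityˡ 0#)))
  ...   | i , fᵢ≢0 = suc i , fᵢ≢0

  det≢0⇒transversal : ∀ {k} (M : Mat k k) → determinant M ≢ 0# → Transversal M
  det≢0⇒transversal {zero}  M nz = record { col = λ () ; col-inj = λ () ; nonzero = λ () }
  det≢0⇒transversal {suc k} M nz with ∑≢0 _ nz
  ... | j , tj≢0 = extend j
    (λ z → tj≢0 (trans (cong (λ x → sgn (toℕ j) * x * determinant (minor M j)) z) (trans (cong (_* determinant (minor M j)) (zeroʳ _)) (zeroˡ _))))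
    (det≢0⇒transversal (minor M j) (λ z → tj≢0 (trans (cong (sgn (toℕ j) * M zero j *_) z) (zeroʳ _))))

  module Norm (N : R → R) (N-* : ∀ x y → N (x * y) ≡ N x * N y) (N-1 : N 1# ≡ 1#) (N-sgn : ∀ j → N (sgn j) ≡ 1#) (N-0 : N 0# ≡ 0#) where

    -- Only the term of `τ` can survive the expansion, and `N` forgets its sign. If `τ` itself meets
    -- a zero entry, both sides vanish; this is how a cycle in Ψ₄ makes the norm 0.
    unique-transversal : ∀ {k} (M : Mat k k) (τ : Fin k → Fin k) → (∀ i j → τ i ≡ τ j → i ≡ j)
      → (∀ (T : Transversal M) i → Transversal.col T i ≡ τ i)
      → N (determinant M) ≡ ∏ (λ i → N (M i (τ i)))
    unique-transversal {zero}  M τ τ-inj uniq = N-1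
    unique-transversal {suc k} M τ τ-inj uniq = begin
      N (determinant M)
        ≡⟨ cong N (∑-single _ (τ zero) others) ⟩
      N (sgn (toℕ (τ zero)) * M zero (τ zero) * determinant (minor M (τ zero)))
        ≡⟨ trans (N-* _ _) (cong (_* N (determinant (minor M (τ zero))))
             (trans (N-* _ _) (trans (cong (_* N (M zero (τ zero))) (N-sgn (toℕ (τ zero)))) (*-identityˡ _)))) ⟩
      N (M zero (τ zero)) * N (determinant (minor M (τ zero)))
        ≡⟨ main ⟩
      N (M zero (τ zero)) * ∏ (λ i → N (M (suc i) (τ (suc i)))) ∎
      where
      others : ∀ j → j ≢ τ zero → sgn (toℕ j) * M zero j * determinant (minor M j) ≡ 0#
      others j j≢ with M zero j ≟ 0# | determinant (minor M j) ≟ 0#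
      ... | yes z | _     = trans (cong (λ x → sgn (toℕ j) * x * determinant (minor M j)) z) (trans (cong (_* determinant (minor M j)) (zeroʳ _)) (zeroˡ _))
      ... | no _  | yes z = trans (cong (sgn (toℕ j) * M zero j *_) z) (zeroʳ _)
      -- A nonzero term in column `j` extends to a transversal that begins with `j`.
      ... | no nz | no nd = contradiction (uniq (extend j nz (det≢0⇒transversal (minor M j) nd)) zero) j≢

      τ₀≢ : ∀ i → τ zero ≢ τ (suc i)
      τ₀≢ i eq with () ← τ-inj _ _ eq

      τ' : Fin k → Fin k
      τ' i = punchOut (τ₀≢ i)

      vanish : ∀ {x} → x ≡ 0# → ∀ y → N x * y ≡ 0#
      vanish z y = trans (cong (_* y) (trans (cong N z) N-0)) (zeroˡ y)

      main : N (M zero (τ zero)) * N (determinant (minor M (τ zero))) ≡ N (M zero (τ zero)) * ∏ (λ i → N (M (suc i) (τ (suc i))))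
      main with M zero (τ zero) ≟ 0#
      ... | yes z = trans (vanish z _) (sym (vanish z _))
      ... | no nz = cong (N (M zero (τ zero)) *_) (trans
        (unique-transversal (minor M (τ zero)) τ'
          (λ i j eq → suc-injective (τ-inj _ _ (trans (sym (punchIn-punchOut (τ₀≢ i))) (trans (cong (punchIn (τ zero)) eq) (punchIn-punchOut (τ₀≢ j))))))
          (λ T i → punchIn-injective (τ zero) _ _ (trans (uniq (extend (τ zero) nz T) (suc i)) (sym (punchIn-punchOut (τ₀≢ i))))))
        (∏-cong (λ i → cong (λ c → N (M (suc i) c)) (punchIn-punchOut (τ₀≢ i)))))

-- Finite sets, cyclic successor, quotients

injective⇒surjective : ∀ {k} (f : Fin k → Fin k) → (∀ i j → f i ≡ f j → i ≡ j) → ∀ y → ∃ λ x → f x ≡ y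
injective⇒surjective {suc k} f inj y with any? (λ x → f x F.≟ y)
... | yes hit = hit
... | no miss = contradiction
  (injective⇒≤ {f = λ x → punchOut (avoids x)} (λ {x} {x'} eq → inj x x' (punchOut-injective (avoids x) (avoids x') eq))) ℕ.1+n≰n
  where
  avoids : ∀ x → y ≢ f x
  avoids x eq = miss (x , sym eq)

least : ∀ {P : ℕ → Set} → Decidable P → ∀ n → P n → ∃ λ d → P d × (∀ j → j ℕ.< d → ¬ P j)
least {P} P? n = <-rec (λ n → P n → ∃ λ d → P d × (∀ j → j ℕ.< d → ¬ P j)) step n
  where
  step : ∀ n → (∀ {j} → j ℕ.< n → P j → ∃ λ d → P d × (∀ j → j ℕ.< d → ¬ P j)) → P n → ∃ λ d → P d × (∀ j → j ℕ.< d → ¬ P j)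
  step n rec pn with ℕ.anyUpTo? P? n
  ... | yes (j , j<n , pj) = rec j<n pj
  ... | no none = n , pn , λ j j<n pj → none (j , j<n , pj)

next-inject₁ : ∀ {k} (i : Fin k) → next (inject₁ i) ≡ suc i
next-inject₁ {suc k} zero    = refl
next-inject₁ {suc k} (suc i) rewrite next-inject₁ i = refl

next-fromℕ : ∀ k → next (F.fromℕ k) ≡ zero
next-fromℕ zero    = refl
next-fromℕ (suc k) rewrite next-fromℕ k = refl

next-injective : ∀ {k} (i j : Fin (suc k)) → next i ≡ next j → i ≡ j
next-injective {k} i j eq with view i | view j
... | ‵fromℕ     | ‵fromℕ     = refl
... | ‵fromℕ     | ‵inject₁ b with () ← trans (sym (next-fromℕ k)) (trans eq (next-inject₁ b))
... | ‵inject₁ a | ‵fromℕ     with () ← trans (sym (next-inject₁ a)) (trans eq (next-fromℕ k))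
... | ‵inject₁ a | ‵inject₁ b = cong inject₁ (suc-injective (trans (sym (next-inject₁ a)) (trans eq (next-inject₁ b))))

next-surjective : ∀ {k} (i : Fin (suc k)) → ∃ λ j → next j ≡ i
next-surjective = injective⇒surjective next next-injective

next∘next≢id : ∀ {k} (i : Fin (3 ℕ.+ k)) → next (next i) ≢ i
next∘next≢id {k} i eq with view i
... | ‵fromℕ with () ← trans (sym (cong next (next-fromℕ (2 ℕ.+ k)))) eq
next∘next≢id {k} .(inject₁ a) eq | ‵inject₁ a with view a
... | ‵fromℕ with () ← trans (sym (trans (cong next (next-inject₁ (F.fromℕ (suc k)))) (next-fromℕ (2 ℕ.+ k)))) eq
... | ‵inject₁ b = ℕ.m≢1+n+m (toℕ b) {1} (sym (trans (cong toℕ chain) (trans (toℕ-inject₁ (inject₁ b)) (toℕ-inject₁ b))))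
  where
  chain : suc (suc b) ≡ inject₁ (inject₁ b)
  chain = trans (sym (trans (cong next (next-inject₁ (inject₁ b))) (next-inject₁ (suc b)))) eq

next≢id : ∀ {k} (i : Fin (3 ℕ.+ k)) → next i ≢ i
next≢id i eq = next∘next≢id i (trans (cong next eq) eq)

next-closed : ∀ {k} (P : Fin (suc k) → Set) → (∀ i → P i → P (next i)) → ∀ i → P i → ∀ j → P j
next-closed {k} P step i Pi = <-weakInduction P P₀ up
  where
  up : ∀ j → P (inject₁ j) → P (suc j)
  up j p = subst P (next-inject₁ j) (step _ p)
  P₀ : P zero
  P₀ = subst P (next-fromℕ k) (step _ (<-weakInduction-startingFrom P Pi up (subst (toℕ i ℕ.≤_) (sym (toℕ-fromℕ k)) (toℕ≤pred[n] i))))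

-- Induction against the cyclic order: `zero` is the successor of the last index, so the indices are
-- treated in the order zero, last, ..., one, each after its successor.
next-downward : ∀ {k} (P : Fin (suc (suc k)) → Set) → P zero → (∀ i → i ≢ zero → P (next i) → P i) → ∀ i → P i
next-downward {k} P P₀ step = >-weakInduction P
  (step _ (λ ()) (subst P (sym (next-fromℕ (suc k))) P₀)) down
  where
  down : ∀ i → P (suc i) → P (inject₁ i)
  down zero    _ = P₀
  down (suc i) p = step _ (λ ()) (subst P (sym (next-inject₁ (suc i))) p)

≤-sumFinℕ : ∀ {k} (f : Fin k → ℕ) i → f i ℕ.≤ sumFinℕ f
≤-sumFinℕ f zero    = ℕ.m≤m+n _ _
≤-sumFinℕ f (suc i) = ℕ.≤-trans (≤-sumFinℕ (f ∘ suc) i) (ℕ.m≤n+m _ _)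

-- The sum of all values of `h` bounds each of them, so fuel `suc (sumFinℕ h)` outlasts every strict
-- ascent.
no-ascent : ∀ {k} (h : Fin k → ℕ) (P : Fin k → Set) → (∀ v → P v → ∃ λ u → P u × h v ℕ.< h u) → ∀ v → ¬ P v
no-ascent h P ascend v Pv = climb (suc (sumFinℕ h)) v Pv (ℕ.m≤m+n _ _)
  where
  climb : ∀ fuel v → P v → suc (sumFinℕ h) ℕ.≤ fuel ℕ.+ h v → ⊥
  climb zero       v Pv le = ℕ.<⇒≱ le (≤-sumFinℕ h v)
  climb (suc fuel) v Pv le with ascend v Pv
  ... | u , Pu , hv<hu = climb fuel u Pu
    (ℕ.≤-trans le (ℕ.≤-trans (ℕ.≤-reflexive (sym (ℕ.+-suc fuel (h v)))) (ℕ.+-monoʳ-≤ fuel hv<hu)))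

-- Distance to a set of targets in a finite graph

module Distance {n} {T : Fin n → Set} (T? : Decidable T) {A : Fin n → Fin n → Set} (A? : ∀ u v → Dec (A u v)) where

  Within : ℕ → Fin n → Set
  Within zero    v = T v
  Within (suc d) v = Within d v ⊎ ∃ λ u → A v u × Within d u

  within? : ∀ d → Decidable (Within d)
  within? zero    v = T? v
  within? (suc d) v = within? d v ⊎-dec any? (λ u → A? v u ×-dec within? d u)

  walk⇒within : ∀ {v t} → Star A v t → T t → ∃ λ d → Within d v
  walk⇒within ε        Tt = 0 , Tt
  walk⇒within (a ◅ as) Tt with walk⇒within as Tt
  ... | d , w = suc d , inj₂ (_ , a , w)

  module _ {S : Fin n → Set} (S? : Decidable S) (reach : ∀ v → S v → ∃ λ d → Within d v) where

    distance : Fin n → ℕ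
    distance v with S? v
    -- The value 0 outside `S` makes `distance-least` true at every vertex, in particular at the
    -- neighbour `u` found in `closer`.
    ... | no _  = 0
    ... | yes s = proj₁ (least (λ d → within? d v) (proj₁ (reach v s)) (proj₂ (reach v s)))

    distance-within : ∀ v → S v → Within (distance v) v
    distance-within v s with S? v
    ... | no ¬s = contradiction s ¬s
    ... | yes s = proj₁ (proj₂ (least (λ d → within? d v) (proj₁ (reach v s)) (proj₂ (reach v s))))

    distance-least : ∀ v d → Within d v → distance v ℕ.≤ d
    distance-least v d w with S? v
    ... | no _  = z≤n
    ... | yes s = ℕ.≮⇒≥ (λ d< → proj₂ (proj₂ (least (λ d → within? d v) (proj₁ (reach v s)) (proj₂ (reach v s)))) d d< w)

    closer : ∀ v → S v → T v ⊎ ∃ λ u → A v u × distance u ℕ.< distance v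
    closer v s = go (distance v) refl (distance-within v s)
      where
      go : ∀ d → distance v ≡ d → Within d v → T v ⊎ ∃ λ u → A v u × distance u ℕ.< distance v
      go zero    eq w = inj₁ w
      go (suc d) eq (inj₁ w) = contradiction (distance-least v d w) (ℕ.<⇒≱ (ℕ.≤-reflexive (sym eq)))
      go (suc d) eq (inj₂ (u , a , w)) = inj₂ (u , a , ℕ.≤-trans (s≤s (distance-least u d w)) (ℕ.≤-reflexive (sym eq)))

-- Orbits of a map of a finite set to itself

iter : ∀ {A : Set} → (A → A) → ℕ → A → A
iter f zero    x = x
iter f (suc j) x = f (iter f j x)

iter-+ : ∀ {A : Set} (f : A → A) i j x → iter f (i ℕ.+ j) x ≡ iter f i (iter f j x)
iter-+ f zero    j x = refl
iter-+ f (suc i) j x = cong f (iter-+ f i j x)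

-- The pigeonhole principle gives a point that recurs, and `L` is taken minimal. If steps a < b ≤ L
-- met, continuing from b to the return at step `suc L` would show a return already after
-- `suc (L ∸ b ℕ.+ a)` steps, against minimality.
eventually-periodic : ∀ {k} (s : Fin k → Fin k) (r : Fin k) → ∃₂ λ a L → let y = iter s a r in
  iter s (suc L) y ≡ y × (∀ i j → i ℕ.≤ L → j ℕ.≤ L → iter s i y ≡ iter s j y → i ≡ j)
eventually-periodic {k} s r
  with i , j , i<j , eq ← pigeonhole (ℕ.n<1+n k) (λ (i : Fin (suc k)) → iter s (toℕ i) r)
  with L , period , minimal ← least (λ L → iter s (suc L) (iter s (toℕ i) r) F.≟ iter s (toℕ i) r) (toℕ j ℕ.∸ suc (toℕ i))
         (trans (sym (iter-+ s (suc (toℕ j ℕ.∸ suc (toℕ i))) (toℕ i) r))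
           (trans (cong (λ d → iter s d r) (trans (sym (ℕ.+-suc _ (toℕ i))) (ℕ.m∸n+n≡m i<j))) (sym eq)))
  = toℕ i , L , period , distinct
  where
  y = iter s (toℕ i) r

  no-return : ∀ a b → a ℕ.< b → b ℕ.≤ L → iter s a y ≢ iter s b y
  no-return a b a<b b≤L e = minimal (L ℕ.∸ b ℕ.+ a) small (trans
    (iter-+ s (suc (L ℕ.∸ b)) a y)
    (trans (cong (iter s (suc (L ℕ.∸ b))) e) (trans (sym (iter-+ s (suc (L ℕ.∸ b)) b y)) (trans (cong (λ d → iter s (suc d) y) (ℕ.m∸n+n≡m b≤L)) period))))
    where
    small : L ℕ.∸ b ℕ.+ a ℕ.< L
    small = ℕ.≤-trans (ℕ.+-monoʳ-< (L ℕ.∸ b) a<b) (ℕ.≤-reflexive (ℕ.m∸n+n≡m b≤L))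

  distinct : ∀ a b → a ℕ.≤ L → b ℕ.≤ L → iter s a y ≡ iter s b y → a ≡ b
  distinct a b a≤L b≤L e with ℕ.<-cmp a b
  ... | tri< a<b _ _ = contradiction e (no-return a b a<b b≤L)
  ... | tri≈ _ a≡b _ = a≡b
  ... | tri> _ _ b<a = contradiction (sym e) (no-return b a b<a a≤L)

-- Quotients by the equivalence that a list of pairs generates

record Quotient {k} (R : Rel (Fin k) _) : Set where
  field
    t     : ℕ
    cls   : Fin k → Fin t
    rep   : Fin t → Fin k
    cls-rep : ∀ l → cls (rep l) ≡ l
    sound : ∀ {x y} → R x y → cls x ≡ cls y
    exact : ∀ {x y} → cls x ≡ cls y → Star (SymClosure R) x y

-- Classes are merged one pair at a time, as in union-find. If the classes of `a` and `b` differ,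
-- `punchOut` deletes the label of `a`, and its elements receive the new label of the class of `b`,
-- so no label is left without elements.
quotient : ∀ {k} (ps : List (Fin k × Fin k)) → Quotient (λ x y → (x , y) List.∈ ps)
quotient [] = record
  { t = _ ; cls = λ x → x ; rep = λ x → x ; cls-rep = λ _ → refl ; sound = λ () ; exact = λ { refl → ε } }
quotient ((a , b) ∷ ps) with quotient ps
... | Q with Quotient.cls Q a F.≟ Quotient.cls Q b
...   | yes eq = record
  { t = t ; cls = cls ; rep = rep ; cls-rep = cls-rep
  ; sound = λ { (Any.here refl) → eq ; (Any.there p) → sound p }
  ; exact = λ e → Star.map (Sym.map Any.there) (exact e) }
  where open Quotient Q
...   | no neq = merge (Quotient.t Q) refl
  where
  open Quotient Q
  -- `punchOut` needs the number of classes to be a successor; passing it as a variable with an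
  -- equation permits the case split.
  merge : ∀ t' → t ≡ t' → Quotient (λ x y → (x , y) List.∈ (a , b) ∷ ps)
  merge zero    refl = contradiction (cls a) (λ ())
  merge (suc t') eq = record
    { t = t' ; cls = collapse ∘ cls' ; rep = rep' ; cls-rep = cls-rep'
    ; sound = λ { (Any.here refl) → collapse-a ; (Any.there p) → cong (collapse ∘ subst Fin eq) (sound p) }
    ; exact = exact' }
    where
    cls' : Fin _ → Fin (suc t')
    cls' x = subst Fin eq (cls x)

    cls'-inj : ∀ {x y} → cls' x ≡ cls' y → cls x ≡ cls y
    cls'-inj e = subst-injective eq e

    α β : Fin (suc t')
    α = cls' a
    β = cls' b
    α≢β : α ≢ β
    α≢β = neq ∘ cls'-inj

    collapse : Fin (suc t') → Fin t'
    collapse c with α F.≟ c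
    ... | yes _  = punchOut α≢β
    ... | no α≢c = punchOut α≢c

    collapse-a : collapse α ≡ collapse β
    collapse-a with α F.≟ α | α F.≟ β
    ... | no ¬r | _      = contradiction refl ¬r
    ... | yes _ | yes e  = contradiction e α≢β
    ... | yes _ | no α≢β' = punchOut-cong α refl

    rep' : Fin t' → Fin _
    rep' l = rep (subst Fin (sym eq) (punchIn α l))

    cls-rep' : ∀ l → collapse (cls' (rep' l)) ≡ l
    cls-rep' l = trans (cong collapse (trans (cong (subst Fin eq) (cls-rep _)) (subst-subst-sym eq))) lemma
      where
      lemma : collapse (punchIn α l) ≡ l
      lemma with α F.≟ punchIn α l
      ... | yes e = contradiction (sym e) (punchInᵢ≢i α l)
      ... | no _  = punchOut-punchIn α

    R' : Rel (Fin _) _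
    R' x y = (x , y) List.∈ (a , b) ∷ ps

    old : ∀ {x y} → cls' x ≡ cls' y → Star (SymClosure R') x y
    old e = Star.map (Sym.map Any.there) (exact (cls'-inj e))

    exact' : ∀ {x y} → collapse (cls' x) ≡ collapse (cls' y) → Star (SymClosure R') x y
    exact' {x} {y} e with α F.≟ cls' x | α F.≟ cls' y
    ... | yes ax | yes ay = old (trans (sym ax) ay)
    ... | yes ax | no ¬ay = old (sym ax) ◅◅ (fwd (Any.here refl) ◅ old (punchOut-injective α≢β ¬ay e))
    ... | no ¬ax | yes ay = old (punchOut-injective ¬ax α≢β e) ◅◅ (bwd (Any.here refl) ◅ old ay)
    ... | no ¬ax | no ¬ay = old (punchOut-injective ¬ax ¬ay e)

-- Substructures of mixed graphs

module Edges {n m} (G : MixedGraph n m) (simple : IsSimple G) where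

  joins-sym : ∀ {e u v} → Joins G e u v → Joins G e v u
  joins-sym (inj₁ p) = inj₂ p
  joins-sym (inj₂ p) = inj₁ p

  joins-endˡ : ∀ {e u v} → Joins G e u v → EndPt G u e
  joins-endˡ (inj₁ (p , _)) = inj₁ (sym p)
  joins-endˡ (inj₂ (_ , q)) = inj₂ (sym q)

  joins-endʳ : ∀ {e u v} → Joins G e u v → EndPt G v e
  joins-endʳ = joins-endˡ ∘ joins-sym

  joins-ends : ∀ {e u v w} → Joins G e u v → EndPt G w e → w ≡ u ⊎ w ≡ v
  joins-ends (inj₁ (p , q)) (inj₁ r) = inj₁ (trans r p)
  joins-ends (inj₁ (p , q)) (inj₂ r) = inj₂ (trans r q)
  joins-ends (inj₂ (p , q)) (inj₁ r) = inj₂ (trans r p)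
  joins-ends (inj₂ (p , q)) (inj₂ r) = inj₁ (trans r q)

  joins-distinct : ∀ {e u v} → Joins G e u v → u ≢ v
  joins-distinct (inj₁ (p , q)) u≡v = proj₁ simple _ (trans p (trans u≡v (sym q)))
  joins-distinct (inj₂ (p , q)) u≡v = proj₁ simple _ (trans p (trans (sym u≡v) (sym q)))

  joins-other : ∀ {e u v w} → Joins G e u v → EndPt G w e → w ≢ u → w ≡ v
  joins-other j w∈e w≢u with joins-ends j w∈e
  ... | inj₁ w≡u = contradiction w≡u w≢u
  ... | inj₂ w≡v = w≡v

  joins-unique : ∀ {e e' u v} → Joins G e u v → Joins G e' u v → e ≡ e'
  joins-unique (inj₁ (refl , refl)) j' = proj₂ simple _ _ j'
  joins-unique (inj₂ (refl , refl)) j' = proj₂ simple _ _ (joins-sym j')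

  ends-join : ∀ {e u v} → EndPt G u e → EndPt G v e → u ≢ v → Joins G e u v
  ends-join (inj₁ p) (inj₁ q) u≢v = contradiction (trans p (sym q)) u≢v
  ends-join (inj₁ p) (inj₂ q) u≢v = inj₁ (sym p , sym q)
  ends-join (inj₂ p) (inj₁ q) u≢v = inj₂ (sym q , sym p)
  ends-join (inj₂ p) (inj₂ q) u≢v = contradiction (trans p (sym q)) u≢v

  opposite : ∀ {e v} → EndPt G v e → ∃ λ u → Joins G e v u
  opposite {e} (inj₁ p) = tgt (G e) , inj₁ (sym p , refl)
  opposite {e} (inj₂ p) = src (G e) , inj₂ (refl , sym p)

  endPt? : ∀ v e → Dec (EndPt G v e)
  endPt? v e = (v F.≟ src (G e)) ⊎-dec (v F.≟ tgt (G e))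

  joins? : ∀ e u v → Dec (Joins G e u v)
  joins? e u v = ((src (G e) F.≟ u) ×-dec (tgt (G e) F.≟ v)) ⊎-dec ((src (G e) F.≟ v) ×-dec (tgt (G e) F.≟ u))

-- The vertices are listed by `elems` and the edges by `enumAs`; the arguments below see only this
-- interface. Using one `k` for both says that the substructure is square.
record Enumerates {n k} (p : Subset n) (ι : Fin k → Fin n) : Set where
  field
    injective : ∀ i j → ι i ≡ ι j → i ≡ j
    member    : ∀ i → ι i ∈ p
    index     : ∀ {v} → v ∈ p → ∃ λ i → ι i ≡ v

module Structure {n m k} (G : MixedGraph n m) (simple : IsSimple G) (V₁ : Subset n) (E₁ : Subset m)
  {ιV : Fin k → Fin n} (enumV : Enumerates V₁ ιV) {ιE : Fin k → Fin m} (enumE : Enumerates E₁ ιE) where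

  open Edges G simple
  open Substructure G V₁ E₁
  module V = Enumerates enumV
  module E = Enumerates enumE

  one-end-unique : ∀ {e u v} → OneEndIn e → u ∈ V₁ → v ∈ V₁ → EndPt G u e → EndPt G v e → u ≡ v
  one-end-unique (inj₁ (s∈ , t∉)) u∈ v∈ (inj₁ p) (inj₁ q) = trans p (sym q)
  one-end-unique (inj₁ (s∈ , t∉)) u∈ v∈ (inj₂ refl) _     = contradiction u∈ t∉
  one-end-unique (inj₁ (s∈ , t∉)) u∈ v∈ _     (inj₂ refl) = contradiction v∈ t∉
  one-end-unique (inj₂ (s∉ , t∈)) u∈ v∈ (inj₂ p) (inj₂ q) = trans p (sym q)
  one-end-unique (inj₂ (s∉ , t∈)) u∈ v∈ (inj₁ refl) _     = contradiction u∈ s∉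
  one-end-unique (inj₂ (s∉ , t∈)) u∈ v∈ _     (inj₁ refl) = contradiction v∈ s∉

  one-end : ∀ {e} → OneEndIn e → ∃ λ v → v ∈ V₁ × EndPt G v e
  one-end (inj₁ (s∈ , _)) = _ , s∈ , inj₁ refl
  one-end (inj₂ (_ , t∈)) = _ , t∈ , inj₂ refl

  ¬one-and-both : ∀ {e} → OneEndIn e → BothEndsIn e → ⊥
  ¬one-and-both (inj₁ (_ , t∉)) (_ , t∈) = t∉ t∈
  ¬one-and-both (inj₂ (s∉ , _)) (s∈ , _) = s∉ s∈

  joins-both : ∀ {e u v} → Joins G e u v → u ∈ V₁ → v ∈ V₁ → BothEndsIn e
  joins-both (inj₁ (refl , refl)) u∈ v∈ = u∈ , v∈
  joins-both (inj₂ (refl , refl)) u∈ v∈ = v∈ , u∈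

  both-joins : ∀ {e u v} → BothEndsIn e → Joins G e u v → u ∈ V₁ × v ∈ V₁
  both-joins (s∈ , t∈) (inj₁ (refl , refl)) = s∈ , t∈
  both-joins (s∈ , t∈) (inj₂ (refl , refl)) = t∈ , s∈

  Adj : Fin n → Fin n → Set
  Adj u v = ∃ λ e → e ∈ E₁ × BothEndsIn e × Joins G e u v

  adj? : ∀ u v → Dec (Adj u v)
  adj? u v = any? (λ e → (e ∈? E₁) ×-dec (((src (G e) ∈? V₁) ×-dec (tgt (G e) ∈? V₁)) ×-dec joins? e u v))

  mutual
    -- `Inc` relates vertices to edges only, so a path alternates between them. The vertices before
    -- and after an edge are either equal, and the detour is dropped, or they are its two ends and
    -- both lie in `V₁`.
    linked⇒walk : ∀ {v u} → Linked (inj₁ v) (inj₁ u) → Star Adj v u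
    linked⇒walk ε = ε
    linked⇒walk (_◅_ {j = inj₂ e} (fwd inc) p) = linked⇒walkᵉ p inc
    linked⇒walk (_◅_ {j = inj₁ _} (fwd ()) _)
    linked⇒walk (_◅_ {j = inj₁ _} (bwd ()) _)
    linked⇒walk (_◅_ {j = inj₂ _} (bwd ()) _)

    linked⇒walkᵉ : ∀ {e u w} → Linked (inj₂ e) (inj₁ u) → Inc (inj₁ w) (inj₂ e) → Star Adj w u
    linked⇒walkᵉ {w = w} (_◅_ {j = inj₁ w'} (bwd (w'∈ , e∈ , q)) p) (w∈ , _ , r) with w F.≟ w'
    ... | yes refl = linked⇒walk p
    ... | no w≢w' = (_ , e∈ , joins-both j w∈ w'∈ , j) ◅ linked⇒walk p
      where j = ends-join r q w≢w'
    linked⇒walkᵉ (_◅_ {j = inj₁ _} (fwd ()) _) _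
    linked⇒walkᵉ (_◅_ {j = inj₂ _} (fwd ()) _) _
    linked⇒walkᵉ (_◅_ {j = inj₂ _} (bwd ()) _) _

  -- Components with a chosen root edge or cycle

  module Labelled (C : Components) where

    open Components C
    open InComponents C

    Root : Fin t → Set
    Root l = ∃ λ e → EIn l e × OneEndIn e

    kindOf : ∀ {l} → Root l ⊎ Cycle l → Kind
    kindOf (inj₁ _)  = tree
    kindOf (inj₂ Cy) = uni (Cycle.psi Cy)

    labels-agree : ∀ {v e} → v ∈ V₁ → e ∈ E₁ → EndPt G v e → lab (inj₁ v) ≡ lab (inj₂ e)
    labels-agree v∈ e∈ p = respect _ _ (v∈ , e∈ , p)

    inner-connected : ∀ l → InnerConnected l
    inner-connected l u v (u∈ , lu) (v∈ , lv) = inner u∈ lu (linked⇒walk (linked _ _ u∈ v∈ (trans lu (sym lv))))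
      where
      inner : ∀ {u v} → u ∈ V₁ → lab (inj₁ u) ≡ l → Star Adj u v → Star (InnerAdj l) u v
      inner u∈ lu ε = ε
      inner u∈ lu ((e , e∈ , b , j) ◅ p) =
        (e , (e∈ , le) , b , j) ◅ inner (proj₂ (both-joins b j)) (trans (labels-agree (proj₂ (both-joins b j)) e∈ (joins-endʳ j)) le) p
        where
        le = trans (sym (labels-agree u∈ e∈ (joins-endˡ j))) lu

    module _ {l} (Cy : Cycle l) where
      open Cycle Cy

      -- Two positions with the same edge would traverse it in opposite directions, so that
      -- `next (next i) ≡ i`, which fails for length at least three.
      es-injective : ∀ i j → es i ≡ es j → i ≡ j
      es-injective i j eq with joins-ends (esJ i) (subst (EndPt G (vs j)) (sym eq) (joins-endˡ (esJ j)))
      ... | inj₁ p = sym (vsInj _ _ p)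
      ... | inj₂ p = contradiction (trans (cong next (sym (vsInj _ _ p))) (vsInj _ _ (sym i≡)))
                       (next∘next≢id i)
        where
        i≡ : vs i ≡ vs (next j)
        i≡ = joins-other (subst (λ e → Joins G e (vs j) (vs (next j))) (sym eq) (esJ j)) (joins-endˡ (esJ i))
               (λ q → joins-distinct (esJ i) (trans q p))

      es-label : ∀ i → lab (inj₂ (es i)) ≡ l
      es-label i = trans (sym (labels-agree (proj₁ (vsIn i)) (esIn i) (joins-endˡ (esJ i)))) (proj₂ (vsIn i))

      es-both : ∀ i → BothEndsIn (es i)
      es-both i = joins-both (esJ i) (proj₁ (vsIn i)) (proj₁ (vsIn (next i)))

    module Chosen (choice : ∀ l → Root l ⊎ Cycle l) where

      TargetOf : ∀ {l} → Root l ⊎ Cycle l → Fin n → Set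
      TargetOf (inj₁ (e , _)) v = EndPt G v e
      TargetOf (inj₂ Cy)      v = ∃ λ i → Cycle.vs Cy i ≡ v

      Target : Fin n → Set
      Target v = TargetOf (choice (lab (inj₁ v))) v

      target? : ∀ v → Dec (Target v)
      target? v with choice (lab (inj₁ v))
      ... | inj₁ (e , _) = endPt? v e
      ... | inj₂ Cy      = any? (λ i → Cycle.vs Cy i F.≟ v)

      target : ∀ {v l} → lab (inj₁ v) ≡ l → TargetOf (choice l) v → Target v
      target refl T = T

      target⁻¹ : ∀ {v l} → lab (inj₁ v) ≡ l → Target v → TargetOf (choice l) v
      target⁻¹ refl T = T

      some-target : ∀ l → ∃ λ v → v ∈ V₁ × lab (inj₁ v) ≡ l × TargetOf (choice l) v
      some-target l with choice l
      ... | inj₁ (e , (e∈ , le) , one) = let v , v∈ , p = one-end one in v , v∈ , trans (labels-agree v∈ e∈ p) le , p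
      ... | inj₂ Cy = let v∈ , lv = Cycle.vsIn Cy zero in _ , v∈ , lv , zero , refl

      cycle-ends-target : ∀ {l} (Cy : Cycle l) → choice l ≡ inj₂ Cy → ∀ i {v} → v ∈ V₁ → EndPt G v (Cycle.es Cy i) → Target v
      cycle-ends-target {l} Cy eq i {v} v∈ p = target (trans (labels-agree v∈ (Cycle.esIn Cy i) p) (es-label Cy i)) (onCy (joins-ends (Cycle.esJ Cy i) p))
        where
        onCy : v ≡ Cycle.vs Cy i ⊎ v ≡ Cycle.vs Cy (next i) → TargetOf (choice l) v
        onCy q rewrite eq with q
        ... | inj₁ refl = i , refl
        ... | inj₂ refl = next i , refl

      ¬root-and-cyc : ∀ {l l'} {R : Root l} {Cy : Cycle l'} → choice l ≡ inj₁ R → choice l' ≡ inj₂ Cy → l ≢ l'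
      ¬root-and-cyc p q refl with () ← trans (sym p) q

      module Heights (height : Fin n → ℕ) where

        -- The label `l` is tied to `v` by an equation instead of being computed, so that the
        -- parents of two vertices can be compared by matching on an equality of labels. Of `height`
        -- only the strict decrease along inner edges is used.
        data Parent (v : Fin n) : Set where
          root  : ∀ {l} (R : Root l) → lab (inj₁ v) ≡ l → choice l ≡ inj₁ R → EndPt G v (proj₁ R) → Parent v
          cyc   : ∀ {l} (Cy : Cycle l) → lab (inj₁ v) ≡ l → choice l ≡ inj₂ Cy → ∀ i → Cycle.vs Cy i ≡ v → Parent v
          inner : ¬ Target v → ∀ e u → e ∈ E₁ → BothEndsIn e → Joins G e v u → height u ℕ.< height v → Parent v

        edge : ∀ {v} → Parent v → Fin m
        edge (root R _ _ _)        = proj₁ R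
        edge (cyc Cy _ _ i _)      = Cycle.es Cy i
        edge (inner _ e _ _ _ _ _) = e

        edge-∈ : ∀ {v} (P : Parent v) → edge P ∈ E₁
        edge-∈ (root R _ _ _)         = proj₁ (proj₁ (proj₂ R))
        edge-∈ (cyc Cy _ _ i _)       = Cycle.esIn Cy i
        edge-∈ (inner _ e _ e∈ _ _ _) = e∈

        edge-end : ∀ {v} (P : Parent v) → EndPt G v (edge P)
        edge-end (root R _ _ p)       = p
        edge-end (cyc Cy _ _ i refl)  = joins-endˡ (Cycle.esJ Cy i)
        edge-end (inner _ _ _ _ _ j _) = joins-endˡ j

        edge-at-cycle : ∀ {l v} (Cy : Cycle l) → choice l ≡ inj₂ Cy → ∀ i → Cycle.vs Cy i ≡ v → (P : Parent v) → edge P ≡ Cycle.es Cy i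
        edge-at-cycle Cy eq i refl (root R lv eq' _) = contradiction (trans (sym lv) (proj₂ (Cycle.vsIn Cy i))) (¬root-and-cyc eq' eq)
        edge-at-cycle Cy eq i refl (cyc Cy' lv' eq' j p) with trans (sym lv') (proj₂ (Cycle.vsIn Cy i))
        ... | refl with inj₂-injective (trans (sym eq) eq')
        ... | refl = cong (Cycle.es Cy) (Cycle.vsInj Cy _ _ p)
        edge-at-cycle Cy eq i refl (inner ¬T _ _ _ _ _ _) =
          contradiction (cycle-ends-target Cy eq i (proj₁ (Cycle.vsIn Cy i)) (joins-endˡ (Cycle.esJ Cy i))) ¬T

        -- A root edge has a single end in `V₁`, and a cycle edge occurs at a single position. A
        -- cycle edge cannot be an inner parent edge, since its ends are targets. An inner edge that
        -- is parent edge of both its ends would make the height decrease in both directions.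
        edge-injective : ∀ {v v'} → v ∈ V₁ → v' ∈ V₁ → (P : Parent v) (P' : Parent v') → edge P ≡ edge P' → v ≡ v'
        edge-injective v∈ v'∈ P@(root (_ , _ , one) _ _ p) P' eq =
          one-end-unique one v∈ v'∈ p (subst (EndPt G _) (sym eq) (edge-end P'))
        edge-injective v∈ v'∈ P P'@(root (_ , _ , one) _ _ p) eq =
          one-end-unique one v∈ v'∈ (subst (EndPt G _) eq (edge-end P)) p
        edge-injective v∈ v'∈ P@(cyc Cy lv eqC i refl) P'@(cyc Cy' lv' eqC' i' refl) eq
          with trans (sym (es-label Cy i)) (trans (cong (lab ∘ inj₂) eq) (es-label Cy' i'))
        ... | refl with inj₂-injective (trans (sym eqC) eqC')
        ... | refl = cong (Cycle.vs Cy) (es-injective Cy i i' eq)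
        edge-injective v∈ v'∈ P@(cyc Cy lv eqC i refl) P'@(inner ¬T _ _ _ _ _ _) eq =
          contradiction (cycle-ends-target Cy eqC i v'∈ (subst (EndPt G _) (sym eq) (edge-end P'))) ¬T
        edge-injective v∈ v'∈ P@(inner ¬T _ _ _ _ _ _) P'@(cyc Cy lv eqC i refl) eq =
          contradiction (cycle-ends-target Cy eqC i v∈ (subst (EndPt G _) eq (edge-end P))) ¬T
        edge-injective {v} {v'} v∈ v'∈ (inner _ e u _ _ j lt) (inner _ .e u' _ _ j' lt') refl with v F.≟ v'
        ... | yes v≡v' = v≡v'
        ... | no v≢v' = contradiction (ℕ.<-trans lt' (subst₂ ℕ._<_ (cong height (sym v'≡u)) (cong height v≡u') lt)) (ℕ.<-irrefl refl)
          where
          v'≡u : v' ≡ u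
          v'≡u = joins-other j (joins-endˡ j') (v≢v' ∘ sym)
          v≡u' : v ≡ u'
          v≡u' = joins-other j' (joins-endˡ j) v≢v'

        module Forest (par : ∀ i → Parent (ιV i)) where

          row : Fin k → Fin k
          row i = proj₁ (E.index (edge-∈ (par i)))

          row-edge : ∀ i → ιE (row i) ≡ edge (par i)
          row-edge i = proj₂ (E.index (edge-∈ (par i)))

          row-injective : ∀ i j → row i ≡ row j → i ≡ j
          row-injective i j eq = V.injective i j (edge-injective (V.member i) (V.member j) (par i) (par j)
            (trans (sym (row-edge i)) (trans (cong ιE eq) (row-edge j))))

          owner : Fin k → Fin k
          owner r = proj₁ (injective⇒surjective row row-injective r)

          row-owner : ∀ r → row (owner r) ≡ r
          row-owner r = proj₂ (injective⇒surjective row row-injective r)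

          owner-row : ∀ i → owner (row i) ≡ i
          owner-row i = row-injective _ _ (row-owner (row i))

          owner-injective : ∀ r s → owner r ≡ owner s → r ≡ s
          owner-injective r s eq = trans (sym (row-owner r)) (trans (cong row eq) (row-owner s))

          owner-edge : ∀ r → ιE r ≡ edge (par (owner r))
          owner-edge r = trans (cong ιE (sym (row-owner r))) (row-edge (owner r))

          owner-end : ∀ r → EndPt G (ιV (owner r)) (ιE r)
          owner-end r = subst (EndPt G _) (sym (owner-edge r)) (edge-end (par (owner r)))

          owner-of : ∀ {e} → e ∈ E₁ → ∃ λ a → edge (par a) ≡ e
          owner-of e∈ = let r , eq = E.index e∈ in owner r , trans (sym (owner-edge r)) eq

          -- Of the two edges of a cycle at a vertex v which is not a target, one is not
          -- the parent edge of v, so it is the parent edge of its other, higher, end.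
          higher-end : ∀ {e a u} → ¬ Target (ιV a) → e ∈ E₁ → Joins G e (ιV a) u → edge (par a) ≢ e
            → ¬ Target u × height (ιV a) ℕ.< height u
          higher-end {e} {a} {u} ¬T e∈ j ne = by-owner (owner-of e∈)
            where
            from-parent : ∀ b → ιV b ≡ u → (P : Parent (ιV b)) → edge P ≡ e → ¬ Target u × height (ιV a) ℕ.< height u
            from-parent b refl (root (_ , _ , one) _ _ p) refl =
              contradiction (one-end-unique one (V.member a) (V.member b) (joins-endˡ j) p) (joins-distinct j)
            from-parent b refl (cyc Cy _ eq i _) refl =
              contradiction (cycle-ends-target Cy eq i (V.member a) (joins-endˡ j)) ¬T
            from-parent b refl (inner ¬Tu _ _ _ _ j' lt) refl =
              ¬Tu , subst (λ x → height x ℕ.< height u) (sym (joins-other j' (joins-endˡ j) (joins-distinct j))) lt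

            by-owner : (∃ λ b → edge (par b) ≡ e) → ¬ Target u × height (ιV a) ℕ.< height u
            by-owner (b , eq) with joins-ends j (subst (EndPt G (ιV b)) eq (edge-end (par b)))
            ... | inj₁ b≡a = contradiction (trans (cong (λ x → edge (par x)) (sym (V.injective b a b≡a))) eq) ne
            ... | inj₂ b≡u = from-parent b b≡u (par b) eq

          module _ {l} (Cy : Cycle l) where
            open Cycle Cy

            ascend : ∀ v → (∃ λ i → vs i ≡ v) × ¬ Target v → ∃ λ u → ((∃ λ i → vs i ≡ u) × ¬ Target u) × height v ℕ.< height u
            ascend v ((i , vi) , ¬T) with next-surjective i
            ... | j , refl with V.index (proj₁ (vsIn (next j)))
            ...   | a , a≡ with trans a≡ vi
            ...     | refl with edge (par a) F.≟ es (next j)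
            ...       | no ne =
              let ¬Tu , lt = higher-end ¬T (esIn (next j)) (subst (λ x → Joins G (es (next j)) x (vs (next (next j)))) vi (esJ (next j))) ne
              in _ , ((_ , refl) , ¬Tu) , lt
            ...       | yes eq =
              let ¬Tu , lt = higher-end ¬T (esIn j) (subst (λ x → Joins G (es j) x (vs j)) vi (joins-sym (esJ j)))
                               (λ eq' → next≢id j (es-injective Cy _ _ (trans (sym eq) eq')))
              in _ , ((_ , refl) , ¬Tu) , lt

            -- A vertex of the cycle that is not a target has, by `ascend`, a higher one of the same
            -- sort on the cycle, and heights cannot increase forever. Acyclicity of rooted
            -- components and uniqueness of the cycle in the others both come from this.
            cycle-targets : ∀ i → Target (vs i)
            cycle-targets i with target? (vs i)
            ... | yes T = T
            ... | no ¬T = contradiction ((i , refl) , ¬T) (no-ascent height _ ascend (vs i))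

          module _ {l} {Cy : Cycle l} (chosen : choice l ≡ inj₂ Cy) (Cy' : Cycle l) where
            private
              module C  = Cycle Cy
              module C' = Cycle Cy'

            vertex-on-chosen : ∀ i → ∃ λ j → C.vs j ≡ C'.vs i
            vertex-on-chosen i = subst (λ c → TargetOf c (C'.vs i)) chosen (target⁻¹ (proj₂ (C'.vsIn i)) (cycle-targets Cy' i))

            -- Each edge of `Cy'` is the parent edge of one of its ends. That end lies on the chosen
            -- cycle, where parent edges are edges of the chosen cycle.
            edge-on-chosen : ∀ i → ∃ λ j → C.es j ≡ C'.es i
            edge-on-chosen i with owner-of (C'.esIn i)
            ... | a , eq with joins-ends (C'.esJ i) (subst (EndPt G (ιV a)) eq (edge-end (par a)))
            ...   | inj₁ p = let j , q = vertex-on-chosen i in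
                      j , trans (sym (edge-at-cycle Cy chosen j (trans q (sym p)) (par a))) eq
            ...   | inj₂ p = let j , q = vertex-on-chosen (next i) in
                      j , trans (sym (edge-at-cycle Cy chosen j (trans q (sym p)) (par a))) eq

            -- The two edges of `Cy'` at the shared vertex both belong to `Cy`, hence each is the
            -- edge of `Cy` before or after that vertex. Being different they cannot both be the one
            -- before, so one of them is `C.es j`.
            edge-at : ∀ i j → C'.vs i ≡ C.vs j → ∃ λ i' → C'.es i' ≡ C.es j
            edge-at i j eq with next-surjective i
            ... | h , refl with edge-on-chosen h | edge-on-chosen (next h)
            ...   | p , ep | q , eq' with joins-ends (C.esJ p) (at p h ep (joins-endʳ (C'.esJ h)))
                                        | joins-ends (C.esJ q) (at q (next h) eq' (joins-endˡ (C'.esJ (next h))))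
              where
              at : ∀ p i → C.es p ≡ C'.es i → EndPt G (C'.vs (next h)) (C'.es i) → EndPt G (C.vs j) (C.es p)
              at p i ep = subst₂ (EndPt G) eq (sym ep)
            ...     | inj₁ j≡p | _ = h , trans (sym ep) (cong C.es (sym (C.vsInj _ _ j≡p)))
            ...     | inj₂ _   | inj₁ j≡q = next h , trans (sym eq') (cong C.es (sym (C.vsInj _ _ j≡q)))
            ...     | inj₂ j≡p | inj₂ j≡q = contradiction
                        (es-injective Cy' _ _ (trans (sym eq') (trans (cong C.es (next-injective q p (C.vsInj _ _ (trans (sym j≡q) j≡p)))) ep)))
                        (next≢id h)

            -- From a shared vertex the next edge of `Cy` is also on `Cy'` by `edge-at`, hence so is
            -- the next vertex; one turn around `Cy` meets all its vertices.
            all-vertices : ∀ j → ∃ λ i → C'.vs i ≡ C.vs j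
            all-vertices = let j₀ , eq = vertex-on-chosen zero in
              next-closed (λ j → ∃ λ i → C'.vs i ≡ C.vs j) step j₀ (zero , sym eq)
              where
              step : ∀ j → (∃ λ i → C'.vs i ≡ C.vs j) → ∃ λ i → C'.vs i ≡ C.vs (next j)
              step j (i , eq) with edge-at i j eq
              ... | i' , eq' with joins-ends (C'.esJ i') (subst (EndPt G _) (sym eq') (joins-endʳ (C.esJ j)))
              ...   | inj₁ p = i' , sym p
              ...   | inj₂ p = next i' , sym p

            chosen⊆ : ∀ {e} → OnCycle Cy e → OnCycle Cy' e
            chosen⊆ (j , refl) = let i , eq = all-vertices j in edge-at i j eq

            ⊆chosen : ∀ {e} → OnCycle Cy' e → OnCycle Cy e
            ⊆chosen (i , refl) = edge-on-chosen i

          rootlessTree : ∀ {l R} → choice l ≡ inj₁ R → RootlessTree l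
          rootlessTree {l} {R@(e , e-in , one)} chosen = inner-connected l , acyclic , e , (e-in , one) , unique
            where
            acyclic : ¬ Cycle l
            -- All vertices of such a cycle would be targets, that is, ends of the root edge, which
            -- has only one end in `V₁`.
            acyclic Cy = case vsInj _ _ (one-end-unique one (proj₁ (vsIn zero)) (proj₁ (vsIn (suc zero))) (end zero) (end (suc zero))) of λ ()
              where
              open Cycle Cy
              end : ∀ i → EndPt G (vs i) e
              end i = subst (λ c → TargetOf c (vs i)) chosen (target⁻¹ (proj₂ (vsIn i)) (cycle-targets Cy i))

            -- Every edge of `E₁` is a parent edge, and parent edges of the kinds `cyc` and `inner`
            -- have both ends in `V₁`.
            unique : ∀ e' → EIn l e' → OneEndIn e' → e' ≡ e
            unique e' (e'∈ , le') one' with owner-of e'∈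
            ... | a , refl with par a | V.member a
            ...   | root R' la chosen' p | a∈ with trans (sym la) (trans (labels-agree a∈ e'∈ p) le')
            ...     | refl = cong proj₁ (inj₁-injective (trans (sym chosen') chosen))
            unique e' (e'∈ , le') one' | a , refl | cyc Cy _ _ i _ | _ = ⊥-elim (¬one-and-both one' (es-both Cy i))
            unique e' (e'∈ , le') one' | a , refl | inner _ _ _ _ b _ _ | _ = ⊥-elim (¬one-and-both one' b)

          unicyclic : ∀ {l Cy} → choice l ≡ inj₂ Cy → Unicyclic l
          unicyclic {l} {Cy} chosen = both , inner-connected l , Cy , λ C₁ C₂ e →
            chosen⊆ chosen C₂ ∘ ⊆chosen chosen C₁ , chosen⊆ chosen C₁ ∘ ⊆chosen chosen C₂
            where
            both : ∀ e → EIn l e → BothEndsIn e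
            both e (e∈ , le) with owner-of e∈
            ... | a , refl with par a | V.member a
            ...   | root R la chosen' p | a∈ =
                      contradiction (trans (sym la) (trans (labels-agree a∈ e∈ p) le)) (¬root-and-cyc chosen' chosen)
            ...   | cyc Cy' _ _ i _ | _ = es-both Cy' i
            ...   | inner _ _ _ _ b _ _ | _ = b

          typeII : (∀ l → kindOf (choice l) ≢ uni ψ₄) → TypeII
          typeII ok = record { comps = C ; kind = λ l → kindOf (choice l) ; kindOK = λ l → kind-ok l (choice l) refl ; notΨ₄ = ok }
            where
            kind-ok : ∀ l c → choice l ≡ c → (kindOf c ≡ tree → RootlessTree l)
              × (∀ p → kindOf c ≡ uni p → Unicyclic l × Σ (Cycle l) (λ Cy → Cycle.psi Cy ≡ p))
            kind-ok l (inj₁ R)  chosen = (λ _ → rootlessTree chosen) , λ _ ()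
            kind-ok l (inj₂ Cy) chosen = (λ ()) , λ { p refl → unicyclic chosen , Cy , refl }

      -- The height is the distance to the nearest target. It exists because every component
      -- contains a target, and a vertex of `V₁` that is not a target has a strictly closer
      -- neighbour.
      parents : ∃ λ height → ∀ v → v ∈ V₁ → Heights.Parent height v
      parents = distance (_∈? V₁) reach , parent
        where
        open Distance target? adj?
        reach : ∀ v → v ∈ V₁ → ∃ λ d → Within d v
        reach v v∈ = let u , u∈ , lu , T = some-target (lab (inj₁ v)) in
          walk⇒within (linked⇒walk (linked _ _ v∈ u∈ (sym lu))) (target lu T)

        open Heights (distance (_∈? V₁) reach)

        parent : ∀ v → v ∈ V₁ → Parent v
        parent v v∈ with target? v | closer (_∈? V₁) reach v v∈
        ... | no ¬T | inj₁ T = contradiction T ¬T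
        ... | no ¬T | inj₂ (u , (e , e∈ , b , j) , lt) = inner ¬T e u e∈ b j lt
        ... | yes T | _ = at-target refl T
          where
          at-target : ∀ {c} → choice (lab (inj₁ v)) ≡ c → TargetOf c v → Parent v
          at-target {inj₁ R}  eq p        = root R refl eq p
          at-target {inj₂ Cy} eq (i , p)  = cyc Cy refl eq i p


  joins-one : ∀ {e u v} → Joins G e u v → u ∈ V₁ → v ∉ V₁ → OneEndIn e
  joins-one (inj₁ (refl , refl)) u∈ v∉ = inj₁ (u∈ , v∉)
  joins-one (inj₂ (refl , refl)) u∈ v∉ = inj₂ (v∉ , u∈)

  -- Components read off a matching of vertices with edges

  module Matched (r₀ : Fin k) {θ : Fin k → Fin k} (θ-injective : ∀ r s → θ r ≡ θ s → r ≡ s)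
    (θ-end : ∀ r → EndPt G (ιV (θ r)) (ιE r)) where

    vertex : Fin k → Fin n
    vertex r = ιV (θ r)

    vertex-∈ : ∀ r → vertex r ∈ V₁
    vertex-∈ r = V.member (θ r)

    vertex-injective : ∀ {r s} → vertex r ≡ vertex s → r ≡ s
    vertex-injective eq = θ-injective _ _ (V.injective _ _ eq)

    row-of : ∀ {v} → v ∈ V₁ → ∃ λ r → vertex r ≡ v
    row-of v∈ = let i , eq = V.index v∈ ; r , eq' = injective⇒surjective θ θ-injective i in r , trans (cong ιV eq') eq

    far : Fin k → Fin n
    far r = proj₁ (opposite (θ-end r))

    far-joins : ∀ r → Joins G (ιE r) (vertex r) (far r)
    far-joins r = proj₂ (opposite (θ-end r))

    -- From an edge, go to the end with which it is not matched, then to the edge matched with that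
    -- end; an edge that leaves `V₁` stays put. The classes generated by the pairs `(r , succ r)`
    -- turn out to be the components.
    succ : Fin k → Fin k
    succ r with far r ∈? V₁
    ... | yes far∈ = proj₁ (row-of far∈)
    ... | no _     = r

    succ-far : ∀ r → far r ∈ V₁ → vertex (succ r) ≡ far r
    succ-far r far∈ with far r ∈? V₁
    ... | yes far∈' = proj₂ (row-of far∈')
    ... | no far∉   = contradiction far∈ far∉

    succ-stay : ∀ r → far r ∉ V₁ → succ r ≡ r
    succ-stay r far∉ with far r ∈? V₁
    ... | yes far∈ = contradiction far∈ far∉
    ... | no _     = refl

    open Quotient (quotient (map (λ r → r , succ r) (allFin k)))

    cls-succ : ∀ r → cls (succ r) ≡ cls r
    cls-succ r = sym (sound (List.∈-map⁺ (λ r → r , succ r) (List.∈-allFin r)))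

    rowᵛ : Fin n → Fin k
    rowᵛ v with v ∈? V₁
    ... | yes v∈ = proj₁ (row-of v∈)
    -- Labels are total on `Elem`, so elements outside the substructure need one too; `r₀` is an
    -- arbitrary default.
    ... | no _   = r₀

    rowᵛ-vertex : ∀ {v} → v ∈ V₁ → vertex (rowᵛ v) ≡ v
    rowᵛ-vertex {v} v∈ with v ∈? V₁
    ... | yes v∈' = proj₂ (row-of v∈')
    ... | no v∉   = contradiction v∈ v∉

    rowᵉ : Fin m → Fin k
    rowᵉ e with e ∈? E₁
    ... | yes e∈ = proj₁ (E.index e∈)
    ... | no _   = r₀

    rowᵉ-edge : ∀ {e} → e ∈ E₁ → ιE (rowᵉ e) ≡ e
    rowᵉ-edge {e} e∈ with e ∈? E₁
    ... | yes e∈' = proj₂ (E.index e∈')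
    ... | no e∉   = contradiction e∈ e∉

    rowˣ : Elem → Fin k
    rowˣ (inj₁ v) = rowᵛ v
    rowˣ (inj₂ e) = rowᵉ e

    rowᵉ-ιE : ∀ r → rowᵉ (ιE r) ≡ r
    rowᵉ-ιE r = E.injective _ _ (rowᵉ-edge (E.member r))

    linked-sym : ∀ {x y} → Linked x y → Linked y x
    linked-sym = Star.reverse (Sym.symmetric Inc)

    linked-row : ∀ x → Member x → Linked x (inj₂ (ιE (rowˣ x)))
    linked-row (inj₁ v) v∈ = fwd (v∈ , E.member _ , subst (λ u → EndPt G u (ιE (rowᵛ v))) (rowᵛ-vertex v∈) (θ-end _)) ◅ ε
    linked-row (inj₂ e) e∈ = subst (λ e' → Linked (inj₂ e) (inj₂ e')) (sym (rowᵉ-edge e∈)) ε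

    linked-succ : ∀ r → Linked (inj₂ (ιE r)) (inj₂ (ιE (succ r)))
    linked-succ r = by-cases (far r ∈? V₁)
      where
      by-cases : Dec (far r ∈ V₁) → Linked (inj₂ (ιE r)) (inj₂ (ιE (succ r)))
      by-cases (yes far∈) = bwd {b = inj₁ (far r)} (far∈ , E.member r , joins-endʳ (far-joins r))
        ◅ fwd (far∈ , E.member _ , subst (λ u → EndPt G u (ιE (succ r))) (succ-far r far∈) (θ-end (succ r))) ◅ ε
      by-cases (no far∉) = subst (λ s → Linked (inj₂ (ιE r)) (inj₂ (ιE s))) (sym (succ-stay r far∉)) ε

    linked-rows : ∀ {r s} → cls r ≡ cls s → Linked (inj₂ (ιE r)) (inj₂ (ιE s))
    linked-rows eq = Star.concat (Star.gmap (λ r → inj₂ (ιE r)) step (exact eq))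
      where
      related : ∀ {r s} → (r , s) List.∈ map (λ r → r , succ r) (allFin k) → Linked (inj₂ (ιE r)) (inj₂ (ιE s))
      related p with List.∈-map⁻ (λ r → r , succ r) p
      ... | r , _ , refl = linked-succ r
      step : ∀ {r s} → SymClosure (λ r s → (r , s) List.∈ map (λ r → r , succ r) (allFin k)) r s → Linked (inj₂ (ιE r)) (inj₂ (ιE s))
      step (fwd p) = related p
      step (bwd p) = linked-sym (related p)

    components : Components
    components = record
      { t       = t
      ; lab     = λ x → cls (rowˣ x)
      ; onto    = λ l → inj₂ (ιE (rep l)) , E.member _ , trans (cong cls (rowᵉ-ιE (rep l))) (cls-rep l)
      ; respect = respects
      ; linked  = λ x y mx my eq → linked-row x mx ◅◅ linked-rows eq ◅◅ linked-sym (linked-row y my)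
      }
      where
      -- A vertex on an edge is either matched with it, and then both have the same row, or it is
      -- the far end, and then its row is the successor of the row of the edge.
      respects : ∀ x y → Inc x y → cls (rowˣ x) ≡ cls (rowˣ y)
      respects (inj₁ v) (inj₂ e) (v∈ , e∈ , p)
        with joins-ends (far-joins (rowᵉ e)) (subst (EndPt G v) (sym (rowᵉ-edge e∈)) p)
      ... | inj₁ q = cong cls (vertex-injective (trans (rowᵛ-vertex v∈) q))
      ... | inj₂ refl = trans (cong cls (vertex-injective (trans (rowᵛ-vertex v∈) (sym (succ-far _ v∈))))) (cls-succ _)

    open Labelled components
    open InComponents components

    vertex-label : ∀ r → cls (rowᵛ (vertex r)) ≡ cls r
    vertex-label r = cong cls (vertex-injective (rowᵛ-vertex (vertex-∈ r)))

    edge-label : ∀ r → cls (rowᵉ (ιE r)) ≡ cls r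
    edge-label r = cong cls (rowᵉ-ιE r)

    cls-iter : ∀ j r → cls (iter succ j r) ≡ cls r
    cls-iter zero    r = refl
    cls-iter (suc j) r = trans (cls-succ _) (cls-iter j r)

    -- When no edge of the component leaves `V₁`, consecutive vertices of a `succ`-orbit are joined
    -- by edges, and the orbit becomes periodic. Period one would be a loop and period two a pair of
    -- parallel edges, so simplicity leaves a period of at least three.
    closed-cycle : ∀ l → (∀ r → cls r ≡ l → far r ∈ V₁) → Cycle l
    closed-cycle l closed with eventually-periodic succ (rep l)
    ... | a , L , period , distinct = by-length L period distinct
      where
      y = iter succ a (rep l)
      cls-y : ∀ j → cls (iter succ j y) ≡ l
      cls-y j = trans (cls-iter j y) (trans (cls-iter a (rep l)) (cls-rep l))
      far≡ : ∀ j → far (iter succ j y) ≡ vertex (iter succ (suc j) y)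
      far≡ j = sym (succ-far _ (closed _ (cls-y j)))
      step : ∀ j → Joins G (ιE (iter succ j y)) (vertex (iter succ j y)) (vertex (iter succ (suc j) y))
      step j = subst (Joins G _ _) (far≡ j) (far-joins _)

      by-length : ∀ L → iter succ (suc L) y ≡ y → (∀ i j → i ℕ.≤ L → j ℕ.≤ L → iter succ i y ≡ iter succ j y → i ≡ j) → Cycle l
      by-length zero period distinct = contradiction (cong vertex (sym period)) (joins-distinct (step 0))
      by-length (suc zero) period distinct = contradiction
        (distinct 0 1 z≤n (s≤s z≤n) (E.injective _ _ (joins-unique (step 0) (joins-sym (subst (Joins G _ _) (cong vertex period) (step 1)))))) (λ ())
      by-length (suc (suc len)) period distinct = record
        { len   = len
        ; vs    = λ i → vertex (iter succ (toℕ i) y)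
        ; es    = λ i → ιE (iter succ (toℕ i) y)
        ; vsInj = λ i j eq → toℕ-injective (distinct _ _ (toℕ≤pred[n] i) (toℕ≤pred[n] j) (vertex-injective eq))
        ; vsIn  = λ i → vertex-∈ _ , trans (vertex-label _) (cls-y (toℕ i))
        ; esIn  = λ i → E.member _
        ; esJ   = λ i → subst (Joins G _ _) (cong vertex (wrap i)) (step (toℕ i))
        }
        where
        wrap : ∀ (i : Fin (3 ℕ.+ len)) → iter succ (suc (toℕ i)) y ≡ iter succ (toℕ (next i)) y
        wrap i with view i
        ... | ‵fromℕ rewrite next-fromℕ (2 ℕ.+ len) | toℕ-fromℕ len = period
        ... | ‵inject₁ j rewrite next-inject₁ j | toℕ-inject₁ j = refl

    -- A root edge is searched for first; the failure of the search is exactly the closedness that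
    -- `closed-cycle` requires.
    choice : ∀ l → Root l ⊎ Cycle l
    choice l with any? (λ r → (cls r F.≟ l) ×-dec ¬? (far r ∈? V₁))
    ... | yes (r , cr , far∉) = inj₁ (ιE r , (E.member r , trans (edge-label r) cr) , joins-one (far-joins r) (vertex-∈ r) far∉)
    ... | no none = inj₂ (closed-cycle l closed)
      where
      closed : ∀ r → cls r ≡ l → far r ∈ V₁
      closed r cr with far r ∈? V₁
      ... | yes far∈ = far∈
      ... | no far∉  = contradiction (r , cr , far∉) none

-- The incidence matrix of a substructure

record Conjugation (𝓡 : DiscreteRing) : Set where
  open DiscreteRing 𝓡
  field
    conj   : Carrier → Carrier
    conj-+ : ∀ x y → conj (x + y) ≡ conj x + conj y
    conj-* : ∀ x y → conj (x * y) ≡ conj x * conj y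
    conj-- : ∀ x → conj (- x) ≡ - conj x
    conj-0 : conj 0# ≡ 0#
    conj-1 : conj 1# ≡ 1#

module Norms (𝓡 : DiscreteRing) (κ : Conjugation 𝓡) where
  open DiscreteRing 𝓡 renaming (Carrier to R)
  open Conjugation κ
  open Determinants 𝓡
  open IsCommutativeRing isCommutativeRing
    using (+-assoc; +-comm; +-identityˡ; +-identityʳ; -‿inverseˡ;
           *-assoc; *-comm; *-identityˡ; *-identityʳ; distribˡ; distribʳ; zeroˡ; zeroʳ)
  open Algebra.Properties.Ring (CommutativeRing.ring commutativeRing)
    using (-‿distribˡ-*; -‿distribʳ-*; -‿involutive)

  N : R → R
  N x = x * conj x

  N-* : ∀ x y → N (x * y) ≡ N x * N y
  N-* x y = trans (cong (x * y *_) (conj-* x y)) (*-Props.interchange x y (conj x) (conj y))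

  N-0 : N 0# ≡ 0#
  N-0 = zeroˡ _

  N-1 : N 1# ≡ 1#
  N-1 = trans (*-identityˡ _) conj-1

  N-neg : ∀ x → N (- x) ≡ N x
  N-neg x = trans (cong (- x *_) (conj-- x)) (trans (sym (-‿distribˡ-* x (- conj x)))
    (trans (cong -_ (sym (-‿distribʳ-* x (conj x)))) (-‿involutive _)))

  N-sgn : ∀ j → N (sgn j) ≡ 1#
  N-sgn zero          = N-1
  N-sgn (suc zero)    = trans (N-neg 1#) N-1
  N-sgn (suc (suc j)) = N-sgn j

  conj-sgn : ∀ j → conj (sgn j) ≡ sgn j
  conj-sgn zero          = conj-1
  conj-sgn (suc zero)    = trans (conj-- 1#) (cong -_ conj-1)
  conj-sgn (suc (suc j)) = conj-sgn j

  conj-∑ : ∀ {k} (f : Fin k → R) → conj (∑ f) ≡ ∑ (conj ∘ f)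
  conj-∑ {zero}  f = conj-0
  conj-∑ {suc k} f = trans (conj-+ _ _) (cong (conj (f zero) +_) (conj-∑ (f ∘ suc)))

  conj-determinant : ∀ {k} (M : Mat k k) → conj (determinant M) ≡ determinant (λ i j → conj (M i j))
  conj-determinant {zero}  M = conj-1
  conj-determinant {suc k} M = trans (conj-∑ (λ j → sgn (toℕ j) * M zero j * determinant (minor M j))) (∑-cong (λ j →
    trans (conj-* _ _) (cong₂ _*_ (trans (conj-* _ _) (cong (_* conj (M zero j)) (conj-sgn (toℕ j)))) (conj-determinant (minor M j)))))

  open Norm N N-* N-1 N-sgn N-0 public

  tails : ∀ {k} → (Fin k → R) → Fin k → R
  tails f zero    = ∏ f
  tails f (suc i) = tails (f ∘ suc) i

  tails-fromℕ : ∀ {k} (f : Fin (suc k) → R) → tails f (F.fromℕ k) ≡ f (F.fromℕ k) * 1#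
  tails-fromℕ {zero}  f = refl
  tails-fromℕ {suc k} f = tails-fromℕ (f ∘ suc)

  tails-inject₁ : ∀ {k} (f : Fin (suc k) → R) (j : Fin k) → tails f (inject₁ j) ≡ f (inject₁ j) * tails f (suc j)
  tails-inject₁ f zero    = refl
  tails-inject₁ f (suc j) = tails-inject₁ (f ∘ suc) j

  -- Index zero stands for the position reached after the full turn, whence 1#.
  around : ∀ {k} → (Fin (suc k) → R) → Fin (suc k) → R
  around f zero    = 1#
  around f (suc j) = tails (f ∘ suc) j

  around-next : ∀ {k} (f : Fin (suc k) → R) p → p ≢ zero → around f p ≡ f p * around f (next p)
  around-next f zero p≢0 = contradiction refl p≢0
  around-next {suc k} f (suc j) _ with view j
  ... | ‵fromℕ      rewrite next-fromℕ (suc k)       = tails-fromℕ (f ∘ suc)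
  ... | ‵inject₁ j' rewrite next-inject₁ (suc j') = tails-inject₁ (f ∘ suc) j'

  -- Rows are replaced in index order through the matrices `hybrid t`. When row `r` is due, the
  -- other rows come from either matrix, so `step` has to accept every mixture of the two.
  replace-rows : ∀ {k} {Φ : Mat k k → R} → Alternating Φ → (M M' : Mat k k)
    → (∀ r B B' → (∀ s → B s ≡ M s ⊎ B s ≡ M' s) → B r ≡ M r → B' r ≡ M' r → (∀ s → s ≢ r → B' s ≡ B s) → Φ B' ≡ Φ B)
    → Φ M' ≡ Φ M
  replace-rows {k} {Φ} alt M M' step = trans (respects all-rows) (from k ℕ.≤-refl)
    where
    open Alternating alt
    hybrid : ℕ → Mat k k
    hybrid t s with toℕ s ℕ.<? t
    ... | yes _ = M' s
    ... | no _  = M s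

    below : ∀ t s → toℕ s ℕ.< t → hybrid t s ≡ M' s
    below t s lt with toℕ s ℕ.<? t
    ... | yes _  = refl
    ... | no nlt = contradiction lt nlt

    above : ∀ t s → ¬ toℕ s ℕ.< t → hybrid t s ≡ M s
    above t s nlt with toℕ s ℕ.<? t
    ... | yes lt = contradiction lt nlt
    ... | no _   = refl

    either : ∀ t s → hybrid t s ≡ M s ⊎ hybrid t s ≡ M' s
    either t s with toℕ s ℕ.<? t
    ... | yes _ = inj₂ refl
    ... | no _  = inj₁ refl

    all-rows : M' ≋ hybrid k
    all-rows s j = cong (λ f → f j) (sym (below k s (toℕ<n s)))

    from : ∀ t → t ℕ.≤ k → Φ (hybrid t) ≡ Φ M
    from zero    _   = respects (λ s j → refl)
    from (suc t) t<k = trans (step r (hybrid t) (hybrid (suc t)) (either t)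
      (above t r (ℕ.<-irrefl r≡t)) (below (suc t) r (s≤s (ℕ.≤-reflexive r≡t))) others) (from t (ℕ.<⇒≤ t<k))
      where
      r = fromℕ< t<k
      r≡t : toℕ r ≡ t
      r≡t = toℕ-fromℕ< t<k
      others : ∀ s → s ≢ r → hybrid (suc t) s ≡ hybrid t s
      others s s≢r with toℕ s ℕ.<? t
      ... | yes lt = below (suc t) s (ℕ.m<n⇒m<1+n lt)
      ... | no nlt = above (suc t) s (λ { (s≤s le) → s≢r (toℕ-injective (trans (ℕ.≤-antisym le (ℕ.≮⇒≥ nlt)) (sym r≡t))) })

  module Incidence (ζ : R) (ζ-unit : N ζ ≡ 1#) {n m} (G : MixedGraph n m) (simple : IsSimple G) where
    open Edges G simple

    entry : Fin m → Fin n → R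
    entry e v = if does (src (G e) F.≟ v) then 1#
      else if does (tgt (G e) F.≟ v) then (if directed (G e) then ζ else 1#) else 0#

    entry-unit : ∀ {e v} → EndPt G v e → N (entry e v) ≡ 1#
    entry-unit {e} {v} p with src (G e) F.≟ v
    ... | yes _ = N-1
    ... | no s≢v with tgt (G e) F.≟ v
    ...   | no t≢v = contradiction p λ { (inj₁ q) → s≢v (sym q) ; (inj₂ q) → t≢v (sym q) }
    ...   | yes _ with directed (G e)
    ...     | true  = ζ-unit
    ...     | false = N-1

    entry-end : ∀ {e v} → entry e v ≢ 0# → EndPt G v e
    entry-end {e} {v} nz with src (G e) F.≟ v
    ... | yes p = inj₁ (sym p)
    ... | no _ with tgt (G e) F.≟ v
    ...   | yes q = inj₂ (sym q)
    ...   | no _  = contradiction refl nz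

    entry-zero : ∀ {e v} → ¬ EndPt G v e → entry e v ≡ 0#
    entry-zero {e} {v} ne with entry e v ≟ 0#
    ... | yes z = z
    ... | no nz = contradiction (entry-end nz) ne

    δ : Fin n → Fin n → R
    δ v w = if does (v F.≟ w) then 1# else 0#

    δ-refl : ∀ v → δ v v ≡ 1#
    δ-refl v with v F.≟ v
    ... | yes _ = refl
    ... | no ne = contradiction refl ne

    δ-≢ : ∀ {v w} → v ≢ w → δ v w ≡ 0#
    δ-≢ {v} {w} ne with v F.≟ w
    ... | yes eq = contradiction eq ne
    ... | no _   = refl

    entry-split : ∀ {e u v} → Joins G e u v → ∀ w → entry e w ≡ entry e u * δ w u + entry e v * δ w v
    entry-split {e} {u} {v} j w with w F.≟ u | w F.≟ v
    ... | yes refl | yes w≡v  = contradiction w≡v (joins-distinct j)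
    ... | yes refl | no _     = sym (trans (cong₂ _+_ (*-identityʳ _) (zeroʳ _)) (+-identityʳ _))
    ... | no _     | yes refl = sym (trans (cong₂ _+_ (zeroʳ _) (*-identityʳ _)) (+-identityˡ _))
    ... | no w≢u   | no w≢v   = trans (entry-zero (λ p → case joins-ends j p of λ { (inj₁ q) → w≢u q ; (inj₂ q) → w≢v q }))
                                  (sym (trans (cong₂ _+_ (zeroʳ _) (zeroʳ _)) (+-identityˡ _)))

    module Minor {k} (V₁ : Subset n) (E₁ : Subset m)
      {ιV : Fin k → Fin n} (enumV : Enumerates V₁ ιV) {ιE : Fin k → Fin m} (enumE : Enumerates E₁ ιE) where
      open Structure G simple V₁ E₁ enumV enumE
      open Substructure G V₁ E₁

      M : Mat k k
      M r i = entry (ιE r) (ιV i)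

      module _ (C : Components) where
        open Components C
        open InComponents C
        open Labelled C

        module CycleWeight {l} (Cy : Cycle l) where
          open Cycle Cy using (len; vs; es; esIn; esJ)
          -- As `X i` has norm 1, its inverse is `conj (X i)`. Hence `q i` is the factor picked up
          -- when a multiple of the row of `es i` moves an entry from `vs i` to `vs (next i)`.
          X Y q : Fin (3 ℕ.+ len) → R
          X i = entry (es i) (vs i)
          Y i = entry (es i) (vs (next i))
          q i = - (conj (X i) * Y i)

          X-unit : ∀ i → N (X i) ≡ 1#
          X-unit i = entry-unit (joins-endˡ (esJ i))

          -- The entry at `vs zero` that remains in the row of `es zero` once its second entry has
          -- been carried around the cycle.
          total : R
          total = X zero + Y zero * around q (next zero)

          N-total : N total ≡ N (1# + - ∏ q)
          N-total = begin
            N total                                ≡⟨ cong N factor ⟩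
            N (X zero * (1# + - ∏ q))              ≡⟨ N-* _ _ ⟩
            N (X zero) * N (1# + - ∏ q)            ≡⟨ cong (_* N (1# + - ∏ q)) (X-unit zero) ⟩
            1# * N (1# + - ∏ q)                    ≡⟨ *-identityˡ _ ⟩
            N (1# + - ∏ q)                         ∎
            where
            open ≡-Reasoning
            T = around q (next zero)
            Y≡ : Y zero * T ≡ X zero * - ∏ q
            Y≡ = sym (begin
              X zero * - (- (conj (X zero) * Y zero) * T) ≡⟨ cong (λ x → X zero * - x) (sym (-‿distribˡ-* _ T)) ⟩
              X zero * - - (conj (X zero) * Y zero * T)   ≡⟨ cong (X zero *_) (-‿involutive _) ⟩
              X zero * (conj (X zero) * Y zero * T)       ≡⟨ cong (X zero *_) (*-assoc _ _ _) ⟩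
              X zero * (conj (X zero) * (Y zero * T))     ≡⟨ *-assoc _ _ _ ⟨
              N (X zero) * (Y zero * T)                   ≡⟨ cong (_* (Y zero * T)) (X-unit zero) ⟩
              1# * (Y zero * T)                           ≡⟨ *-identityˡ _ ⟩
              Y zero * T                                  ∎)
            factor : total ≡ X zero * (1# + - ∏ q)
            factor = trans (cong₂ _+_ (sym (*-identityʳ _)) Y≡) (sym (distribˡ _ _ _))

          -- Adding multiples of the rows of es 1, es 2, … to the row r of es 0 moves its
          -- second nonzero entry around the cycle, from vs 1 back to vs 0.
          eliminate : ∀ {r} → ιE r ≡ es zero → ∀ p z {B B' : Mat k k}
            → (∀ j → j ≢ zero → ∀ s → ιE s ≡ es j → ∀ i → B s i ≡ M s i)
            → (∀ i → B r i ≡ X zero * δ (ιV i) (vs zero) + z * δ (ιV i) (vs p))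
            → (∀ i → B' r i ≡ (X zero + z * around q p) * δ (ιV i) (vs zero))
            → (∀ s → s ≢ r → ∀ i → B' s i ≡ B s i)
            → determinant B' ≡ determinant B
          eliminate {r} r≡ = next-downward _ base step
            where
            base : ∀ z {B B' : Mat k k}
              → (∀ j → j ≢ zero → ∀ s → ιE s ≡ es j → ∀ i → B s i ≡ M s i)
              → (∀ i → B r i ≡ X zero * δ (ιV i) (vs zero) + z * δ (ιV i) (vs zero))
              → (∀ i → B' r i ≡ (X zero + z * 1#) * δ (ιV i) (vs zero))
              → (∀ s → s ≢ r → ∀ i → B' s i ≡ B s i)
              → determinant B' ≡ determinant B
            base z {B} {B'} _ Br B'r others = det-cong same
              where
              same : B' ≋ B
              same s i with s F.≟ r
              ... | yes refl = trans (B'r i) (trans (cong (λ x → (X zero + x) * _) (*-identityʳ z)) (trans (distribʳ _ _ _) (sym (Br i))))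
              ... | no s≢r   = others s s≢r i

            step : ∀ p → p ≢ zero
              → (∀ z {B B' : Mat k k}
                → (∀ j → j ≢ zero → ∀ s → ιE s ≡ es j → ∀ i → B s i ≡ M s i)
                → (∀ i → B r i ≡ X zero * δ (ιV i) (vs zero) + z * δ (ιV i) (vs (next p)))
                → (∀ i → B' r i ≡ (X zero + z * around q (next p)) * δ (ιV i) (vs zero))
                → (∀ s → s ≢ r → ∀ i → B' s i ≡ B s i)
                → determinant B' ≡ determinant B)
              → ∀ z {B B' : Mat k k}
                → (∀ j → j ≢ zero → ∀ s → ιE s ≡ es j → ∀ i → B s i ≡ M s i)
                → (∀ i → B r i ≡ X zero * δ (ιV i) (vs zero) + z * δ (ιV i) (vs p))
                → (∀ i → B' r i ≡ (X zero + z * around q p) * δ (ιV i) (vs zero))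
                → (∀ s → s ≢ r → ∀ i → B' s i ≡ B s i)
                → determinant B' ≡ determinant B
            step p p≢0 IH z {B} {B'} rows Br B'r others = trans
              (IH (z * q p) {B''} {B'}
                (λ j j≢0 s s≡ i → trans (cong (λ f → f i) (B''-other (other-row j≢0 s≡))) (rows j j≢0 s s≡ i))
                (λ i → cong (λ f → f i) B''-r)
                (λ i → trans (B'r i) (cong (λ x → (X zero + x) * δ (ιV i) (vs zero)) (trans (cong (z *_) (around-next q p p≢0)) (sym (*-assoc _ _ _)))))
                (λ s s≢r i → trans (others s s≢r i) (cong (λ f → f i) (sym (B''-other s≢r)))))
              (Alternating.add-row det-alternating r sₚ c (other-row p≢0 sₚ≡ ∘ sym)
                (λ i → trans (cong (λ f → f i) B''-r) (row-op i))
                (λ s s≢r i → cong (λ f → f i) (B''-other s≢r)))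
              where
              sₚ : Fin k
              sₚ = proj₁ (E.index (esIn p))
              sₚ≡ : ιE sₚ ≡ es p
              sₚ≡ = proj₂ (E.index (esIn p))
              other-row : ∀ {j s} → j ≢ zero → ιE s ≡ es j → s ≢ r
              other-row j≢0 s≡ refl = j≢0 (es-injective Cy _ _ (trans (sym s≡) r≡))
              c : R
              -- Chosen so that `c * X p` is `- z`, which clears the entry at `vs p`; then `c * Y p`
              -- equals `z * q p`, the new entry at `vs (next p)`.
              c = - (z * conj (X p))
              v : Fin k → R
              v i = X zero * δ (ιV i) (vs zero) + z * q p * δ (ιV i) (vs (next p))
              B'' : Mat k k
              B'' = set₂ r r v v B
              B''-r : B'' r ≡ v
              B''-r = set₂-p r r
              B''-other : ∀ {s} → s ≢ r → B'' s ≡ B s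
              B''-other s≢r = set₂-other r r s≢r s≢r
              row-op : ∀ i → v i ≡ c * B sₚ i + B r i
              row-op i = sym (begin
                c * B sₚ i + B r i
                  ≡⟨ cong₂ (λ x y → c * x + y) (trans (rows p p≢0 sₚ sₚ≡ i) (trans (cong (λ e → entry e (ιV i)) sₚ≡) (entry-split (esJ p) (ιV i)))) (Br i) ⟩
                c * (X p * d + Y p * d') + (a + z * d)
                  ≡⟨ cong (_+ (a + z * d)) (trans (distribˡ c _ _) (cong₂ _+_ (sym (*-assoc c _ _)) (sym (*-assoc c _ _)))) ⟩
                c * X p * d + c * Y p * d' + (a + z * d)
                  ≡⟨ cong₂ (λ x y → x * d + y * d' + (a + z * d)) cX cY ⟩
                - z * d + z * q p * d' + (a + z * d)
                  ≡⟨ cong (λ x → x + z * q p * d' + (a + z * d)) (sym (-‿distribˡ-* z d)) ⟩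
                - (z * d) + z * q p * d' + (a + z * d)
                  ≡⟨ cong₂ _+_ (+-comm _ _) (+-comm _ _) ⟩
                z * q p * d' + - (z * d) + (z * d + a)
                  ≡⟨ +-assoc _ _ _ ⟩
                z * q p * d' + (- (z * d) + (z * d + a))
                  ≡⟨ cong (z * q p * d' +_) (trans (sym (+-assoc _ _ _)) (trans (cong (_+ a) (-‿inverseˡ _)) (+-identityˡ a))) ⟩
                z * q p * d' + a
                  ≡⟨ +-comm _ _ ⟩
                a + z * q p * d' ∎)
                where
                open ≡-Reasoning
                a d d' : R
                a  = X zero * δ (ιV i) (vs zero)
                d  = δ (ιV i) (vs p)
                d' = δ (ιV i) (vs (next p))
                cX : c * X p ≡ - z
                cX = trans (sym (-‿distribˡ-* _ _)) (cong -_ (trans (*-assoc _ _ _) (trans (cong (z *_) (trans (*-comm _ _) (X-unit p))) (*-identityʳ z))))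
                cY : c * Y p ≡ z * q p
                cY = trans (sym (-‿distribˡ-* _ _)) (trans (cong -_ (*-assoc _ _ _)) (-‿distribʳ-* _ _))

        weight : ∀ {l} → Root l ⊎ Cycle l → R
        weight (inj₁ _)  = 1#
        weight (inj₂ Cy) = N (1# + - ∏ (CycleWeight.q Cy))

        module _ (choice : ∀ l → Root l ⊎ Cycle l) where
          open Chosen choice

          -- The reduced matrix and its only possible transversal

          module ForestNorm (height : Fin n → ℕ) (par : ∀ i → Heights.Parent height (ιV i)) where
            open Heights height
            open Forest par

            record Head (r : Fin k) : Set where
              field
                {l}    : Fin t
                {Cy}   : Cycle l
                chosen : choice l ≡ inj₂ Cy
                first  : Cycle.es Cy zero ≡ ιE r

            head? : ∀ r → Dec (Head r)
            head? r = by-choice (choice (lab (inj₂ (ιE r)))) refl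
              where
              by-choice : ∀ c → choice (lab (inj₂ (ιE r))) ≡ c → Dec (Head r)
              by-choice (inj₁ _) eq = no λ { record { Cy = Cy ; chosen = chosen ; first = first } →
                ¬root-and-cyc eq chosen (trans (cong (lab ∘ inj₂) (sym first)) (es-label Cy zero)) }
              by-choice (inj₂ Cy) eq with Cycle.es Cy zero F.≟ ιE r
              ... | yes p = yes record { chosen = eq ; first = p }
              ... | no ¬p = no (¬p ∘ firsts)
                where
                firsts : Head r → Cycle.es Cy zero ≡ ιE r
                firsts record { Cy = Cy' ; chosen = chosen ; first = first }
                  with trans (sym (es-label Cy' zero)) (cong (lab ∘ inj₂) first)
                ... | refl with inj₂-injective (trans (sym chosen) eq)
                ... | refl = first

            head-unique : ∀ {r l} {Cy : Cycle l} → choice l ≡ inj₂ Cy → (H : Head r) → ∀ j → Cycle.es Cy j ≡ ιE r → j ≡ zero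
            head-unique {Cy = Cy} chosen record { Cy = Cy' ; chosen = chosen' ; first = first } j eq
              with trans (sym (es-label Cy' zero)) (trans (cong (lab ∘ inj₂) (trans first (sym eq))) (es-label Cy j))
            ... | refl with inj₂-injective (trans (sym chosen) chosen')
            ... | refl = es-injective Cy _ _ (trans eq (sym first))

            -- The outcome of all eliminations, written down directly: one row per chosen cycle,
            -- that of its edge `es zero`, is reduced to a single entry.
            M′ : Mat k k
            M′ r i with head? r
            ... | yes record { Cy = Cy } = CycleWeight.total Cy * δ (ιV i) (Cycle.vs Cy zero)
            ... | no _                   = M r i

            M′-head : ∀ {r l} {Cy : Cycle l} → choice l ≡ inj₂ Cy → Cycle.es Cy zero ≡ ιE r
              → ∀ i → M′ r i ≡ CycleWeight.total Cy * δ (ιV i) (Cycle.vs Cy zero)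
            M′-head {r} {Cy = Cy} chosen first i with head? r
            ... | no ¬H = contradiction (record { chosen = chosen ; first = first }) ¬H
            ... | yes record { Cy = Cy' ; chosen = chosen' ; first = first' }
              with trans (sym (es-label Cy' zero)) (trans (cong (lab ∘ inj₂) (trans first' (sym first))) (es-label Cy zero))
            ... | refl with inj₂-injective (trans (sym chosen) chosen')
            ... | refl = refl

            M′-other : ∀ {r} → ¬ Head r → ∀ i → M′ r i ≡ M r i
            M′-other {r} ¬H i with head? r
            ... | yes H = contradiction H ¬H
            ... | no _  = refl

            det-M′ : determinant M′ ≡ determinant M
            det-M′ = replace-rows det-alternating M M′ replace
              where
              replace : ∀ r B B' → (∀ s → B s ≡ M s ⊎ B s ≡ M′ s) → B r ≡ M r → B' r ≡ M′ r
                → (∀ s → s ≢ r → B' s ≡ B s) → determinant B' ≡ determinant B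
              replace r B B' mixed Br B'r others = by-head (head? r)
                where
                by-head : Dec (Head r) → determinant B' ≡ determinant B
                by-head (no ¬H) = det-cong same
                  where
                  same : B' ≋ B
                  same s i with s F.≟ r
                  ... | yes refl = trans (cong (λ f → f i) B'r) (trans (M′-other ¬H i) (cong (λ f → f i) (sym Br)))
                  ... | no s≢r   = cong (λ f → f i) (others s s≢r)
                by-head (yes record { Cy = Cy ; chosen = chosen ; first = first }) =
                  eliminate (sym first) (next zero) (Y zero) rows
                    (λ i → trans (cong (λ f → f i) Br) (trans (cong (λ e → entry e (ιV i)) (sym first)) (entry-split (Cycle.esJ Cy zero) (ιV i))))
                    (λ i → trans (cong (λ f → f i) B'r) (M′-head chosen first i))
                    (λ s s≢r i → cong (λ f → f i) (others s s≢r))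
                  where
                  open CycleWeight Cy
                  -- The rows that the elimination adds are not heads, so they agree with `M`
                  -- whichever matrix of the mixture they come from.
                  rows : ∀ j → j ≢ zero → ∀ s → ιE s ≡ Cycle.es Cy j → ∀ i → B s i ≡ M s i
                  rows j j≢0 s s≡ i with mixed s
                  ... | inj₁ p = cong (λ f → f i) p
                  ... | inj₂ p = trans (cong (λ f → f i) p) (M′-other (λ H → j≢0 (head-unique chosen H j (sym s≡))) i)

            M′-nonhead-end : ∀ {r i} → ¬ Head r → M′ r i ≢ 0# → EndPt G (ιV i) (ιE r)
            M′-nonhead-end {i = i} ¬H nz = entry-end (λ z → nz (trans (M′-other ¬H i) z))

            module _ (T : Transversal M′) where
              open Transversal T

              Fixed : Fin n → Set
              Fixed v = ∀ r → ιV (owner r) ≡ v → ιV (col r) ≡ v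

              -- The row that `u` owns already occupies column `u`, and the columns of a transversal
              -- are distinct, so row `r` is left with `v`.
              fixed-step : ∀ r {v u} → ιV (owner r) ≡ v → u ∈ V₁ → u ≢ v → Fixed u
                → ιV (col r) ≡ v ⊎ ιV (col r) ≡ u → ιV (col r) ≡ v
              fixed-step r ov u∈ u≢v fu (inj₁ eq) = eq
              fixed-step r ov u∈ u≢v fu (inj₂ eq) =
                let a , a≡u = V.index u∈
                    ou = trans (cong ιV (owner-row a)) a≡u
                    same = col-inj (row a) r (V.injective _ _ (trans (fu (row a) ou) (sym eq)))
                in contradiction (trans (sym ou) (trans (cong (ιV ∘ owner) same) ov)) u≢v

              -- The reduced row of `es zero` has a nonzero entry at most at `vs zero`, which starts
              -- the induction. The row of `es i` offers `vs i` and `vs (next i)`, so the successor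
              -- has to be settled first and the induction runs backwards.
              fixed-cycle : ∀ {l} {Cy : Cycle l} → choice l ≡ inj₂ Cy → ∀ i → Fixed (Cycle.vs Cy i)
              fixed-cycle {Cy = Cy} chosen = next-downward _ base step
                where
                open Cycle Cy using (vs; es; vsInj; vsIn; esJ)
                first : ∀ i r → ιV (owner r) ≡ vs i → es i ≡ ιE r
                first i r o = trans (sym (edge-at-cycle Cy chosen i (sym o) (par (owner r)))) (sym (owner-edge r))
                base : Fixed (vs zero)
                base r o with ιV (col r) F.≟ vs zero
                ... | yes eq = eq
                ... | no ne = contradiction (trans (M′-head chosen (first zero r o) (col r)) (trans (cong (_ *_) (δ-≢ ne)) (zeroʳ _))) (nonzero r)
                step : ∀ i → i ≢ zero → Fixed (vs (next i)) → Fixed (vs i)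
                step i i≢0 fixed r o = fixed-step r o (proj₁ (vsIn (next i))) (joins-distinct (esJ i) ∘ sym) fixed
                  (joins-ends (esJ i) (subst (EndPt G (ιV (col r))) (sym (first i r o))
                    (M′-nonhead-end (λ H → i≢0 (head-unique chosen H i (first i r o))) (nonzero r))))

              -- A root edge offers one column only, cycle vertices are done, and the other end of
              -- an inner parent edge is lower, hence settled by induction on the height.
              fixed : ∀ v → Acc ℕ._<_ (height v) → Fixed v
              fixed v (acc rs) r refl = by-parent (par (owner r)) (owner-edge r)
                where
                by-parent : (P : Parent (ιV (owner r))) → ιE r ≡ edge P → ιV (col r) ≡ ιV (owner r)
                by-parent (root {l} (e , (e∈ , le) , one) la chosen p) eq =
                  one-end-unique one (V.member _) (V.member _) (subst (EndPt G _) eq (M′-nonhead-end ¬H (nonzero r))) p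
                  where
                  ¬H : ¬ Head r
                  ¬H record { Cy = Cy ; first = first } = ¬one-and-both one (subst BothEndsIn (trans first eq) (es-both Cy zero))
                by-parent (cyc Cy la chosen i vi) eq = trans (fixed-cycle chosen i r (sym vi)) vi
                by-parent (inner ¬T e u e∈ b j lt) eq =
                  fixed-step r refl (proj₂ (both-joins b j)) (joins-distinct j ∘ sym) (fixed u (rs lt))
                    (joins-ends j (subst (EndPt G _) eq (M′-nonhead-end ¬H (nonzero r))))
                  where
                  ¬H : ¬ Head r
                  ¬H record { Cy = Cy ; chosen = chosen ; first = first } = ¬T (cycle-ends-target Cy chosen zero (V.member _)
                    (subst (EndPt G _) (trans (sym eq) (sym first)) (joins-endˡ j)))

            N-det-M′ : N (determinant M′) ≡ ∏ (λ r → N (M′ r (owner r)))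
            N-det-M′ = unique-transversal M′ owner owner-injective
              (λ T r → V.injective _ _ (fixed T _ (<-wellFounded _) r refl))

            rep-of : ∀ {l} → Root l ⊎ Cycle l → Fin k
            rep-of (inj₁ (e , (e∈ , _) , _)) = proj₁ (E.index e∈)
            rep-of (inj₂ Cy)                 = proj₁ (E.index (Cycle.esIn Cy zero))

            rep-label : ∀ {l} (c : Root l ⊎ Cycle l) → lab (inj₂ (ιE (rep-of c))) ≡ l
            rep-label (inj₁ (e , (e∈ , le) , _)) = trans (cong (lab ∘ inj₂) (proj₂ (E.index e∈))) le
            rep-label (inj₂ Cy)                  = trans (cong (lab ∘ inj₂) (proj₂ (E.index (Cycle.esIn Cy zero)))) (es-label Cy zero)

            -- A table of rows against components that holds each weight once, at a representative
            -- row, and 1 elsewhere. Multiplied along rows it gives the norms of the entries of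
            -- `M′`, along components the weights; `∏-swap` equates the two products.
            factor : Fin k → Fin t → R
            factor r l = if does (rep-of (choice l) F.≟ r) then weight (choice l) else 1#

            factor-rep : ∀ l → factor (rep-of (choice l)) l ≡ weight (choice l)
            factor-rep l with rep-of (choice l) F.≟ rep-of (choice l)
            ... | yes _ = refl
            ... | no ne = contradiction refl ne

            factor-other : ∀ r l → rep-of (choice l) ≢ r → factor r l ≡ 1#
            factor-other r l ne with rep-of (choice l) F.≟ r
            ... | yes eq = contradiction eq ne
            ... | no _   = refl

            M-owner : ∀ r → N (M r (owner r)) ≡ 1#
            M-owner r = entry-unit (owner-end r)

            diagonal : ∀ r → N (M′ r (owner r)) ≡ factor r (lab (inj₂ (ιE r)))
            diagonal r = by-choice (lab (inj₂ (ιE r))) (choice (lab (inj₂ (ιE r)))) refl refl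
              where
              by-choice : ∀ l c → lab (inj₂ (ιE r)) ≡ l → choice l ≡ c → N (M′ r (owner r)) ≡ factor r l
              by-choice l c ll chosen with rep-of (choice l) F.≟ r
              by-choice l (inj₁ R) ll chosen | d = trans (cong N (M′-other ¬H (owner r))) (trans (M-owner r) (sym (trivial d)))
                where
                ¬H : ¬ Head r
                ¬H record { Cy = Cy ; chosen = chosen' ; first = first } =
                  ¬root-and-cyc chosen chosen' (trans (sym ll) (trans (cong (lab ∘ inj₂) (sym first)) (es-label Cy zero)))
                trivial : ∀ (d : Dec (rep-of (choice l) ≡ r)) → (if does d then weight (choice l) else 1#) ≡ 1#
                trivial (yes _) = cong weight chosen
                trivial (no _)  = refl
              by-choice l (inj₂ Cy) ll chosen | yes eq = trans (cong N entry≡) (trans (CycleWeight.N-total Cy) (cong weight (sym chosen)))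
                where
                first : Cycle.es Cy zero ≡ ιE r
                first = trans (sym (proj₂ (E.index (Cycle.esIn Cy zero)))) (cong ιE (trans (cong rep-of (sym chosen)) eq))
                o≡ : ιV (owner r) ≡ Cycle.vs Cy zero
                o≡ = let a , a≡ = V.index (proj₁ (Cycle.vsIn Cy zero)) in trans
                  (edge-injective (V.member _) (V.member a) (par (owner r)) (par a)
                    (trans (sym (owner-edge r)) (trans (sym first) (sym (edge-at-cycle Cy chosen zero (sym a≡) (par a)))))) a≡
                entry≡ : M′ r (owner r) ≡ CycleWeight.total Cy
                entry≡ = trans (M′-head chosen first (owner r))
                  (trans (cong (λ x → CycleWeight.total Cy * x) (trans (cong (λ v → δ v (Cycle.vs Cy zero)) o≡) (δ-refl (Cycle.vs Cy zero)))) (*-identityʳ _))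
              by-choice l (inj₂ Cy) ll chosen | no ne = trans (cong N (M′-other ¬H (owner r))) (M-owner r)
                where
                ¬H : ¬ Head r
                ¬H record { Cy = Cy' ; chosen = chosen' ; first = first'} with trans (sym (es-label Cy' zero)) (trans (cong (lab ∘ inj₂) first') ll)
                ... | refl with inj₂-injective (trans (sym chosen) chosen')
                ... | refl = ne (E.injective _ _ (trans (cong (ιE ∘ rep-of) chosen) (trans (proj₂ (E.index (Cycle.esIn Cy zero))) first')))

            norm-determinant : N (determinant M) ≡ ∏ (λ l → weight (choice l))
            norm-determinant = begin
              N (determinant M)                    ≡⟨ cong N det-M′ ⟨
              N (determinant M′)                   ≡⟨ N-det-M′ ⟩
              ∏ (λ r → N (M′ r (owner r)))         ≡⟨ ∏-cong (λ r → trans (diagonal r) (sym (∏-single (factor r) (lab (inj₂ (ιE r)))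
                                                        (λ l l≢ → factor-other r l (λ eq → l≢
                                                          (trans (sym (rep-label (choice l))) (cong (lab ∘ inj₂ ∘ ιE) eq))))))) ⟩
              ∏ (λ r → ∏ (factor r))               ≡⟨ ∏-swap factor ⟩
              ∏ (λ l → ∏ (λ r → factor r l))       ≡⟨ ∏-cong (λ l → trans (∏-single (λ r → factor r l) (rep-of (choice l))
                                                        (λ r r≢ → factor-other r l (r≢ ∘ sym))) (factor-rep l)) ⟩
              ∏ (λ l → weight (choice l))          ∎
              where open ≡-Reasoning

-- Eisenstein integers

open import Data.Integer as ℤ using (+_; -[1+_]; _%ℕ_; _/ℕ_)
import Data.Integer.DivMod as ℤ
import Data.Integer.Properties as ℤ
open import Data.Integer.Tactic.RingSolver using (solve-∀)

_≟ω_ : DecidableEquality ℤω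
(a + b ω) ≟ω (c + d ω) with a ℤ.≟ c | b ℤ.≟ d
... | yes refl | yes refl = yes refl
... | no a≢c   | _        = no (a≢c ∘ cong re)
... | _        | no b≢d   = no (b≢d ∘ cong im)

⊕-⊗-isCommutativeRing : IsCommutativeRing _≡_ _⊕_ _⊗_ ⊖_ 𝟘 𝟙
⊕-⊗-isCommutativeRing = record
  { isRing = record
    { +-isAbelianGroup = record
      { isGroup = record
        { isMonoid = record
          { isSemigroup = record
            { isMagma = record { isEquivalence = isEquivalence ; ∙-cong = cong₂ _⊕_ }
            ; assoc = λ (a + b ω) (c + d ω) (e + f ω) → cong₂ _+_ω (ℤ.+-assoc a c e) (ℤ.+-assoc b d f)
            }
          ; identity = (λ (a + b ω) → cong₂ _+_ω (ℤ.+-identityˡ a) (ℤ.+-identityˡ b))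
                     , (λ (a + b ω) → cong₂ _+_ω (ℤ.+-identityʳ a) (ℤ.+-identityʳ b))
          }
        ; inverse = (λ (a + b ω) → cong₂ _+_ω (ℤ.+-inverseˡ a) (ℤ.+-inverseˡ b))
                  , (λ (a + b ω) → cong₂ _+_ω (ℤ.+-inverseʳ a) (ℤ.+-inverseʳ b))
        ; ⁻¹-cong = cong ⊖_
        }
      ; comm = λ (a + b ω) (c + d ω) → cong₂ _+_ω (ℤ.+-comm a c) (ℤ.+-comm b d)
      }
    ; *-cong = cong₂ _⊗_
    ; *-assoc = λ (a + b ω) (c + d ω) (e + f ω) → cong₂ _+_ω (assoc-re a b c d e f) (assoc-im a b c d e f)
    ; *-identity = (λ (a + b ω) → cong₂ _+_ω (idˡ-re a b) (idˡ-im a b))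
                 , (λ (a + b ω) → cong₂ _+_ω (idʳ-re a b) (idʳ-im a b))
    ; distrib = (λ (a + b ω) (c + d ω) (e + f ω) → cong₂ _+_ω (dˡ-re a b c d e f) (dˡ-im a b c d e f))
              , (λ (a + b ω) (c + d ω) (e + f ω) → cong₂ _+_ω (dʳ-re a b c d e f) (dʳ-im a b c d e f))
    }
  ; *-comm = λ (a + b ω) (c + d ω) → cong₂ _+_ω (comm-re a b c d) (comm-im a b c d)
  }
  where
  open import Data.Integer using (_+_; _*_; _-_)
  assoc-re : ∀ a b c d e f → (a * c - b * d) * e - (a * d + b * c + b * d) * f
                           ≡ a * (c * e - d * f) - b * (c * f + d * e + d * f)
  assoc-re = solve-∀
  assoc-im : ∀ a b c d e f → (a * c - b * d) * f + (a * d + b * c + b * d) * e + (a * d + b * c + b * d) * f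
                           ≡ a * (c * f + d * e + d * f) + b * (c * e - d * f) + b * (c * f + d * e + d * f)
  assoc-im = solve-∀
  idˡ-re : ∀ a b → + 1 * a - + 0 * b ≡ a
  idˡ-re = solve-∀
  idˡ-im : ∀ a b → + 1 * b + + 0 * a + + 0 * b ≡ b
  idˡ-im = solve-∀
  idʳ-re : ∀ a b → a * + 1 - b * + 0 ≡ a
  idʳ-re = solve-∀
  idʳ-im : ∀ a b → a * + 0 + b * + 1 + b * + 0 ≡ b
  idʳ-im = solve-∀
  dˡ-re : ∀ a b c d e f → a * (c + e) - b * (d + f) ≡ (a * c - b * d) + (a * e - b * f)
  dˡ-re = solve-∀
  dˡ-im : ∀ a b c d e f → a * (d + f) + b * (c + e) + b * (d + f) ≡ (a * d + b * c + b * d) + (a * f + b * e + b * f)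
  dˡ-im = solve-∀
  dʳ-re : ∀ a b c d e f → (c + e) * a - (d + f) * b ≡ (c * a - d * b) + (e * a - f * b)
  dʳ-re = solve-∀
  dʳ-im : ∀ a b c d e f → (c + e) * b + (d + f) * a + (d + f) * b ≡ (c * b + d * a + d * b) + (e * b + f * a + f * b)
  dʳ-im = solve-∀
  comm-re : ∀ a b c d → a * c - b * d ≡ c * a - d * b
  comm-re = solve-∀
  comm-im : ∀ a b c d → a * d + b * c + b * d ≡ c * b + d * a + d * b
  comm-im = solve-∀

eisenstein : DiscreteRing
eisenstein = record { isCommutativeRing = ⊕-⊗-isCommutativeRing ; _≟_ = _≟ω_ }

-- ω̄ = 1 − ω
conj : ℤω → ℤω
conj (a + b ω) = (a ℤ.+ b) + (ℤ.- b) ω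

conj-⊕ : ∀ x y → conj (x ⊕ y) ≡ conj x ⊕ conj y
conj-⊕ (a + b ω) (c + d ω) = cong₂ _+_ω (re-eq a b c d) (im-eq b d)
  where
  open import Data.Integer using (_+_; _*_; _-_; -_)
  re-eq : ∀ a b c d → (a + c) + (b + d) ≡ (a + b) + (c + d)
  re-eq = solve-∀
  im-eq : ∀ b d → - (b + d) ≡ (- b) + (- d)
  im-eq = solve-∀

conj-⊗ : ∀ x y → conj (x ⊗ y) ≡ conj x ⊗ conj y
conj-⊗ (a + b ω) (c + d ω) = cong₂ _+_ω (re-eq a b c d) (im-eq a b c d)
  where
  open import Data.Integer using (_+_; _*_; _-_; -_)
  re-eq : ∀ a b c d → (a * c - b * d) + (a * d + b * c + b * d) ≡ (a + b) * (c + d) - (- b) * (- d)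
  re-eq = solve-∀
  im-eq : ∀ a b c d → - (a * d + b * c + b * d) ≡ (a + b) * (- d) + (- b) * (c + d) + (- b) * (- d)
  im-eq = solve-∀

fromℕ-* : ∀ a b → fromℕ (a ℕ.* b) ≡ fromℕ a ⊗ fromℕ b
fromℕ-* a b = cong₂ _+_ω (trans (ℤ.pos-* a b) (re-eq (+ a) (+ b))) (im-eq (+ a) (+ b))
  where
  open import Data.Integer using (_+_; _*_; _-_; -_)
  re-eq : ∀ a b → a * b ≡ a * b - + 0 * + 0
  re-eq = solve-∀
  im-eq : ∀ a b → + 0 ≡ a * + 0 + + 0 * b + + 0 * + 0
  im-eq = solve-∀

-- Comparison with the determinant and the subset sum of the statement

open Determinants eisenstein

sumFin≡∑ : ∀ {k} (f : Fin k → ℤω) → sumFin f ≡ ∑ f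
sumFin≡∑ {zero}  f = refl
sumFin≡∑ {suc k} f = cong (f zero ⊕_) (sumFin≡∑ (f ∘ suc))

signω≡sgn : ∀ j → signω j ≡ sgn j
signω≡sgn zero          = refl
signω≡sgn (suc zero)    = refl
signω≡sgn (suc (suc j)) = signω≡sgn j

det≡determinant : ∀ {k} (M : Matrix k) → det M ≡ determinant M
det≡determinant {zero}  M = refl
det≡determinant {suc k} M = trans (sumFin≡∑ (λ j → signω (toℕ j) ⊗ M zero j ⊗ det (minor M j)))
  (∑-cong (λ j → cong₂ (λ s d → s ⊗ M zero j ⊗ d) (signω≡sgn (toℕ j)) (det≡determinant (minor M j))))

sum-filter-map : ∀ {m} (b : Bool) k (ps : List (Subset m)) (w : Subset (suc m) → ℕ)
  → sum (map w (filter (λ p → ∣ p ∣ ℕ.≟ k) (map (b ∷_) ps)))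
  ≡ sum (map (w ∘ (b ∷_)) (filter (λ p → ∣ b ∷ p ∣ ℕ.≟ k) ps))
sum-filter-map b k []       w = refl
sum-filter-map b k (p ∷ ps) w with does (∣ b ∷ p ∣ ℕ.≟ k)
... | true  = cong (w (b ∷ p) ℕ.+_) (sum-filter-map b k ps w)
... | false = sum-filter-map b k ps w

sumSubsetsOfSize≡∑⊆ : ∀ m k (w : Subset m → ℕ) → fromℕ (sumSubsetsOfSize k w) ≡ ∑⊆ m k (λ p _ → fromℕ (w p))
sumSubsetsOfSize≡∑⊆ zero zero    w = cong fromℕ (ℕ.+-identityʳ _)
sumSubsetsOfSize≡∑⊆ zero (suc k) w = refl
sumSubsetsOfSize≡∑⊆ (suc m) k w = trans (cong fromℕ (split k)) (by-size k)
  where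
  part : Bool → ℕ → ℕ
  part b k = sum (map (w ∘ (b ∷_)) (filter (λ p → ∣ b ∷ p ∣ ℕ.≟ k) (allSubsets m)))

  split : ∀ k → sumSubsetsOfSize k w ≡ part true k ℕ.+ part false k
  split k = begin
    sum (map w (filter P? (map (true ∷_) ps ++ map (false ∷_) ps)))
      ≡⟨ cong (sum ∘ map w) (filter-++ P? (map (true ∷_) ps) _) ⟩
    sum (map w (filter P? (map (true ∷_) ps) ++ filter P? (map (false ∷_) ps)))
      ≡⟨ cong sum (map-++ w (filter P? (map (true ∷_) ps)) _) ⟩
    sum (map w (filter P? (map (true ∷_) ps)) ++ map w (filter P? (map (false ∷_) ps)))
      ≡⟨ sum-++ (map w (filter P? (map (true ∷_) ps))) _ ⟩
    sum (map w (filter P? (map (true ∷_) ps))) ℕ.+ sum (map w (filter P? (map (false ∷_) ps)))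
      ≡⟨ cong₂ ℕ._+_ (sum-filter-map true k ps w) (sum-filter-map false k ps w) ⟩
    part true k ℕ.+ part false k ∎
    where
    open ≡-Reasoning
    ps = allSubsets m
    P? = λ (p : Subset (suc m)) → ∣ p ∣ ℕ.≟ k

  by-size : ∀ k → fromℕ (part true k ℕ.+ part false k) ≡ ∑⊆ (suc m) k (λ p _ → fromℕ (w p))
  -- A subset that contains the first edge is not empty, so the first part contributes nothing.
  by-size zero = trans
    (cong (λ l → fromℕ (sum (map (w ∘ (true ∷_)) l) ℕ.+ part false 0))
      (filter-none {P = λ (p : Subset m) → suc ∣ p ∣ ≡ 0} (λ p → suc ∣ p ∣ ℕ.≟ 0) {allSubsets m} (All.universal (λ _ ()) _)))
    (sumSubsetsOfSize≡∑⊆ m 0 (w ∘ (false ∷_)))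
  by-size (suc k) = cong₂ _⊕_
    (trans (cong (λ l → fromℕ (sum (map (w ∘ (true ∷_)) l)))
       (filter-≐ (λ p → ∣ true ∷ p ∣ ℕ.≟ suc k) (λ p → ∣ p ∣ ℕ.≟ k) (ℕ.suc-injective , cong suc) (allSubsets m)))
       (sumSubsetsOfSize≡∑⊆ m k (w ∘ (true ∷_))))
    (sumSubsetsOfSize≡∑⊆ m (suc k) (w ∘ (false ∷_)))

open IsCommutativeRing ⊕-⊗-isCommutativeRing using (*-assoc; *-identityˡ; *-identityʳ)

conjugation : Conjugation eisenstein
conjugation = record
  { conj = conj ; conj-+ = conj-⊕ ; conj-* = conj-⊗
  ; conj-- = λ (a + b ω) → cong₂ _+_ω (sym (ℤ.neg-distrib-+ a b)) refl
  ; conj-0 = refl ; conj-1 = refl }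

open Norms eisenstein conjugation

-- Powers of roots of unity and the weights of cycles

pow : ℤω → ℕ → ℤω
pow x zero    = 𝟙
pow x (suc j) = x ⊗ pow x j

pow-+ : ∀ x i j → pow x (i ℕ.+ j) ≡ pow x i ⊗ pow x j
pow-+ x zero    j = sym (*-identityˡ _)
pow-+ x (suc i) j = trans (cong (x ⊗_) (pow-+ x i j)) (sym (*-assoc x (pow x i) (pow x j)))

pow-period : ∀ x d → pow x d ≡ 𝟙 → ∀ i j → pow x (i ℕ.+ j ℕ.* d) ≡ pow x i
pow-period x d eq i j = trans (pow-+ x i (j ℕ.* d)) (trans (cong (pow x i ⊗_) (ones j)) (*-identityʳ _))
  where
  ones : ∀ j → pow x (j ℕ.* d) ≡ 𝟙
  ones zero    = refl
  ones (suc j) = trans (pow-+ x d (j ℕ.* d)) (cong₂ _⊗_ eq (ones j))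

pow-square : ∀ x j → pow (x ⊗ x) j ≡ pow x (2 ℕ.* j)
pow-square x zero    = refl
pow-square x (suc j) = trans (*-assoc x x _)
  (trans (cong (λ y → x ⊗ (x ⊗ y)) (pow-square x j)) (cong (pow x ∘ suc) (sym (ℕ.+-suc j (j ℕ.+ 0)))))

∏-if : ∀ {k} x (p : Fin k → Bool) → ∏ (λ i → if p i then x else 𝟙) ≡ pow x (countFin p)
∏-if {zero}  x p = refl
∏-if {suc k} x p with p zero
... | true  = cong (x ⊗_) (∏-if x (p ∘ suc))
... | false = trans (*-identityˡ _) (∏-if x (p ∘ suc))

-- A primitive cube root of unity, −ω̄; its square is −ω.
η : ℤω
η = ⊖ ω̄

ψ-weight : Psi → ℕ
ψ-weight ψ₁ = 1
ψ-weight ψ₂ = 3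
ψ-weight ψ₃ = 4
ψ-weight ψ₄ = 0

-- Because η³ = 1, the exponent 2b stands for -b, and a - b may be replaced by its residue modulo 6.
-- The doubled exponent keeps the powers natural.
η-mod-6 : ∀ a b → pow η (a ℕ.+ 2 ℕ.* b) ≡ pow η (((+ a) ℤ.- (+ b)) %ℕ 6)
η-mod-6 a b = by-quotient (d /ℕ 6) (ℤ.a≡a%ℕn+[a/ℕn]*n d 6)
  where
  open +-*-Solver
  d = (+ a) ℤ.- (+ b)
  r = d %ℕ 6
  open import Data.Integer using (_+_; _*_; _-_; -_)
  a≡ : ∀ x y z → x - y ≡ z → x ≡ z + y
  a≡ x y z refl = lemma x y
    where
    lemma : ∀ x y → x ≡ x - y + y
    lemma = solve-∀
  by-quotient : ∀ q → d ≡ + r ℤ.+ q ℤ.* + 6 → pow η (a ℕ.+ 2 ℕ.* b) ≡ pow η r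
  by-quotient (+ q) eq = trans (cong (λ x → pow η (x ℕ.+ 2 ℕ.* b)) ≡ℕ) (trans (cong (pow η) (arith r q b)) (pow-period η 3 refl r (2 ℕ.* q ℕ.+ b)))
    where
    ≡ℕ : a ≡ r ℕ.+ q ℕ.* 6 ℕ.+ b
    ≡ℕ = ℤ.+-injective (trans (a≡ (+ a) (+ b) _ eq) (cong (λ x → + r ℤ.+ x ℤ.+ + b) (sym (ℤ.pos-* q 6))))
    arith : ∀ r q b → r ℕ.+ q ℕ.* 6 ℕ.+ b ℕ.+ 2 ℕ.* b ≡ r ℕ.+ (2 ℕ.* q ℕ.+ b) ℕ.* 3
    arith = solve 3 (λ r q b → r :+ q :* con 6 :+ b :+ con 2 :* b := r :+ (con 2 :* q :+ b) :* con 3) refl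
  -- A negative quotient cannot be subtracted in ℕ, so `2 ℕ.* suc q` periods of length 3 are added
  -- on the left first.
  by-quotient -[1+ q ] eq = trans (sym (pow-period η 3 refl (a ℕ.+ 2 ℕ.* b) (2 ℕ.* suc q)))
    (trans (cong (pow η) (trans (arith a b (suc q)) (trans (cong (λ x → x ℕ.+ 2 ℕ.* b) ≡ℕ) (arith' r b)))) (pow-period η 3 refl r b))
    where
    move : ∀ x y r s → x - y ≡ r + (- s) * + 6 → x + s * + 6 ≡ r + y
    move x y r s e = trans (lemma x y s) (trans (cong (λ z → z + y + s * + 6) e) (lemma' r s y))
      where
      lemma : ∀ x y s → x + s * + 6 ≡ x - y + y + s * + 6
      lemma = solve-∀
      lemma' : ∀ r s y → r + (- s) * + 6 + y + s * + 6 ≡ r + y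
      lemma' = solve-∀
    ≡ℕ : a ℕ.+ suc q ℕ.* 6 ≡ r ℕ.+ b
    ≡ℕ = ℤ.+-injective (trans (cong (λ x → + a ℤ.+ x) (ℤ.pos-* (suc q) 6)) (move (+ a) (+ b) (+ r) (+ suc q) eq))
    arith : ∀ a b s → a ℕ.+ 2 ℕ.* b ℕ.+ 2 ℕ.* s ℕ.* 3 ≡ a ℕ.+ s ℕ.* 6 ℕ.+ 2 ℕ.* b
    arith = solve 3 (λ a b s → a :+ con 2 :* b :+ con 2 :* s :* con 3 := a :+ s :* con 6 :+ con 2 :* b) refl
    arith' : ∀ r b → r ℕ.+ b ℕ.+ 2 ℕ.* b ≡ r ℕ.+ b ℕ.* 3
    arith' = solve 2 (λ r b → r :+ b :+ con 2 :* b := r :+ b :* con 3) refl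

-- Only the parity of `c` matters, since (-1)² = 1; the twelve remaining cases are computed in ℤ[ω].
ψ-norm : ∀ r c → r ℕ.< 6 → N (𝟙 ⊕ ⊖ (pow η r ⊗ pow (⊖ 𝟙) c)) ≡ fromℕ (ψ-weight (psiOf r c))
ψ-norm r c r<6 = trans (cong (λ x → N (𝟙 ⊕ ⊖ (pow η r ⊗ x))) parity) (table r (c ℕ.% 2) r<6 (ℕ.m%n<n c 2))
  where
  parity : pow (⊖ 𝟙) c ≡ pow (⊖ 𝟙) (c ℕ.% 2)
  parity = trans (cong (pow (⊖ 𝟙)) (ℕ.m≡m%n+[m/n]*n c 2)) (pow-period (⊖ 𝟙) 2 refl (c ℕ.% 2) (c ℕ./ 2))
  table : ∀ r s → r ℕ.< 6 → s ℕ.< 2 → N (𝟙 ⊕ ⊖ (pow η r ⊗ pow (⊖ 𝟙) s))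
    ≡ fromℕ (ψ-weight (if does (r ℕ.≟ 0) ∨ does (r ℕ.≟ 3)
        then (if does (s ℕ.≟ 1) then ψ₃ else ψ₄) else (if does (s ℕ.≟ 1) then ψ₁ else ψ₂)))
  table 0 0 _ _ = refl
  table 0 1 _ _ = refl
  table 1 0 _ _ = refl
  table 1 1 _ _ = refl
  table 2 0 _ _ = refl
  table 2 1 _ _ = refl
  table 3 0 _ _ = refl
  table 3 1 _ _ = refl
  table 4 0 _ _ = refl
  table 4 1 _ _ = refl
  table 5 0 _ _ = refl
  table 5 1 _ _ = refl
  table _ (suc (suc _)) _ (s≤s (s≤s ()))
  table (suc (suc (suc (suc (suc (suc _)))))) _ (s≤s (s≤s (s≤s (s≤s (s≤s (s≤s ())))))) _

-- Enumerations of subsets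

enumAs-enumerates : ∀ {m k} (p : Subset m) (eq : ∣ p ∣ ≡ k) → Enumerates p (enumAs p eq)
enumAs-enumerates p refl = record
  { injective = λ i j e → cast-injective i j (enum-injective p _ _ e)
  ; member    = λ i → enum-member p _
  ; index     = λ v∈ → let i , e = enum-index p v∈ in i , trans (cong (enum p) (cast-is-id refl i)) e
  }
  where
  cast-injective : ∀ {k} (i j : Fin k) → cast refl i ≡ cast refl j → i ≡ j
  cast-injective i j e = trans (sym (cast-is-id refl i)) (trans e (cast-is-id refl j))
  enum-injective : ∀ {m} (p : Subset m) i j → enum p i ≡ enum p j → i ≡ j
  enum-injective (true  ∷ p) zero    zero    e = refl
  enum-injective (true  ∷ p) (suc i) (suc j) e = cong suc (enum-injective p i j (suc-injective e))
  enum-injective (false ∷ p) i       j       e = enum-injective p i j (suc-injective e)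
  enum-member : ∀ {m} (p : Subset m) i → enum p i ∈ p
  enum-member (true  ∷ p) zero    = here
  enum-member (true  ∷ p) (suc i) = there (enum-member p i)
  enum-member (false ∷ p) i       = there (enum-member p i)
  enum-index : ∀ {m} (p : Subset m) {v} → v ∈ p → ∃ λ i → enum p i ≡ v
  enum-index (true  ∷ p) here      = zero , refl
  enum-index (true  ∷ p) (there q) = let i , e = enum-index p q in suc i , cong suc e
  enum-index (false ∷ p) (there q) = let i , e = enum-index p q in i , cong suc e

elems⁺ : ∀ {n} {p : Subset n} {v} → v ∈ p → v List.∈ elems p
elems⁺ {p = true  ∷ p} here      = Any.here refl
elems⁺ {p = true  ∷ p} (there q) = Any.there (List.∈-map⁺ suc (elems⁺ q))
elems⁺ {p = false ∷ p} (there q) = List.∈-map⁺ suc (elems⁺ q)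

elems⁻ : ∀ {n} (p : Subset n) {v} → v List.∈ elems p → v ∈ p
elems⁻ (true  ∷ p) (Any.here refl) = here
elems⁻ (true  ∷ p) (Any.there q) with List.∈-map⁻ suc q
... | _ , q' , refl = there (elems⁻ p q')
elems⁻ (false ∷ p) q with List.∈-map⁻ suc q
... | _ , q' , refl = there (elems⁻ p q')

elems-unique : ∀ {n} (p : Subset n) → Unique (elems p)
elems-unique []          = AllPairs.[]
elems-unique (true  ∷ p) = All.map⁺ (All.universal (λ _ ()) _) AllPairs.∷ Unique.map⁺ suc-injective (elems-unique p)
elems-unique (false ∷ p) = Unique.map⁺ suc-injective (elems-unique p)

lookup-injective : ∀ {A : Set} {xs : List A} → Unique xs → ∀ i j → lookup xs i ≡ lookup xs j → i ≡ j
lookup-injective (_ AllPairs.∷ _)  zero    zero    eq = refl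
lookup-injective (x∉ AllPairs.∷ _) zero    (suc j) eq = contradiction eq (All.lookup x∉ (List.∈-lookup j))
lookup-injective (x∉ AllPairs.∷ _) (suc i) zero    eq = contradiction (sym eq) (All.lookup x∉ (List.∈-lookup i))
lookup-injective (_ AllPairs.∷ u)  (suc i) (suc j) eq = cong suc (lookup-injective u i j eq)

length-elems : ∀ {n} (p : Subset n) → length (elems p) ≡ ∣ p ∣
length-elems []          = refl
length-elems (true  ∷ p) = cong suc (trans (length-map suc (elems p)) (length-elems p))
length-elems (false ∷ p) = trans (length-map suc (elems p)) (length-elems p)

elems-enumerates : ∀ {n} (p : Subset n) → Enumerates p (lookup (elems p))
elems-enumerates p = record
  { injective = λ i j → lookup-injective (elems-unique p) i j
  ; member    = λ i → elems⁻ p (List.∈-lookup i)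
  ; index     = λ v∈ → Any.index (elems⁺ v∈) , sym (lookup-index (elems⁺ v∈))
  }

-- The Gram factorisation of Q and the norms of the minors

module _ {n m : ℕ} (G : MixedGraph n m) (simple : IsSimple G) where
  open Incidence ω̄ refl G simple

  -- Checked edge by edge. At each end of an edge the entry is a unit, which counts the degree on
  -- the diagonal; for the two ends of a directed edge the products are 1 · conj ω̄ = ω and ω̄ · 1 =
  -- ω̄.
  QMat-gram : ∀ i j → QMat G i j ≡ ∑ (λ e → entry e i ⊗ conj (entry e j))
  QMat-gram i j = trans (cong ((if eqb G i j then fromℕ (degree G i) else 𝟘) ⊕_) (sumFin≡∑ (λ e → nEntry G e i j)))
    (trans (cong (_⊕ ∑ (λ e → nEntry G e i j)) diagonal)
      (trans (sym (∑-+ (λ e → if eqb G i j then ends e else 𝟘) (λ e → nEntry G e i j))) (∑-cong term)))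
    where
    ends : Fin m → ℤω
    ends e = if eqb G (src (G e)) i ∨ eqb G (tgt (G e)) i then 𝟙 else 𝟘

    fromℕ-count : ∀ {k} (p : Fin k → Bool) → fromℕ (countFin p) ≡ ∑ (λ e → if p e then 𝟙 else 𝟘)
    fromℕ-count {zero}  p = refl
    fromℕ-count {suc k} p with p zero
    ... | true  = cong (𝟙 ⊕_) (fromℕ-count (p ∘ suc))
    ... | false = cong (𝟘 ⊕_) (fromℕ-count (p ∘ suc))

    diagonal : (if eqb G i j then fromℕ (degree G i) else 𝟘) ≡ ∑ (λ e → if eqb G i j then ends e else 𝟘)
    diagonal with eqb G i j
    ... | true  = fromℕ-count (λ e → eqb G (src (G e)) i ∨ eqb G (tgt (G e)) i)
    ... | false = sym (∑-zero {m} {λ _ → 𝟘} (λ _ → refl))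

    term : ∀ e → (if eqb G i j then ends e else 𝟘) ⊕ nEntry G e i j ≡ entry e i ⊗ conj (entry e j)
    term e with i F.≟ j
    ... | yes refl = diag
      where
      diag : ends e ⊕ nEntry G e i i ≡ entry e i ⊗ conj (entry e i)
      diag with src (G e) F.≟ i | tgt (G e) F.≟ i
      ... | yes p | yes q = contradiction (trans p (sym q)) (proj₁ simple e)
      ... | yes _ | no _  = refl
      ... | no _  | no _  = refl
      ... | no _  | yes _ with directed (G e)
      ...   | true  = refl
      ...   | false = refl
    ... | no i≢j = off
      where
      off : 𝟘 ⊕ nEntry G e i j ≡ entry e i ⊗ conj (entry e j)
      off with src (G e) F.≟ i | tgt (G e) F.≟ i | src (G e) F.≟ j | tgt (G e) F.≟ j | directed (G e)
      ... | yes p | yes q | _     | _     | _     = contradiction (trans p (sym q)) (proj₁ simple e)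
      ... | _     | _     | yes p | yes q | _     = contradiction (trans p (sym q)) (proj₁ simple e)
      ... | yes p | _     | yes q | _     | _     = contradiction (trans (sym p) q) i≢j
      ... | _     | yes p | _     | yes q | _     = contradiction (trans (sym p) q) i≢j
      ... | yes _ | no _  | no _  | yes _ | true  = refl
      ... | yes _ | no _  | no _  | yes _ | false = refl
      ... | yes _ | no _  | no _  | no _  | _     = refl
      ... | no _  | yes _ | yes _ | no _  | true  = refl
      ... | no _  | yes _ | yes _ | no _  | false = refl
      ... | no _  | yes _ | no _  | no _  | true  = refl
      ... | no _  | yes _ | no _  | no _  | false = refl
      ... | no _  | no _  | yes _ | no _  | _     = refl
      ... | no _  | no _  | no _  | yes _ | true  = refl
      ... | no _  | no _  | no _  | yes _ | false = refl
      ... | no _  | no _  | no _  | no _  | _     = refl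

  module _ {k} (V₁ : Subset n) (E₁ : Subset m)
    {ιV : Fin k → Fin n} (enumV : Enumerates V₁ ιV) {ιE : Fin k → Fin m} (enumE : Enumerates E₁ ιE) where
    open Structure G simple V₁ E₁ enumV enumE
    open Substructure G V₁ E₁
    open Minor V₁ E₁ enumV enumE

    kind-weight : Kind → ℕ
    kind-weight tree    = 1
    kind-weight (uni p) = ψ-weight p

    module _ (C : Components) where
      open Components C
      open InComponents C
      open Labelled C

      module _ {l} (Cy : Cycle l) where
        open Cycle Cy
        open CycleWeight C Cy using (q)

        infix 8 _when_
        _when_ : ℤω → Bool → ℤω
        x when p = if p then x else 𝟙

        -- Both directed values are powers of `η`, so the product over the cycle depends only on the
        -- counts `a`, `b` and `c`.
        q-classified : ∀ i → q i ≡ (η when along i) ⊗ ((η ⊗ η) when against i) ⊗ ((⊖ 𝟙) when undirected i)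
        q-classified i = by-orientation (esJ i)
          where
          by-orientation : Joins G (es i) (vs i) (vs (next i)) → q i ≡ (η when along i) ⊗ ((η ⊗ η) when against i) ⊗ ((⊖ 𝟙) when undirected i)
          by-orientation _ with src (G (es i)) F.≟ vs i | tgt (G (es i)) F.≟ vs i
            | src (G (es i)) F.≟ vs (next i) | tgt (G (es i)) F.≟ vs (next i) | directed (G (es i))
          by-orientation _ | yes p | yes q | _ | _ | _ = contradiction (trans p (sym q)) (proj₁ simple _)
          by-orientation _ | _ | _ | yes p | yes q | _ = contradiction (trans p (sym q)) (proj₁ simple _)
          by-orientation (inj₁ (p , _)) | no ¬p | _ | _ | _ | _ = contradiction p ¬p
          by-orientation (inj₁ (_ , q)) | _ | _ | _ | no ¬q | _ = contradiction q ¬q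
          by-orientation (inj₂ (p , _)) | _ | _ | no ¬p | _ | _ = contradiction p ¬p
          by-orientation (inj₂ (_ , q)) | _ | no ¬q | _ | _ | _ = contradiction q ¬q
          by-orientation (inj₁ _) | yes _ | no _ | no _ | yes _ | true  = refl
          by-orientation (inj₁ _) | yes _ | no _ | no _ | yes _ | false = refl
          by-orientation (inj₂ _) | no _ | yes _ | yes _ | no _ | true  = refl
          by-orientation (inj₂ _) | no _ | yes _ | yes _ | no _ | false = refl

        ∏q : ∏ q ≡ pow η (((+ a) ℤ.- (+ b)) %ℕ 6) ⊗ pow (⊖ 𝟙) c
        ∏q = begin
          ∏ q
            ≡⟨ ∏-cong q-classified ⟩
          ∏ (λ i → (η when along i) ⊗ ((η ⊗ η) when against i) ⊗ ((⊖ 𝟙) when undirected i))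
            ≡⟨ ∏-* (λ i → (η when along i) ⊗ ((η ⊗ η) when against i)) (λ i → (⊖ 𝟙) when undirected i) ⟩
          ∏ (λ i → (η when along i) ⊗ ((η ⊗ η) when against i)) ⊗ ∏ (λ i → (⊖ 𝟙) when undirected i)
            ≡⟨ cong₂ _⊗_ (∏-* (λ i → η when along i) (λ i → (η ⊗ η) when against i)) (∏-if (⊖ 𝟙) undirected) ⟩
          ∏ (λ i → η when along i) ⊗ ∏ (λ i → (η ⊗ η) when against i) ⊗ pow (⊖ 𝟙) c
            ≡⟨ cong (_⊗ pow (⊖ 𝟙) c) (cong₂ _⊗_ (∏-if η along) (trans (∏-if (η ⊗ η) against) (pow-square η b))) ⟩
          pow η a ⊗ pow η (2 ℕ.* b) ⊗ pow (⊖ 𝟙) c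
            ≡⟨ cong (_⊗ pow (⊖ 𝟙) c) (trans (sym (pow-+ η a (2 ℕ.* b))) (η-mod-6 a b)) ⟩
          pow η (((+ a) ℤ.- (+ b)) %ℕ 6) ⊗ pow (⊖ 𝟙) c ∎
          where open ≡-Reasoning

      weight-kind : ∀ {l} (c : Root l ⊎ Cycle l) → weight C c ≡ fromℕ (kind-weight (kindOf c))
      weight-kind (inj₁ _)  = refl
      weight-kind (inj₂ Cy) = trans (cong (λ x → N (𝟙 ⊕ ⊖ x)) (∏q Cy))
        (ψ-norm (((+ Cycle.a Cy) ℤ.- (+ Cycle.b Cy)) %ℕ 6) (Cycle.c Cy) (ℤ.n%ℕd<d ((+ Cycle.a Cy) ℤ.- (+ Cycle.b Cy)) 6))

      -- Any decomposition with any choice will do. It is used with the kinds of a given structure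
      -- of type II, and again with the choice that a matching provides.
      norm-of-choice : (choice : ∀ l → Root l ⊎ Cycle l) → N (determinant M) ≡ ∏ (λ l → fromℕ (kind-weight (kindOf (choice l))))
      norm-of-choice choice = let height , parent = Chosen.parents choice in
        trans (ForestNorm.norm-determinant C choice height (λ i → parent _ (V.member i))) (∏-cong (λ l → weight-kind (choice l)))

    module _ (T : TypeII) where
      open TypeII T
      open Labelled comps using (Root; kindOf)

      kinds-product : ∀ {t} (kind : Fin t → Kind) → (∀ l → kind l ≢ uni ψ₄)
        → ∏ (λ l → fromℕ (kind-weight (kind l))) ≡ fromℕ (3 ^ countFin (λ l → isUni ψ₂ (kind l)) ℕ.* 4 ^ countFin (λ l → isUni ψ₃ (kind l)))
      kinds-product {zero}  kind ok = refl
      kinds-product {suc t} kind ok = trans (cong (fromℕ (kind-weight (kind zero)) ⊗_) (kinds-product (kind ∘ suc) (ok ∘ suc)))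
        (trans (sym (fromℕ-* (kind-weight (kind zero)) _)) (cong fromℕ (first (kind zero) (ok zero))))
        where
        x = countFin (λ l → isUni ψ₂ (kind (suc l)))
        y = countFin (λ l → isUni ψ₃ (kind (suc l)))
        open +-*-Solver
        first : ∀ κ → κ ≢ uni ψ₄ → kind-weight κ ℕ.* (3 ^ x ℕ.* 4 ^ y)
          ≡ 3 ^ ((if isUni ψ₂ κ then 1 else 0) ℕ.+ x) ℕ.* 4 ^ ((if isUni ψ₃ κ then 1 else 0) ℕ.+ y)
        first tree     _  = ℕ.*-identityˡ _
        first (uni ψ₁) _  = ℕ.*-identityˡ _
        first (uni ψ₂) _  = sym (ℕ.*-assoc 3 (3 ^ x) (4 ^ y))
        first (uni ψ₃) _  = solve 2 (λ u v → con 4 :* (u :* v) := u :* (con 4 :* v)) refl (3 ^ x) (4 ^ y)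
        first (uni ψ₄) ne = contradiction refl ne

      choose : ∀ l → Σ (Root l ⊎ Cycle l) (λ c → kindOf c ≡ kind l)
      choose l = by-kind (kind l) refl
        where
        by-kind : ∀ κ → kind l ≡ κ → Σ (Root l ⊎ Cycle l) (λ c → kindOf c ≡ κ)
        by-kind tree eq = let _ , _ , e , (e-in , one) , _ = proj₁ (kindOK l) eq in inj₁ (e , e-in , one) , refl
        by-kind (uni p) eq = let _ , Cy , ψ≡p = proj₂ (kindOK l) p eq in inj₂ Cy , cong uni ψ≡p

      norm-typeII : N (determinant M) ≡ fromℕ (3 ^ τ₁ ℕ.* 4 ^ τ₂)
      norm-typeII = trans (norm-of-choice comps (proj₁ ∘ choose))
        (trans (∏-cong (λ l → cong (fromℕ ∘ kind-weight) (proj₂ (choose l)))) (kinds-product kind notΨ₄))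

    -- A nonzero norm forces a nonzero determinant, whose transversal matches every edge with one of
    -- its ends in `V₁`. A chosen cycle in Ψ₄ would put a factor 0 into the norm, so there is none.
    norm≢0⇒typeII : Fin k → N (determinant M) ≢ 𝟘 → TypeII
    norm≢0⇒typeII r₀ nz = let height , parent = Chosen.parents choice in
      Forest.typeII height (λ i → parent _ (V.member i)) (λ l ψ₄l → nz (trans (norm-of-choice components choice)
        (∏-zero (λ l → fromℕ (kind-weight (kindOf (choice l)))) l (cong (fromℕ ∘ kind-weight) ψ₄l))))
      where
      open Transversal (det≢0⇒transversal M (λ z → nz (cong N z)))
      open Matched r₀ col-inj (λ r → entry-end (nonzero r))
      open Labelled components
      open Chosen choice
      open Heights using (module Forest)

    -- In the second alternative the norm is tested against 0: a nonzero value would yield the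
    -- structure of type II that the alternative excludes.
    norm-weight : Fin k → ∀ {x} → WeightOf x → N (determinant M) ≡ fromℕ x
    norm-weight r₀ (inj₁ (T , refl)) = norm-typeII T
    norm-weight r₀ (inj₂ (¬T , refl)) with N (determinant M) ≟ω 𝟘
    ... | yes z = z
    ... | no nz = contradiction (norm≢0⇒typeII r₀ nz) ¬T

theorem2p8 : ∀ {n m : ℕ} (G : MixedGraph n m) → IsSimple G → IsConnected G
    → (V₁ : Subset n) → Nonempty V₁
    → (w : Subset m → ℕ)
    → (∀ E₁ → ∣ E₁ ∣ ≡ ∣ V₁ ∣ → Substructure.WeightOf G V₁ E₁ (w E₁))
    → det (principal (QMat G) V₁) ≡ fromℕ (sumSubsetsOfSize ∣ V₁ ∣ w)
theorem2p8 {n} {m} G simple _ V₁ (v₀ , v₀∈) w hw = begin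
  det (principal (QMat G) V₁)
    ≡⟨ det≡determinant (principal (QMat G) V₁) ⟩
  determinant (principal (QMat G) V₁)
    ≡⟨ det-cong (λ i j → QMat-gram G simple (ι i) (ι j)) ⟩
  determinant (λ i j → ∑ (λ e → A e i ⊗ conj (A e j)))
    ≡⟨ cauchy-binet m det-alternating A (λ e j → conj (A e j)) ⟩
  ∑⊆ m k (λ p eq → determinant (A ∘ enumAs p eq) ⊗ determinant (λ r j → conj (A (enumAs p eq r) j)))
    ≡⟨ ∑⊆-cong m k (λ p eq → trans
         (cong (determinant (A ∘ enumAs p eq) ⊗_) (sym (conj-determinant (A ∘ enumAs p eq))))
         (norm-weight G simple V₁ p enumV (enumAs-enumerates p eq) r₀ (hw p (trans eq (length-elems V₁))))) ⟩
  ∑⊆ m k (λ p _ → fromℕ (w p))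
    ≡⟨ sumSubsetsOfSize≡∑⊆ m k w ⟨
  fromℕ (sumSubsetsOfSize k w)
    ≡⟨ cong (λ k → fromℕ (sumSubsetsOfSize k w)) (length-elems V₁) ⟩
  fromℕ (sumSubsetsOfSize ∣ V₁ ∣ w) ∎
  where
  open ≡-Reasoning
  open Incidence ω̄ refl G simple using (entry)
  k : ℕ
  k = length (elems V₁)
  ι : Fin k → Fin n
  ι = lookup (elems V₁)
  enumV : Enumerates V₁ ι
  enumV = elems-enumerates V₁
  r₀ : Fin k
  r₀ = proj₁ (Enumerates.index enumV v₀∈)
  A : Mat m k
  A e i = entry e (ι i)
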